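{- Let $N\ge1$, $w\ge0$, $k=w+2$ with $(k,N)\ne(2,1)$, and $\Gamma=\Gamma_1(N)$. Let $P\in\bar W_w^{\Gamma,+}$, put $Q=P|_U$ and $Q^{\pm}=\tfrac12 Q|_{1\pm\epsilon}\in\bar V_w^{\Gamma,\pm}$. Then $Q^-\in\bar V_w^{\Gamma,-,\mathrm{sym}}:=\{u\in\bar V_w^{\Gamma,- }:u|_{\epsilon S}=u\}$ and \[ 3\lambda(Q^+)=-\lambda(Q^-)-\lambda^{\mathcal{S}}(Q)\in\mathcal{P}_{k,N}^{\mathrm{ev}}. \] Conversely, for $R\in\bar V_w^{\Gamma,+}$, $\lambda(R)\in\mathcal{P}_{k,N}^{\mathrm{ev}}$ if and only if $R=\tfrac12 P|_{U(1+\epsilon)}$ for some $P\in\bar W_w^{\Gamma,+}$.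
   Context: $V_w$ is the $\mathbb{Q}$-space of homogeneous degree-$w$ polynomials in $X,Y$, with right $\mathrm{GL}(2,\mathbb{Z})$-action $P|_\gamma(X,Y)=P(aX+bY,cX+dY)$ for $\gamma=\begin{pmatrix}a&b\\c&d\end{pmatrix}$. $\epsilon=\begin{pmatrix}-1&0\\0&1\end{pmatrix}$, $J=-I$, $S=\begin{pmatrix}0&-1\\1&0\end{pmatrix}$, $U=\begin{pmatrix}1&-1\\1&0\end{pmatrix}$. $\bar V_w^\Gamma$ is the space of maps $P:\Gamma\backslash\mathrm{SL}(2,\mathbb{Z})\to V_w$ with $P|_J=P$, with right action $P|_\gamma(C)=P(C\gamma^{ -1})|_\gamma$ for $\gamma\in\mathrm{SL}(2,\mathbb{Z})$ and $P|_\epsilon(C)=P(J\epsilon C\epsilon)|_\epsilon$, extended linearly to the group ring; $\bar V_w^{\Gamma,\pm}=\{P:P|_\epsilon=\pm P\}$ and $\bar W_w^{\Gamma,+}=\{P\in\bar V_w^{\Gamma}:P|_{1+S}=P|_{1+U+U^2}=0,\ P|_\epsilon=P\}$. $A(N)=\{(a,b)\in(\mathbb{Z}/N\mathbb{Z})^2:\gcd(a,b,N)=1\}$; $\Gamma_1(N)$ is the group of matrices in $\mathrm{SL}(2,\mathbb{Z})$ congruent to $\begin{pmatrix}1&*\\0&1\end{pmatrix}$ mod $N$; $C_{a,b}$ is the coset in $\Gamma_1(N)\backslash\mathrm{SL}(2,\mathbb{Z})$ of matrices with bottom row $\equiv(a,b)\bmod N$ (a bijection with $A(N)$). $\mathcal{D}_{k,N}$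 is the $\mathbb{Q}$-vector space with generators $Z_{a,b}^{r,s},P_{a,b}^{r,s},Z_c^k$ ($r,s\ge1$, $r+s=k$, $(a,b)\in A(N)$, $c\in\mathbb{Z}/N\mathbb{Z}$) and relations $P_{a,b}^{r,s}=\sum_{j=0}^{r-1}\binom{s-1+j}{j}Z_{a-b,b}^{r-j,s+j}+\sum_{j=0}^{s-1}\binom{r-1+j}{j}Z_{b-a,a}^{s-j,r+j}=Z_{a,b}^{r,s}+Z_{b,a}^{s,r}+Z_{a+b}^{r+s}$. $\mathcal{P}_{k,N}^{\mathrm{ev}}$ is the subspace spanned by all $P_{a,b}^{r,s}+(-1)^rP_{ -a,b}^{r,s}+(-1)^sP_{a,-b}^{r,s}+(-1)^{r+s}P_{ -a,-b}^{r,s}$ and all $Z_a^k+(-1)^kZ_{ -a}^k$. For maps $P:\Gamma\backslash\mathrm{SL}(2,\mathbb{Z})\to V_w$: $\lambda(P)=\sum_{C}\lambda_C(P(CS))$ and $\lambda^{\mathcal{S}}(P)=\sum_C\lambda^{\mathcal{S}}_C(P(CS))$, sums over $C\in\Gamma\backslash\mathrm{SL}(2,\mathbb{Z})$, where $\lambda_{C_{a,b}},\lambda^{\mathcal{S}}_{C_{a,b}}:V_w\to\mathcal{D}_{k,N}$ are the linear maps $X^rY^s\mapsto r!\,s!\,Z_{a,b}^{r+1,s+1}$ and $X^rY^s\mapsto r!\,s!\,Z_{a+b}^{r+s+2}$, respectively. -}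

module Defs where

open import Data.Nat as ℕ using (ℕ; zero; suc; NonZero; _≡ᵇ_; _!)
open import Data.Nat.GCD using (gcd)
open import Data.Nat.Combinatorics using (_C_)
open import Data.Fin as Fin using (Fin; toℕ; fromℕ<)
open import Data.Integer as ℤ using (ℤ; +_)
open import Data.Rational as ℚ using (ℚ; 0ℚ; 1ℚ; ½)
open import Data.List using (List; []; _∷_; map; foldr; upTo; allFin; concatMap)
open import Data.Bool using (Bool; true; false; if_then_else_; _∧_)
open import Data.Product using (Σ; _×_; _,_; proj₁; proj₂; ∃)
open import Data.List.Relation.Unary.All using (All)
open import Relation.Binary.PropositionalEquality using (_≡_)
open import Data.Unit using (⊤)

sumℚ : List ℚ → ℚ
sumℚ = foldr ℚ._+_ 0ℚ

ℤ→ℚ : ℤ → ℚ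
ℤ→ℚ z = z ℚ./ 1

ℕ→ℚ : ℕ → ℚ
ℕ→ℚ n = (+ n) ℚ./ 1

3ℚ : ℚ
3ℚ = + 3 ℚ./ 1

record M2 : Set where
  constructor mat
  field
    a b c d : ℤ

infixl 7 _⊗_
_⊗_ : M2 → M2 → M2
mat a b c d ⊗ mat a' b' c' d' =
  mat (a ℤ.* a' ℤ.+ b ℤ.* c') (a ℤ.* b' ℤ.+ b ℤ.* d')
      (c ℤ.* a' ℤ.+ d ℤ.* c') (c ℤ.* b' ℤ.+ d ℤ.* d')

-- inverse of a determinant-one matrix
inv₁ : M2 → M2
inv₁ (mat a b c d) = mat d (ℤ.- b) (ℤ.- c) a

εM JM SM UM : M2
εM = mat (ℤ.- + 1) (+ 0) (+ 0) (+ 1)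
JM = mat (ℤ.- + 1) (+ 0) (+ 0) (ℤ.- + 1)
SM = mat (+ 0) (ℤ.- + 1) (+ 1) (+ 0)
UM = mat (+ 1) (ℤ.- + 1) (+ 1) (+ 0)

module Setup (N : ℕ) .{{_ : NonZero N}} (w : ℕ) where

  k : ℕ
  k = w ℕ.+ 2

  red : ℤ → Fin N
  red z = fromℕ< (ℤ.n%ℕd<d z N)
    where import Data.Integer.DivMod as ℤ

  toZ : Fin N → ℤ
  toZ x = + toℕ x

  _⊕_ _⊖_ : Fin N → Fin N → Fin N
  x ⊕ y = red (toZ x ℤ.+ toZ y)
  x ⊖ y = red (toZ x ℤ.- toZ y)

  ⊝_ : Fin N → Fin N
  ⊝ x = red (ℤ.- toZ x)

  isAᵇ : Fin N → Fin N → Bool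
  isAᵇ x y = gcd (gcd (toℕ x) (toℕ y)) N ≡ᵇ 1

  IsA : Fin N → Fin N → Set
  IsA x y = gcd (gcd (toℕ x) (toℕ y)) N ≡ 1

  pairs : List (Fin N × Fin N)
  pairs = concatMap (λ x → map (λ y → (x , y)) (allFin N)) (allFin N)

  rowMul : Fin N → Fin N → M2 → Fin N × Fin N
  rowMul x y (mat a b c d) =
    red (toZ x ℤ.* a ℤ.+ toZ y ℤ.* c) , red (toZ x ℤ.* b ℤ.+ toZ y ℤ.* d)

  -- V_w : homogeneous polynomials of degree w over ℚ;
  -- v i = coefficient of X^i Y^(w-i).

  V : Set
  V = Fin (suc w) → ℚ

  -- P|γ (X,Y) = P(aX+bY, cX+dY); coefficient of X^m Y^(w-m) of
  -- Σ_r p_r (aX+bY)^r (cX+dY)^(w-r)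
  actV : M2 → V → V
  actV (mat a b c d) p m = sumℚ (map term (allFin (suc w)))
    where
      term : Fin (suc w) → ℚ
      term r = p r ℚ.* sumℚ (map inner (upTo (suc (toℕ m))))
        where
          rr = toℕ r
          sr = w ℕ.∸ rr
          mm = toℕ m
          inner : ℕ → ℚ
          inner i = ℕ→ℚ ((rr C i) ℕ.* (sr C (mm ℕ.∸ i)))
                    ℚ.* ℤ→ℚ ((a ℤ.^ i) ℤ.* (b ℤ.^ (rr ℕ.∸ i))
                             ℤ.* (c ℤ.^ (mm ℕ.∸ i)) ℤ.* (d ℤ.^ (sr ℕ.∸ (mm ℕ.∸ i))))

  -- Maps Γ₁(N)\SL(2,Z) → V_w.  The coset C_{a,b} is indexed by its bottom
  -- row (a,b) ∈ A(N); a map is given as a function on all of (Z/NZ)^2,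
  -- of which only the values on A(N) matter (equality is on A(N)).

  Map : Set
  Map = Fin N → Fin N → V

  _≈M_ : Map → Map → Set
  P ≈M Q = ∀ x y → IsA x y → ∀ i → P x y i ≡ Q x y i

  _+M_ : Map → Map → Map
  (P +M Q) x y i = P x y i ℚ.+ Q x y i

  _*M_ : ℚ → Map → Map
  (q *M P) x y i = q ℚ.* P x y i

  _-M_ : Map → Map → Map
  (P -M Q) x y i = P x y i ℚ.- Q x y i

  0M : Map
  0M _ _ _ = 0ℚ

  _∣_ : Map → M2 → Map
  (P ∣ γ) x y = actV γ (P (proj₁ r) (proj₂ r))
    where r = rowMul x y (inv₁ γ)

  -- P|ε (C) = P(JεCε)|ε ; JεCε has bottom row (c,-d) if C has bottom row (c,d)
  _∣ε : Map → Map
  (P ∣ε) x y = actV εM (P x (⊝ y))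

  InVbar : Map → Set
  InVbar P = (P ∣ JM) ≈M P

  InVbar⁺ InVbar⁻ : Map → Set
  InVbar⁺ P = InVbar P × ((P ∣ε) ≈M P)
  InVbar⁻ P = InVbar P × ((P ∣ε) ≈M ((ℚ.- 1ℚ) *M P))

  InVbar⁻sym : Map → Set
  InVbar⁻sym u = InVbar⁻ u × (((u ∣ε) ∣ SM) ≈M u)

  InW⁺ : Map → Set
  InW⁺ P = InVbar P
         × ((P +M (P ∣ SM)) ≈M 0M)
         × (((P +M (P ∣ UM)) +M (P ∣ (UM ⊗ UM))) ≈M 0M)
         × ((P ∣ε) ≈M P)

  -- D_{k,N}: free Q-space on the generators modulo relations.

  data Gen : Set where
    Zg : ℕ → ℕ → Fin N → Fin N → Gen
    Pg : ℕ → ℕ → Fin N → Fin N → Gen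
    Zk : Fin N → Gen

  eqGen : Gen → Gen → Bool
  eqGen (Zg r s x y) (Zg r' s' x' y') =
    (r ≡ᵇ r') ∧ (s ≡ᵇ s') ∧ (toℕ x ≡ᵇ toℕ x') ∧ (toℕ y ≡ᵇ toℕ y')
  eqGen (Pg r s x y) (Pg r' s' x' y') =
    (r ≡ᵇ r') ∧ (s ≡ᵇ s') ∧ (toℕ x ≡ᵇ toℕ x') ∧ (toℕ y ≡ᵇ toℕ y')
  eqGen (Zk x) (Zk x') = toℕ x ≡ᵇ toℕ x'
  eqGen _ _ = false

  -- elements of the free Q-vector space on Gen (coefficient functions;
  -- all elements used below have finite support)
  F : Set
  F = Gen → ℚ

  _≈F_ : F → F → Set
  u ≈F v = ∀ g → u g ≡ v g

  0F : F
  0F _ = 0ℚ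

  _+F_ _-F_ : F → F → F
  (u +F v) g = u g ℚ.+ v g
  (u -F v) g = u g ℚ.- v g

  _•_ : ℚ → F → F
  (q • u) g = q ℚ.* u g

  sumF : List F → F
  sumF = foldr _+F_ 0F

  gen : Gen → F
  gen g h = if eqGen g h then 1ℚ else 0ℚ

  sign : ℕ → ℚ
  sign zero = 1ℚ
  sign (suc n) = ℚ.- sign n

  ValidIdx : ℕ × ℕ × Fin N × Fin N → Set
  ValidIdx (r , s , x , y) = (1 ℕ.≤ r) × (1 ℕ.≤ s) × (r ℕ.+ s ≡ k) × IsA x y

  Pexpr₁ : ℕ → ℕ → Fin N → Fin N → F
  Pexpr₁ r s x y =
    sumF (map (λ j → ℕ→ℚ ((s ℕ.∸ 1 ℕ.+ j) C j) • gen (Zg (r ℕ.∸ j) (s ℕ.+ j) (x ⊖ y) y)) (upTo r))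
    +F
    sumF (map (λ j → ℕ→ℚ ((r ℕ.∸ 1 ℕ.+ j) C j) • gen (Zg (s ℕ.∸ j) (r ℕ.+ j) (y ⊖ x) x)) (upTo s))

  Pexpr₂ : ℕ → ℕ → Fin N → Fin N → F
  Pexpr₂ r s x y = (gen (Zg r s x y) +F gen (Zg s r y x)) +F gen (Zk (x ⊕ y))

  relVec : Bool × (ℕ × ℕ × Fin N × Fin N) → F
  relVec (false , r , s , x , y) = gen (Pg r s x y) -F Pexpr₁ r s x y
  relVec (true  , r , s , x , y) = gen (Pg r s x y) -F Pexpr₂ r s x y

  InSpan : {I : Set} → (I → Set) → (I → F) → F → Set
  InSpan {I} Valid vec u =
    Σ (List (ℚ × I)) λ L →
      All (λ qi → Valid (proj₂ qi)) L × (u ≈F sumF (map (λ qi → proj₁ qi • vec (proj₂ qi)) L))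

  -- the subspace of relations (kernel of F → D_{k,N})
  InRel : F → Set
  InRel = InSpan (λ bi → ValidIdx (proj₂ bi)) relVec

  _≈D_ : F → F → Set
  u ≈D v = InRel (u -F v)

  data PevIdx : Set where
    pIdx : ℕ × ℕ × Fin N × Fin N → PevIdx
    zIdx : Fin N → PevIdx

  ValidPev : PevIdx → Set
  ValidPev (pIdx i) = ValidIdx i
  ValidPev (zIdx _) = ⊤

  pevVec : PevIdx → F
  pevVec (pIdx (r , s , x , y)) =
    ((gen (Pg r s x y) +F (sign r • gen (Pg r s (⊝ x) y)))
      +F (sign s • gen (Pg r s x (⊝ y))))
      +F (sign (r ℕ.+ s) • gen (Pg r s (⊝ x) (⊝ y)))
  pevVec (zIdx c) = gen (Zk c) +F (sign k • gen (Zk (⊝ c)))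

  InPev : F → Set
  InPev u = Σ F λ v → InSpan ValidPev pevVec v × (u ≈D v)

  λC : Fin N → Fin N → V → F
  λC x y v = sumF (map (λ i → (v i ℚ.* ℕ→ℚ ((toℕ i) ! ℕ.* (w ℕ.∸ toℕ i) !))
                               • gen (Zg (suc (toℕ i)) (suc (w ℕ.∸ toℕ i)) x y))
                       (allFin (suc w)))

  λSC : Fin N → Fin N → V → F
  λSC x y v = sumF (map (λ i → (v i ℚ.* ℕ→ℚ ((toℕ i) ! ℕ.* (w ℕ.∸ toℕ i) !))
                               • gen (Zk (x ⊕ y)))
                        (allFin (suc w)))

  -- λ(P) = Σ_C λ_C(P(CS)); C = C_{a,b} ⇒ CS has bottom row (a,b)S
  lam : Map → F
  lam P = sumF (map (λ xy → if isAᵇ (proj₁ xy) (proj₂ xy)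
                             then λC (proj₁ xy) (proj₂ xy) (P (proj₁ (cs xy)) (proj₂ (cs xy)))
                             else 0F) pairs)
    where cs = λ (xy : Fin N × Fin N) → rowMul (proj₁ xy) (proj₂ xy) SM

  lamS : Map → F
  lamS P = sumF (map (λ xy → if isAᵇ (proj₁ xy) (proj₂ xy)
                              then λSC (proj₁ xy) (proj₂ xy) (P (proj₁ (cs xy)) (proj₂ (cs xy)))
                              else 0F) pairs)
    where cs = λ (xy : Fin N × Fin N) → rowMul (proj₁ xy) (proj₂ xy) SM

module Submission where

-- In the coordinates g(C) = P(CS) the relations of D say λ(f|(1+δ)(T-1)) = λ^S(f) for all f, where T = (1 1; 0 1) and
-- δ = εS swaps X and Y; and P^ev consists of the λ(e|(1+δ)T) with e even for J and odd for ε, plus even sums of the Z_c.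
-- For P in W⁺ and Q = P|U the relations of the modular group give 3Q⁺ + Q⁻ = -(Q + Q|δ)|(T-1) with Q⁻|δ = Q⁻, whence
-- the direct statement.  Conversely, if λ(R) lies in P^ev, comparing coefficients of the generators gives
-- R = ψ|T - ψ + E with ψ and E fixed by δ and E odd for ε.  Since R|ε = R, this says 2R = (ψ|T - ψ)|(1+ε) and
-- ψ|T(1-ε) = ψ|(1-ε) - 2E.  The right side is fixed by δ; that the left side is means exactly that P = ψ|(U-U²)
-- satisfies P|(1+S) = 0, and then P lies in W⁺ and R = ½ P|U(1+ε).

open import Defs
open import Data.Nat using (ℕ; NonZero)
open import Data.Product using (Σ; _×_; _,_)
open import Data.Rational using (ℚ; ½)
open import Relation.Binary.PropositionalEquality using (_≡_)
open import Relation.Nullary using (¬_)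
open import Function.Bundles using (_⇔_)
open import Algebra.Bundles using (CommutativeRing)
import Algebra.Properties.CommutativeSemiring.Binomial as Binomial
import Algebra.Properties.CommutativeSemiring.Exp as Exp
import Algebra.Properties.Semiring.Mult as Mult
import Algebra.Properties.Semiring.Sum as Sum
open import Data.Bool using (Bool; true; false; if_then_else_; _∧_; T)
open import Data.Empty using (⊥-elim)
open import Data.Fin using (Fin; toℕ)
import Data.Fin as Fin
import Data.Fin.Properties as FinP
import Data.Integer as ℤ
import Data.Integer.DivMod as ℤD
import Data.Integer.Divisibility.Signed as ℤS
import Data.Integer.Properties as ℤP
import Data.Integer.Tactic.RingSolver as IntSolver
open import Data.List using (List; []; _∷_; _++_; map; concatMap; upTo; allFin)
import Data.List.Properties as ListP
open import Data.List.Relation.Unary.All using (All; []; _∷_)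
import Data.List.Relation.Unary.All.Properties as AllP
open import Data.Nat using (zero; suc; _!)
import Data.Nat as ℕ
open import Data.Nat.Combinatorics using (_C_; k>n⇒nCk≡0; nCk≡n!/k![n-k]!; k![n∸k]!∣n!)
import Data.Nat.DivMod as ℕDM
import Data.Nat.Divisibility as ℕD
import Data.Nat.GCD as ℕG
import Data.Nat.Properties as ℕP
import Data.Nat.Tactic.RingSolver as NatSolver
open import Data.Product using (proj₁; proj₂)
open import Data.Product.Properties using (≡-dec)
open import Data.Rational using (0ℚ; 1ℚ; _+_; _*_; _-_; -_)
import Data.Rational as ℚ
import Data.Rational.Properties as ℚP
open import Data.Rational.Solver using (module +-*-Solver)
import Data.Rational.Unnormalised as ℚᵘ
import Data.Rational.Unnormalised.Properties as ℚᵘP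
open import Data.Sum using (inj₁; inj₂; [_,_]′)
open import Data.Unit using (⊤; tt)
open import Function.Bundles using (mk⇔)
open import Relation.Binary.PropositionalEquality using (_≢_; refl; sym; trans; cong; cong₂; subst; module ≡-Reasoning)
open import Relation.Nullary using (Dec; yes; no; contradiction)
open import Relation.Nullary.Decidable using (_×-dec_)

open +-*-Solver using (solve; _:=_; _:+_; _:*_; _:-_; :-_; con)

-- `D` is never computed. An equation in it is an explicit list of multiples of relation vectors in
-- the free space, so every argument compares coefficients at the three kinds of generators. The
-- members of either family of relations, summed against a map f, have f itself (up to factorials)
-- as coefficient at the generators P; so a combination of relations is described by one map per
-- family. If λ(R) differs from an even element by such a combination, then, since λ(R) has no
-- P-coefficients, the first map is minus the second map f minus the even part e, and the
-- Z-coefficients become R = e|(1+δ)T + f|(1+δ)(T-1) in the coordinates g(C) = P(CS). With E =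
-- e|(1+δ) and ψ = E + f|(1+δ) this is ψ|T - ψ + E. Only f may fail to be fixed by J; as R is fixed
-- by J, f|(1+δ) can be replaced by its average over J. E stays odd for ε because δε = Jεδ.

-- Finite sums of rationals over lists.

∑ : {A : Set} → List A → (A → ℚ) → ℚ
∑ xs f = sumℚ (map f xs)

∑-cong : {A : Set} (xs : List A) {f g : A → ℚ} → (∀ x → f x ≡ g x) → ∑ xs f ≡ ∑ xs g
∑-cong []       h = refl
∑-cong (x ∷ xs) h = cong₂ _+_ (h x) (∑-cong xs h)

∑-zero : {A : Set} (xs : List A) {f : A → ℚ} → (∀ x → f x ≡ 0ℚ) → ∑ xs f ≡ 0ℚ
∑-zero []       h = refl
∑-zero (x ∷ xs) h = trans (cong₂ _+_ (h x) (∑-zero xs h)) (ℚP.+-identityˡ 0ℚ)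

∑-+ : {A : Set} (xs : List A) (f g : A → ℚ) → ∑ xs (λ x → f x + g x) ≡ ∑ xs f + ∑ xs g
∑-+ []       f g = refl
∑-+ (x ∷ xs) f g = trans (cong (f x + g x +_) (∑-+ xs f g))
  (solve 4 (λ a b c d → a :+ b :+ (c :+ d) := a :+ c :+ (b :+ d)) refl (f x) (g x) (∑ xs f) (∑ xs g))

∑-*ˡ : {A : Set} (xs : List A) (c : ℚ) (f : A → ℚ) → ∑ xs (λ x → c * f x) ≡ c * ∑ xs f
∑-*ˡ []       c f = sym (ℚP.*-zeroʳ c)
∑-*ˡ (x ∷ xs) c f = trans (cong (c * f x +_) (∑-*ˡ xs c f)) (sym (ℚP.*-distribˡ-+ c (f x) (∑ xs f)))

∑-*ʳ : {A : Set} (xs : List A) (c : ℚ) (f : A → ℚ) → ∑ xs (λ x → f x * c) ≡ ∑ xs f * c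
∑-*ʳ xs c f = trans (∑-cong xs (λ x → ℚP.*-comm (f x) c)) (trans (∑-*ˡ xs c f) (ℚP.*-comm c (∑ xs f)))

∑-swap : {A B : Set} (xs : List A) (ys : List B) (f : A → B → ℚ) →
         ∑ xs (λ x → ∑ ys (f x)) ≡ ∑ ys (λ y → ∑ xs (λ x → f x y))
∑-swap []       ys f = sym (∑-zero ys (λ _ → refl))
∑-swap (x ∷ xs) ys f = trans (cong (∑ ys (f x) +_) (∑-swap xs ys f)) (sym (∑-+ ys (f x) _))

∑-++ : {A : Set} (xs ys : List A) (f : A → ℚ) → ∑ (xs ++ ys) f ≡ ∑ xs f + ∑ ys f
∑-++ []       ys f = sym (ℚP.+-identityˡ _)
∑-++ (x ∷ xs) ys f = trans (cong (f x +_) (∑-++ xs ys f)) (sym (ℚP.+-assoc (f x) (∑ xs f) (∑ ys f)))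

∑-map : {A B : Set} (xs : List A) (h : A → B) (f : B → ℚ) → ∑ (map h xs) f ≡ ∑ xs (λ x → f (h x))
∑-map xs h f = cong sumℚ (sym (ListP.map-∘ xs))

∑-allFin : ∀ n (f : Fin (suc n) → ℚ) → ∑ (allFin (suc n)) f ≡ f Fin.zero + ∑ (allFin n) (λ i → f (Fin.suc i))
∑-allFin n f = cong (λ l → f Fin.zero + sumℚ l)
  (trans (ListP.map-tabulate Fin.suc f) (sym (ListP.map-tabulate (λ i → i) (λ i → f (Fin.suc i)))))

∑-upTo : ∀ n (f : ℕ → ℚ) → ∑ (upTo (suc n)) f ≡ f 0 + ∑ (upTo n) (λ i → f (suc i))
∑-upTo n f = cong (λ l → f 0 + sumℚ l)
  (trans (ListP.map-applyUpTo suc f n) (sym (ListP.map-applyUpTo (λ i → i) (λ i → f (suc i)) n)))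

∑-toℕ : ∀ n (f : ℕ → ℚ) → ∑ (allFin n) (λ i → f (toℕ i)) ≡ ∑ (upTo n) f
∑-toℕ zero    f = refl
∑-toℕ (suc n) f = trans (∑-allFin n (λ i → f (toℕ i)))
  (trans (cong (f 0 +_) (∑-toℕ n (λ i → f (suc i)))) (sym (∑-upTo n f)))

∑-upTo-last : ∀ n (f : ℕ → ℚ) → ∑ (upTo (suc n)) f ≡ ∑ (upTo n) f + f n
∑-upTo-last zero    f = trans (ℚP.+-identityʳ (f 0)) (sym (ℚP.+-identityˡ (f 0)))
∑-upTo-last (suc n) f = trans (∑-upTo (suc n) f)
  (trans (cong (f 0 +_) (∑-upTo-last n (λ i → f (suc i))))
  (trans (sym (ℚP.+-assoc (f 0) _ _)) (cong (_+ f (suc n)) (sym (∑-upTo n f)))))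

∑-upTo-cong : ∀ n {f g : ℕ → ℚ} → (∀ i → i ℕ.< n → f i ≡ g i) → ∑ (upTo n) f ≡ ∑ (upTo n) g
∑-upTo-cong zero            h = refl
∑-upTo-cong (suc n) {f} {g} h = trans (∑-upTo n f) (trans
  (cong₂ _+_ (h 0 (ℕ.s≤s ℕ.z≤n)) (∑-upTo-cong n (λ i i<n → h (suc i) (ℕ.s≤s i<n)))) (sym (∑-upTo n g)))

∑-upTo-zero : ∀ n {f : ℕ → ℚ} → (∀ i → i ℕ.< n → f i ≡ 0ℚ) → ∑ (upTo n) f ≡ 0ℚ
∑-upTo-zero n h = trans (∑-upTo-cong n h) (∑-zero (upTo n) (λ _ → refl))

∑-upTo-extend : ∀ {m n} {f : ℕ → ℚ} → m ℕ.≤ n → (∀ i → m ℕ.≤ i → f i ≡ 0ℚ) → ∑ (upTo n) f ≡ ∑ (upTo m) f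
∑-upTo-extend {m} {n} m≤n h with ℕP.m≤n⇒m<n∨m≡n m≤n
... | inj₂ refl = refl
∑-upTo-extend {m} {suc n} {f} m≤n h | inj₁ (ℕ.s≤s m≤n′) = trans (∑-upTo-last n f)
  (trans (cong₂ _+_ (∑-upTo-extend m≤n′ h) (h n m≤n′)) (ℚP.+-identityʳ _))

∑-upTo-single : ∀ {n} {f : ℕ → ℚ} j → j ℕ.< n → (∀ i → i ℕ.< n → i ≢ j → f i ≡ 0ℚ) → ∑ (upTo n) f ≡ f j
∑-upTo-single {suc n} {f} zero    j<n         h = trans (∑-upTo n f)
  (trans (cong (f 0 +_) (∑-upTo-zero n (λ i i<n → h (suc i) (ℕ.s≤s i<n) λ ()))) (ℚP.+-identityʳ (f 0)))
∑-upTo-single {suc n} {f} (suc j) (ℕ.s≤s j<n) h = trans (∑-upTo n f)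
  (trans (cong₂ _+_ (h 0 (ℕ.s≤s ℕ.z≤n) λ ())
    (∑-upTo-single j j<n (λ i i<n i≢j → h (suc i) (ℕ.s≤s i<n) (λ e → i≢j (ℕP.suc-injective e)))))
         (ℚP.+-identityˡ _))

∑-Fin-single : ∀ {n} {f : Fin n → ℚ} j → (∀ i → i ≢ j → f i ≡ 0ℚ) → ∑ (allFin n) f ≡ f j
∑-Fin-single {suc n} {f} Fin.zero    h = trans (∑-allFin n f)
  (trans (cong (f Fin.zero +_) (∑-zero (allFin n) (λ i → h (Fin.suc i) λ ()))) (ℚP.+-identityʳ _))
∑-Fin-single {suc n} {f} (Fin.suc j) h = trans (∑-allFin n f)
  (trans (cong₂ _+_ (h Fin.zero λ ()) (∑-Fin-single j (λ i i≢j → h (Fin.suc i) (λ e → i≢j (FinP.suc-injective e)))))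
         (ℚP.+-identityˡ _))

-- Sums a Cauchy product by rows i instead of diagonals m = i + j. In the induction the new diagonal
-- adds one entry to each row; row n was empty before.
∑-triangle : ∀ n (f : ℕ → ℕ → ℚ) →
  ∑ (upTo n) (λ m → ∑ (upTo (suc m)) (λ i → f i (m ℕ.∸ i))) ≡ ∑ (upTo n) (λ i → ∑ (upTo (n ℕ.∸ i)) (f i))
∑-triangle zero    f = refl
∑-triangle (suc n) f = begin
  ∑ (upTo (suc n)) diagonal                     ≡⟨ ∑-upTo-last n diagonal ⟩
  ∑ (upTo n) diagonal + ∑ (upTo (suc n)) last   ≡⟨ cong (_+ ∑ (upTo (suc n)) last) (∑-triangle n f) ⟩
  ∑ (upTo n) row + ∑ (upTo (suc n)) last        ≡⟨ cong (_+ ∑ (upTo (suc n)) last) extend ⟩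
  ∑ (upTo (suc n)) row + ∑ (upTo (suc n)) last  ≡⟨ ∑-+ (upTo (suc n)) row last ⟨
  ∑ (upTo (suc n)) (λ i → row i + last i)       ≡⟨ ∑-upTo-cong (suc n) step ⟩
  ∑ (upTo (suc n)) (λ i → ∑ (upTo (suc n ℕ.∸ i)) (f i)) ∎
  where
  open ≡-Reasoning
  diagonal row last : ℕ → ℚ
  diagonal m = ∑ (upTo (suc m)) (λ i → f i (m ℕ.∸ i))
  row i = ∑ (upTo (n ℕ.∸ i)) (f i)
  last i = f i (n ℕ.∸ i)
  row-n : row n ≡ 0ℚ
  row-n rewrite ℕP.n∸n≡0 n = refl
  extend : ∑ (upTo n) row ≡ ∑ (upTo (suc n)) row
  extend = sym (trans (∑-upTo-last n row) (trans (cong (∑ (upTo n) row +_) row-n) (ℚP.+-identityʳ _)))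
  step : ∀ i → i ℕ.< suc n → row i + last i ≡ ∑ (upTo (suc n ℕ.∸ i)) (f i)
  step i (ℕ.s≤s i≤n) = trans (sym (∑-upTo-last (n ℕ.∸ i) (f i)))
    (cong (λ t → ∑ (upTo t) (f i)) (sym (ℕP.+-∸-assoc 1 i≤n)))

-- Casts into the rationals and the binomial theorem.

ℤ→ℚ-+ : ∀ x y → ℤ→ℚ (x ℤ.+ y) ≡ ℤ→ℚ x + ℤ→ℚ y
ℤ→ℚ-+ x y = ℚP.toℚᵘ-injective (begin
  ℚ.toℚᵘ (ℤ→ℚ (x ℤ.+ y))              ≈⟨ ℚP.toℚᵘ-fromℚᵘ (ℚᵘ.mkℚᵘ (x ℤ.+ y) 0) ⟩
  ℚᵘ.mkℚᵘ (x ℤ.+ y) 0                 ≈⟨ ℚᵘ.*≡* (cong₂ ℤ._*_ (cong₂ ℤ._+_ (sym (ℤP.*-identityʳ x)) (sym (ℤP.*-identityʳ y))) refl) ⟩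
  ℚᵘ.mkℚᵘ x 0 ℚᵘ.+ ℚᵘ.mkℚᵘ y 0        ≈⟨ ℚᵘP.+-cong (ℚP.toℚᵘ-fromℚᵘ (ℚᵘ.mkℚᵘ x 0)) (ℚP.toℚᵘ-fromℚᵘ (ℚᵘ.mkℚᵘ y 0)) ⟨
  ℚ.toℚᵘ (ℤ→ℚ x) ℚᵘ.+ ℚ.toℚᵘ (ℤ→ℚ y)  ≈⟨ ℚP.toℚᵘ-homo-+ (ℤ→ℚ x) (ℤ→ℚ y) ⟨
  ℚ.toℚᵘ (ℤ→ℚ x + ℤ→ℚ y)              ∎)
  where open ℚᵘP.≃-Reasoning

ℤ→ℚ-* : ∀ x y → ℤ→ℚ (x ℤ.* y) ≡ ℤ→ℚ x * ℤ→ℚ y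
ℤ→ℚ-* x y = ℚP.toℚᵘ-injective (begin
  ℚ.toℚᵘ (ℤ→ℚ (x ℤ.* y))              ≈⟨ ℚP.toℚᵘ-fromℚᵘ (ℚᵘ.mkℚᵘ (x ℤ.* y) 0) ⟩
  ℚᵘ.mkℚᵘ x 0 ℚᵘ.* ℚᵘ.mkℚᵘ y 0        ≈⟨ ℚᵘP.*-cong (ℚP.toℚᵘ-fromℚᵘ (ℚᵘ.mkℚᵘ x 0)) (ℚP.toℚᵘ-fromℚᵘ (ℚᵘ.mkℚᵘ y 0)) ⟨
  ℚ.toℚᵘ (ℤ→ℚ x) ℚᵘ.* ℚ.toℚᵘ (ℤ→ℚ y)  ≈⟨ ℚP.toℚᵘ-homo-* (ℤ→ℚ x) (ℤ→ℚ y) ⟨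
  ℚ.toℚᵘ (ℤ→ℚ x * ℤ→ℚ y)              ∎)
  where open ℚᵘP.≃-Reasoning

ℕ→ℚ-+ : ∀ m n → ℕ→ℚ (m ℕ.+ n) ≡ ℕ→ℚ m + ℕ→ℚ n
ℕ→ℚ-+ m n = ℤ→ℚ-+ (ℤ.+ m) (ℤ.+ n)

ℕ→ℚ-* : ∀ m n → ℕ→ℚ (m ℕ.* n) ≡ ℕ→ℚ m * ℕ→ℚ n
ℕ→ℚ-* m n = trans (cong ℤ→ℚ (ℤP.pos-* m n)) (ℤ→ℚ-* (ℤ.+ m) (ℤ.+ n))

ℕ→ℚ-≢0 : ∀ n → ℕ→ℚ (suc n) ≢ 0ℚ
ℕ→ℚ-≢0 n e = ℚP.<⇒≢ (ℚP.positive⁻¹ (ℕ→ℚ (suc n)) {{ℚP.normalize-pos (suc n) 1}}) (sym e)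

*-≡0ʳ : ∀ {p} q → p ≢ 0ℚ → p * q ≡ 0ℚ → q ≡ 0ℚ
*-≡0ʳ {p} q p≢0 e = begin
  q               ≡⟨ ℚP.*-identityˡ q ⟨
  1ℚ * q          ≡⟨ cong (_* q) (ℚP.*-inverseˡ p) ⟨
  ℚ.1/ p * p * q  ≡⟨ ℚP.*-assoc (ℚ.1/ p) p q ⟩
  ℚ.1/ p * (p * q) ≡⟨ cong (ℚ.1/ p *_) e ⟩
  ℚ.1/ p * 0ℚ     ≡⟨ ℚP.*-zeroʳ (ℚ.1/ p) ⟩
  0ℚ              ∎
  where
  open ≡-Reasoning
  instance _ = ℚ.≢-nonZero p≢0

private ℚ-semiring = CommutativeRing.commutativeSemiring ℚP.+-*-commutativeRing

open Exp ℚ-semiring using (_^_; ^-homo-*; ^-distrib-*)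
open Sum (CommutativeRing.semiring ℚP.+-*-commutativeRing) using (sum)
open Mult (CommutativeRing.semiring ℚP.+-*-commutativeRing) using () renaming (_×_ to _·_)

-- The library form of the binomial theorem weights its terms by repeated addition, `actV` by a cast
-- natural number.
·-ℕ→ℚ : ∀ n z → n · z ≡ ℕ→ℚ n * z
·-ℕ→ℚ zero    z = sym (ℚP.*-zeroˡ z)
·-ℕ→ℚ (suc n) z = begin
  z + n · z              ≡⟨ cong (z +_) (·-ℕ→ℚ n z) ⟩
  z + ℕ→ℚ n * z          ≡⟨ cong (_+ ℕ→ℚ n * z) (ℚP.*-identityˡ z) ⟨
  1ℚ * z + ℕ→ℚ n * z     ≡⟨ ℚP.*-distribʳ-+ z 1ℚ (ℕ→ℚ n) ⟨
  (1ℚ + ℕ→ℚ n) * z       ≡⟨ cong (_* z) (ℕ→ℚ-+ 1 n) ⟨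
  ℕ→ℚ (suc n) * z        ∎
  where open ≡-Reasoning

sum≡∑ : ∀ n (f : Fin n → ℚ) → sum f ≡ ∑ (allFin n) f
sum≡∑ zero    f = refl
sum≡∑ (suc n) f = trans (cong (f Fin.zero +_) (sum≡∑ n (λ i → f (Fin.suc i)))) (sym (∑-allFin n f))

*-zeroˡ′ : ∀ {p} q → p ≡ 0ℚ → p * q ≡ 0ℚ
*-zeroˡ′ q refl = ℚP.*-zeroˡ q

*-zeroʳ′ : ∀ p {q} → q ≡ 0ℚ → p * q ≡ 0ℚ
*-zeroʳ′ p refl = ℚP.*-zeroʳ p

binomialTerm : ℕ → ℚ → ℚ → ℕ → ℚ
binomialTerm n X Y i = ℕ→ℚ (n C i) * (X ^ i * Y ^ (n ℕ.∸ i))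

binomialTerm-zero : ∀ {n i} X Y → n ℕ.< i → binomialTerm n X Y i ≡ 0ℚ
binomialTerm-zero {n} {i} X Y n<i = *-zeroˡ′ (X ^ i * Y ^ (n ℕ.∸ i)) (cong ℕ→ℚ (k>n⇒nCk≡0 n<i))

binomial-theorem : ∀ n X Y → ∑ (upTo (suc n)) (binomialTerm n X Y) ≡ (X + Y) ^ n
binomial-theorem n X Y = begin
  ∑ (upTo (suc n)) (binomialTerm n X Y)                ≡⟨ ∑-toℕ (suc n) (binomialTerm n X Y) ⟨
  ∑ (allFin (suc n)) (λ i → binomialTerm n X Y (toℕ i)) ≡⟨ ∑-cong (allFin (suc n)) (λ i → ·-ℕ→ℚ (n C toℕ i) (X ^ toℕ i * Y ^ (n ℕ.∸ toℕ i))) ⟨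
  ∑ (allFin (suc n)) (Binomial.binomialTerm ℚ-semiring X Y n) ≡⟨ sum≡∑ (suc n) (Binomial.binomialTerm ℚ-semiring X Y n) ⟨
  Binomial.binomialExpansion ℚ-semiring X Y n          ≡⟨ Binomial.theorem ℚ-semiring n X Y ⟨
  (X + Y) ^ n                                          ∎
  where open ≡-Reasoning

ℤ→ℚ-^ : ∀ x n → ℤ→ℚ (x ℤ.^ n) ≡ ℤ→ℚ x ^ n
ℤ→ℚ-^ x zero    = refl
ℤ→ℚ-^ x (suc n) = trans (ℤ→ℚ-* x (x ℤ.^ n)) (cong (ℤ→ℚ x *_) (ℤ→ℚ-^ x n))

-- Coefficients of (aX+bY)^r (cX+dY)^(w-r).

module _ (w r : ℕ) where

  -- The coefficient of X^m Y^(w-m) in (aX+bY)^r (cX+dY)^(w-r), in the form in which it appears in actV.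
  summand : M2 → ℕ → ℕ → ℚ
  summand (mat a b c d) m i =
    ℕ→ℚ ((r C i) ℕ.* ((w ℕ.∸ r) C (m ℕ.∸ i)))
    * ℤ→ℚ ((a ℤ.^ i) ℤ.* (b ℤ.^ (r ℕ.∸ i)) ℤ.* (c ℤ.^ (m ℕ.∸ i)) ℤ.* (d ℤ.^ (w ℕ.∸ r ℕ.∸ (m ℕ.∸ i))))

  coefficient : M2 → ℕ → ℚ
  coefficient γ m = ∑ (upTo (suc m)) (summand γ m)

private
  regroup-powers : ∀ a b c d i j p q X Y →
    a ^ i * b ^ p * c ^ j * d ^ q * (X ^ (i ℕ.+ j) * Y ^ (p ℕ.+ q))
    ≡ ((a * X) ^ i * (b * Y) ^ p) * ((c * X) ^ j * (d * Y) ^ q)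
  regroup-powers a b c d i j p q X Y
    rewrite ^-distrib-* a X i | ^-distrib-* b Y p | ^-distrib-* c X j | ^-distrib-* d Y q
          | ^-homo-* X i j | ^-homo-* Y p q
    = solve 8 (λ a b c d x y z t → a :* b :* c :* d :* (x :* y :* (z :* t))
                                 := a :* x :* (b :* z) :* (c :* y :* (d :* t))) refl
        (a ^ i) (b ^ p) (c ^ j) (d ^ q) (X ^ i) (X ^ j) (Y ^ p) (Y ^ q)

module _ {w r : ℕ} (r≤w : r ℕ.≤ w) (a b c d : ℤ.ℤ) (X Y : ℚ) where

  private
    s = w ℕ.∸ r
    f g : ℕ → ℚ
    f = binomialTerm r (ℤ→ℚ a * X) (ℤ→ℚ b * Y)
    g = binomialTerm s (ℤ→ℚ c * X) (ℤ→ℚ d * Y)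

    powers : ℕ → ℕ → ℤ.ℤ
    powers i j = (a ℤ.^ i) ℤ.* (b ℤ.^ (r ℕ.∸ i)) ℤ.* (c ℤ.^ j) ℤ.* (d ℤ.^ (s ℕ.∸ j))

    powers′ : ℕ → ℕ → ℚ
    powers′ i j = ℤ→ℚ a ^ i * ℤ→ℚ b ^ (r ℕ.∸ i) * ℤ→ℚ c ^ j * ℤ→ℚ d ^ (s ℕ.∸ j)

    powers-image : ∀ i j → ℤ→ℚ (powers i j) ≡ powers′ i j
    powers-image i j
      rewrite ℤ→ℚ-* ((a ℤ.^ i) ℤ.* (b ℤ.^ (r ℕ.∸ i)) ℤ.* (c ℤ.^ j)) (d ℤ.^ (s ℕ.∸ j))
            | ℤ→ℚ-* ((a ℤ.^ i) ℤ.* (b ℤ.^ (r ℕ.∸ i))) (c ℤ.^ j)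
            | ℤ→ℚ-* (a ℤ.^ i) (b ℤ.^ (r ℕ.∸ i))
            | ℤ→ℚ-^ a i | ℤ→ℚ-^ b (r ℕ.∸ i) | ℤ→ℚ-^ c j | ℤ→ℚ-^ d (s ℕ.∸ j) = refl

    summand-zero : ∀ m i → (r C i) ℕ.* (s C (m ℕ.∸ i)) ≡ 0 → ∀ t →
      summand w r (mat a b c d) m i * t ≡ 0ℚ
    summand-zero m i e t = *-zeroˡ′ t (*-zeroˡ′ (ℤ→ℚ (powers i (m ℕ.∸ i))) (cong ℕ→ℚ e))

    -- The exponent of Y left when X^i comes from the first factor and X^(m-i) from the second. The
    -- bounds make every truncated subtraction exact.
    degrees : ∀ m i → i ℕ.≤ m → m ℕ.≤ w → i ℕ.≤ r → m ℕ.∸ i ℕ.≤ s →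
      w ℕ.∸ m ≡ r ℕ.∸ i ℕ.+ (s ℕ.∸ (m ℕ.∸ i))
    degrees m i i≤m m≤w i≤r j≤s = ℕP.+-cancelʳ-≡ m _ _ (begin
      w ℕ.∸ m ℕ.+ m                        ≡⟨ ℕP.m∸n+n≡m m≤w ⟩
      w                                    ≡⟨ ℕP.m+[n∸m]≡n r≤w ⟨
      r ℕ.+ s                              ≡⟨ cong₂ ℕ._+_ (ℕP.m∸n+n≡m i≤r) (ℕP.m∸n+n≡m j≤s) ⟨
      (r ℕ.∸ i ℕ.+ i) ℕ.+ (s ℕ.∸ j ℕ.+ j)  ≡⟨ interchange (r ℕ.∸ i) i (s ℕ.∸ j) j ⟩
      r ℕ.∸ i ℕ.+ (s ℕ.∸ j) ℕ.+ (i ℕ.+ j)  ≡⟨ cong (r ℕ.∸ i ℕ.+ (s ℕ.∸ j) ℕ.+_) (ℕP.m+[n∸m]≡n i≤m) ⟩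
      r ℕ.∸ i ℕ.+ (s ℕ.∸ j) ℕ.+ m          ∎)
      where
      open ≡-Reasoning
      j = m ℕ.∸ i
      interchange : ∀ p q u v → (p ℕ.+ q) ℕ.+ (u ℕ.+ v) ≡ p ℕ.+ u ℕ.+ (q ℕ.+ v)
      interchange = NatSolver.solve-∀

    -- Outside the bounds i ≤ r and m - i ≤ s a binomial coefficient vanishes on both sides, so the
    -- truncated exponents do no harm there.
    summand-monomial : ∀ m i → i ℕ.≤ m → m ℕ.≤ w → Dec (i ℕ.≤ r) → Dec (m ℕ.∸ i ℕ.≤ s) →
      summand w r (mat a b c d) m i * (X ^ m * Y ^ (w ℕ.∸ m)) ≡ f i * g (m ℕ.∸ i)
    summand-monomial m i i≤m m≤w (no i≰r) _ =
      trans (summand-zero m i (cong (ℕ._* (s C (m ℕ.∸ i))) (k>n⇒nCk≡0 (ℕP.≰⇒> i≰r))) (X ^ m * Y ^ (w ℕ.∸ m)))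
            (sym (*-zeroˡ′ (g (m ℕ.∸ i)) (binomialTerm-zero (ℤ→ℚ a * X) (ℤ→ℚ b * Y) (ℕP.≰⇒> i≰r))))
    summand-monomial m i i≤m m≤w (yes _) (no j≰s) =
      trans (summand-zero m i (trans (cong ((r C i) ℕ.*_) (k>n⇒nCk≡0 (ℕP.≰⇒> j≰s))) (ℕP.*-zeroʳ (r C i))) (X ^ m * Y ^ (w ℕ.∸ m)))
            (sym (*-zeroʳ′ (f i) (binomialTerm-zero (ℤ→ℚ c * X) (ℤ→ℚ d * Y) (ℕP.≰⇒> j≰s))))
    summand-monomial m i i≤m m≤w (yes i≤r) (yes j≤s) = begin
      summand w r (mat a b c d) m i * (X ^ m * Y ^ (w ℕ.∸ m))
        ≡⟨ cong₂ (λ u v → u * v * (X ^ m * Y ^ (w ℕ.∸ m))) (ℕ→ℚ-* (r C i) (s C j)) (powers-image i j) ⟩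
      A * B * powers′ i j * (X ^ m * Y ^ (w ℕ.∸ m))
        ≡⟨ cong₂ (λ e e′ → A * B * powers′ i j * (X ^ e * Y ^ e′)) (sym (ℕP.m+[n∸m]≡n i≤m)) (degrees m i i≤m m≤w i≤r j≤s) ⟩
      A * B * powers′ i j * (X ^ (i ℕ.+ j) * Y ^ (r ℕ.∸ i ℕ.+ (s ℕ.∸ j)))
        ≡⟨ ℚP.*-assoc (A * B) (powers′ i j) (X ^ (i ℕ.+ j) * Y ^ (r ℕ.∸ i ℕ.+ (s ℕ.∸ j))) ⟩
      A * B * (powers′ i j * (X ^ (i ℕ.+ j) * Y ^ (r ℕ.∸ i ℕ.+ (s ℕ.∸ j))))
        ≡⟨ cong (A * B *_) (regroup-powers (ℤ→ℚ a) (ℤ→ℚ b) (ℤ→ℚ c) (ℤ→ℚ d) i j (r ℕ.∸ i) (s ℕ.∸ j) X Y) ⟩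
      A * B * (F * G)
        ≡⟨ solve 4 (λ u v p q → u :* v :* (p :* q) := u :* p :* (v :* q)) refl A B F G ⟩
      f i * g j ∎
      where
      open ≡-Reasoning
      j = m ℕ.∸ i
      A = ℕ→ℚ (r C i)
      B = ℕ→ℚ (s C j)
      F = (ℤ→ℚ a * X) ^ i * (ℤ→ℚ b * Y) ^ (r ℕ.∸ i)
      G = (ℤ→ℚ c * X) ^ j * (ℤ→ℚ d * Y) ^ (s ℕ.∸ j)

  -- The Cauchy product of two binomial expansions. Row i has length w - i + 1: for i ≤ r this holds
  -- the whole expansion of the second factor, of degree w - r, and for i > r the first factor has
  -- no term.
  coefficients : ∑ (upTo (suc w)) (λ m → coefficient w r (mat a b c d) m * (X ^ m * Y ^ (w ℕ.∸ m)))
               ≡ (ℤ→ℚ a * X + ℤ→ℚ b * Y) ^ r * (ℤ→ℚ c * X + ℤ→ℚ d * Y) ^ (w ℕ.∸ r)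
  coefficients = begin
    ∑ (upTo (suc w)) (λ m → coefficient w r (mat a b c d) m * (X ^ m * Y ^ (w ℕ.∸ m)))
      ≡⟨ ∑-upTo-cong (suc w) (λ { m (ℕ.s≤s m≤w) →
           trans (sym (∑-*ʳ (upTo (suc m)) (X ^ m * Y ^ (w ℕ.∸ m)) (summand w r (mat a b c d) m)))
                 (∑-upTo-cong (suc m) (λ { i (ℕ.s≤s i≤m) → summand-monomial m i i≤m m≤w (i ℕP.≤? r) (m ℕ.∸ i ℕP.≤? s) })) }) ⟩
    ∑ (upTo (suc w)) (λ m → ∑ (upTo (suc m)) (λ i → f i * g (m ℕ.∸ i)))
      ≡⟨ ∑-triangle (suc w) (λ i j → f i * g j) ⟩
    ∑ (upTo (suc w)) (λ i → ∑ (upTo (suc w ℕ.∸ i)) (λ j → f i * g j))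
      ≡⟨ ∑-upTo-cong (suc w) (λ i _ → row i (i ℕP.≤? r)) ⟩
    ∑ (upTo (suc w)) (λ i → f i * ∑ (upTo (suc s)) g)
      ≡⟨ ∑-*ʳ (upTo (suc w)) (∑ (upTo (suc s)) g) f ⟩
    ∑ (upTo (suc w)) f * ∑ (upTo (suc s)) g
      ≡⟨ cong₂ _*_ (trans (∑-upTo-extend (ℕ.s≤s r≤w) (λ i r<i → binomialTerm-zero (ℤ→ℚ a * X) (ℤ→ℚ b * Y) r<i))
                          (binomial-theorem r (ℤ→ℚ a * X) (ℤ→ℚ b * Y)))
                   (binomial-theorem s (ℤ→ℚ c * X) (ℤ→ℚ d * Y)) ⟩
    (ℤ→ℚ a * X + ℤ→ℚ b * Y) ^ r * (ℤ→ℚ c * X + ℤ→ℚ d * Y) ^ s ∎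
    where
    open ≡-Reasoning
    row : ∀ i → Dec (i ℕ.≤ r) → ∑ (upTo (suc w ℕ.∸ i)) (λ j → f i * g j) ≡ f i * ∑ (upTo (suc s)) g
    row i (yes i≤r) = trans (∑-*ˡ (upTo (suc w ℕ.∸ i)) (f i) g) (cong (f i *_)
      (∑-upTo-extend (subst (ℕ._≤ suc w ℕ.∸ i) (ℕP.+-∸-assoc 1 r≤w) (ℕP.∸-monoʳ-≤ (suc w) i≤r))
                     (λ j s<j → binomialTerm-zero (ℤ→ℚ c * X) (ℤ→ℚ d * Y) s<j)))
    row i (no i≰r) = trans (∑-zero (upTo (suc w ℕ.∸ i)) (λ j → *-zeroˡ′ (g j) fi≡0))
                         (sym (*-zeroˡ′ (∑ (upTo (suc s)) g) fi≡0))
      where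
      fi≡0 : f i ≡ 0ℚ
      fi≡0 = binomialTerm-zero (ℤ→ℚ a * X) (ℤ→ℚ b * Y) (ℕP.≰⇒> i≰r)

-- A polynomial that vanishes at all nonzero rationals is zero.

1^n≡1 : ∀ n → 1ℚ ^ n ≡ 1ℚ
1^n≡1 zero    = refl
1^n≡1 (suc n) = trans (ℚP.*-identityˡ (1ℚ ^ n)) (1^n≡1 n)

x-y≡0⇒x≡y : ∀ x y → x - y ≡ 0ℚ → x ≡ y
x-y≡0⇒x≡y x y e = begin
  x           ≡⟨ solve 2 (λ x y → x := x :- y :+ y) refl x y ⟩
  x - y + y   ≡⟨ cong (_+ y) e ⟩
  0ℚ + y      ≡⟨ ℚP.+-identityˡ y ⟩
  y           ∎
  where open ≡-Reasoning

2ℚ : ℚ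
2ℚ = ℕ→ℚ 2

-- The number 2^(n+1) - 1 is the factor that the coefficient of t^(n+1) acquires in f(2t) - f(t).
-- Written as a successor it is visibly nonzero.
2^[1+n]-1-positive : ∀ n → Σ ℕ λ e → 2ℚ ^ suc n ≡ 1ℚ + ℕ→ℚ (suc e)
2^[1+n]-1-positive zero    = 0 , refl
2^[1+n]-1-positive (suc n) with 2^[1+n]-1-positive n
... | e , 2^≡ = 2 ℕ.* suc e , (begin
  2ℚ * 2ℚ ^ suc n              ≡⟨ cong (2ℚ *_) 2^≡ ⟩
  2ℚ * (1ℚ + ℕ→ℚ (suc e))      ≡⟨ solve 1 (λ x → con 2ℚ :* (con 1ℚ :+ x) := con 1ℚ :+ (con 1ℚ :+ con 2ℚ :* x)) refl (ℕ→ℚ (suc e)) ⟩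
  1ℚ + (1ℚ + 2ℚ * ℕ→ℚ (suc e)) ≡⟨ cong (λ t → 1ℚ + (1ℚ + t)) (ℕ→ℚ-* 2 (suc e)) ⟨
  1ℚ + (1ℚ + ℕ→ℚ (2 ℕ.* suc e)) ≡⟨ cong (1ℚ +_) (ℕ→ℚ-+ 1 (2 ℕ.* suc e)) ⟨
  1ℚ + ℕ→ℚ (suc (2 ℕ.* suc e)) ∎)
  where open ≡-Reasoning

-- f(2t) - f(t) has no constant term and, up to nonzero factors, the other coefficients of f.
vanishing : ∀ n (p : Fin n → ℚ) → (∀ t → t ≢ 0ℚ → ∑ (allFin n) (λ i → p i * t ^ toℕ i) ≡ 0ℚ) → ∀ i → p i ≡ 0ℚ
vanishing (suc n) p h = λ { Fin.zero → constant ; (Fin.suc i) → higher i }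
  where
  open ≡-Reasoning
  c : ℕ → ℚ
  c i = ℕ→ℚ (suc (proj₁ (2^[1+n]-1-positive i)))
  f : ℚ → ℚ
  f t = p Fin.zero * 1ℚ + ∑ (allFin n) (λ i → p (Fin.suc i) * t ^ suc (toℕ i))
  f≡0 : ∀ t → t ≢ 0ℚ → f t ≡ 0ℚ
  f≡0 t t≢0 = trans (sym (∑-allFin n (λ i → p i * t ^ toℕ i))) (h t t≢0)
  doubling : ∀ t i → p (Fin.suc i) * t ^ suc (toℕ i) + t * (p (Fin.suc i) * c (toℕ i) * t ^ toℕ i)
                   ≡ p (Fin.suc i) * (2ℚ * t) ^ suc (toℕ i)
  doubling t i = begin
    q * t ^ suc (toℕ i) + t * (q * c (toℕ i) * t ^ toℕ i)
      ≡⟨ solve 4 (λ q t c x → q :* (t :* x) :+ t :* (q :* c :* x) := q :* ((con 1ℚ :+ c) :* (t :* x))) refl q t (c (toℕ i)) (t ^ toℕ i) ⟩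
    q * ((1ℚ + c (toℕ i)) * t ^ suc (toℕ i))
      ≡⟨ cong (λ u → q * (u * t ^ suc (toℕ i))) (proj₂ (2^[1+n]-1-positive (toℕ i))) ⟨
    q * (2ℚ ^ suc (toℕ i) * t ^ suc (toℕ i))
      ≡⟨ cong (q *_) (^-distrib-* 2ℚ t (suc (toℕ i))) ⟨
    q * (2ℚ * t) ^ suc (toℕ i) ∎
    where q = p (Fin.suc i)
  difference : ∀ t → f t + t * ∑ (allFin n) (λ i → p (Fin.suc i) * c (toℕ i) * t ^ toℕ i) ≡ f (2ℚ * t)
  difference t = begin
    p Fin.zero * 1ℚ + F + t * G ≡⟨ ℚP.+-assoc (p Fin.zero * 1ℚ) F (t * G) ⟩
    p Fin.zero * 1ℚ + (F + t * G) ≡⟨ cong (λ u → p Fin.zero * 1ℚ + (F + u)) (∑-*ˡ (allFin n) t g) ⟨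
    p Fin.zero * 1ℚ + (F + ∑ (allFin n) (λ i → t * g i)) ≡⟨ cong (p Fin.zero * 1ℚ +_) (∑-+ (allFin n) _ _) ⟨
    p Fin.zero * 1ℚ + ∑ (allFin n) (λ i → p (Fin.suc i) * t ^ suc (toℕ i) + t * g i)
      ≡⟨ cong (p Fin.zero * 1ℚ +_) (∑-cong (allFin n) (doubling t)) ⟩
    f (2ℚ * t) ∎
    where
    g : Fin n → ℚ
    g i = p (Fin.suc i) * c (toℕ i) * t ^ toℕ i
    F = ∑ (allFin n) (λ i → p (Fin.suc i) * t ^ suc (toℕ i))
    G = ∑ (allFin n) g
  higher : ∀ i → p (Fin.suc i) ≡ 0ℚ
  higher i = *-≡0ʳ {c (toℕ i)} (p (Fin.suc i)) (ℕ→ℚ-≢0 (proj₁ (2^[1+n]-1-positive (toℕ i))))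
    (trans (ℚP.*-comm (c (toℕ i)) (p (Fin.suc i)))
      -- The difference f(2t) - f(t) is t times a polynomial with one coefficient fewer. The
      -- induction hypothesis tests only t ≠ 0, so t can be cancelled.
      (vanishing n (λ i → p (Fin.suc i) * c (toℕ i)) (λ t t≢0 → *-≡0ʳ {t} _ t≢0 (begin
        t * G t            ≡⟨ ℚP.+-identityˡ (t * G t) ⟨
        0ℚ + t * G t       ≡⟨ cong (_+ t * G t) (f≡0 t t≢0) ⟨
        f t + t * G t      ≡⟨ difference t ⟩
        f (2ℚ * t)         ≡⟨ f≡0 (2ℚ * t) (λ e → t≢0 (*-≡0ʳ {2ℚ} t (ℕ→ℚ-≢0 1) e)) ⟩
        0ℚ ∎)) i))
    where
    G : ℚ → ℚ
    G t = ∑ (allFin n) (λ i → p (Fin.suc i) * c (toℕ i) * t ^ toℕ i)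
  constant : p Fin.zero ≡ 0ℚ
  constant = begin
    p Fin.zero             ≡⟨ ℚP.*-identityʳ (p Fin.zero) ⟨
    p Fin.zero * 1ℚ        ≡⟨ ℚP.+-identityʳ (p Fin.zero * 1ℚ) ⟨
    p Fin.zero * 1ℚ + 0ℚ   ≡⟨ cong (p Fin.zero * 1ℚ +_) (∑-zero (allFin n) (λ i → *-zeroˡ′ (1ℚ ^ suc (toℕ i)) (higher i))) ⟨
    f 1ℚ                   ≡⟨ f≡0 1ℚ (ℕ→ℚ-≢0 0) ⟩
    0ℚ                     ∎

-- Indicators, and the matrices δ and T.

indicator : {A : Set} → Dec A → ℚ
indicator (yes _) = 1ℚ
indicator (no _)  = 0ℚ

indicator-yes : {A : Set} (d : Dec A) → A → indicator d ≡ 1ℚ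
indicator-yes (yes _) a = refl
indicator-yes (no ¬a) a = contradiction a ¬a

indicator-no : {A : Set} (d : Dec A) → ¬ A → indicator d ≡ 0ℚ
indicator-no (yes a) ¬a = contradiction a ¬a
indicator-no (no _)  ¬a = refl

indicator-⇔ : {A B : Set} (d : Dec A) (d′ : Dec B) → (A → B) → (B → A) → indicator d ≡ indicator d′
indicator-⇔ (yes a) d′ f g = sym (indicator-yes d′ (f a))
indicator-⇔ (no ¬a) d′ f g = sym (indicator-no d′ (λ b → ¬a (g b)))

transpose : M2 → M2
transpose (mat a b c d) = mat a c b d

δM TM : M2
δM = mat (ℤ.+ 0) (ℤ.+ 1) (ℤ.+ 1) (ℤ.+ 0)
TM = mat (ℤ.+ 1) (ℤ.+ 1) (ℤ.+ 0) (ℤ.+ 1)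

-- The action on V_w, studied through the values of polynomials.

module Polynomials (N : ℕ) .{{_ : NonZero N}} (w : ℕ) where
  open Setup N w

  ev : V → ℚ → ℚ → ℚ
  ev p X Y = ∑ (allFin (suc w)) (λ i → p i * (X ^ toℕ i * Y ^ (w ℕ.∸ toℕ i)))

  toℕ≤w : (r : Fin (suc w)) → toℕ r ℕ.≤ w
  toℕ≤w r = ℕP.≤-pred (FinP.toℕ<n r)

  -- The bridge from the coefficient formula to substitution. After the sums are exchanged,
  -- `coefficients` evaluates the image of each monomial X^r Y^(w-r).
  ev-actV : ∀ γ p X Y → let open M2 γ in
    ev (actV γ p) X Y ≡ ev p (ℤ→ℚ a * X + ℤ→ℚ b * Y) (ℤ→ℚ c * X + ℤ→ℚ d * Y)
  ev-actV γ@(mat a b c d) p X Y = begin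
    ∑ (allFin (suc w)) (λ m → ∑ (allFin (suc w)) (λ r → p r * K r (toℕ m)) * mono (toℕ m))
      ≡⟨ ∑-cong (allFin (suc w)) (λ m → sym (∑-*ʳ (allFin (suc w)) (mono (toℕ m)) (λ r → p r * K r (toℕ m)))) ⟩
    ∑ (allFin (suc w)) (λ m → ∑ (allFin (suc w)) (λ r → p r * K r (toℕ m) * mono (toℕ m)))
      ≡⟨ ∑-swap (allFin (suc w)) (allFin (suc w)) (λ m r → p r * K r (toℕ m) * mono (toℕ m)) ⟩
    ∑ (allFin (suc w)) (λ r → ∑ (allFin (suc w)) (λ m → p r * K r (toℕ m) * mono (toℕ m)))
      ≡⟨ ∑-cong (allFin (suc w)) step ⟩
    ev p (ℤ→ℚ a * X + ℤ→ℚ b * Y) (ℤ→ℚ c * X + ℤ→ℚ d * Y) ∎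
    where
    open ≡-Reasoning
    K : Fin (suc w) → ℕ → ℚ
    K r = coefficient w (toℕ r) γ
    mono : ℕ → ℚ
    mono m = X ^ m * Y ^ (w ℕ.∸ m)
    step : ∀ r → ∑ (allFin (suc w)) (λ m → p r * K r (toℕ m) * mono (toℕ m))
               ≡ p r * ((ℤ→ℚ a * X + ℤ→ℚ b * Y) ^ toℕ r * (ℤ→ℚ c * X + ℤ→ℚ d * Y) ^ (w ℕ.∸ toℕ r))
    step r = begin
      ∑ (allFin (suc w)) (λ m → p r * K r (toℕ m) * mono (toℕ m))
        ≡⟨ ∑-cong (allFin (suc w)) (λ m → ℚP.*-assoc (p r) (K r (toℕ m)) (mono (toℕ m))) ⟩
      ∑ (allFin (suc w)) (λ m → p r * (K r (toℕ m) * mono (toℕ m)))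
        ≡⟨ ∑-*ˡ (allFin (suc w)) (p r) (λ m → K r (toℕ m) * mono (toℕ m)) ⟩
      p r * ∑ (allFin (suc w)) (λ m → K r (toℕ m) * mono (toℕ m))
        ≡⟨ cong (p r *_) (trans (∑-toℕ (suc w) (λ m → K r m * mono m)) (coefficients (toℕ≤w r) a b c d X Y)) ⟩
      p r * ((ℤ→ℚ a * X + ℤ→ℚ b * Y) ^ toℕ r * (ℤ→ℚ c * X + ℤ→ℚ d * Y) ^ (w ℕ.∸ toℕ r)) ∎

  -- Setting Y = 1 leaves a polynomial in one variable, to which `vanishing` applies.
  ev-injective : ∀ p q → (∀ X Y → ev p X Y ≡ ev q X Y) → ∀ i → p i ≡ q i
  ev-injective p q h i = x-y≡0⇒x≡y (p i) (q i) (vanishing (suc w) (λ i → p i - q i) (λ t _ → begin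
    ∑ (allFin (suc w)) (λ i → (p i - q i) * t ^ toℕ i)
      ≡⟨ ∑-cong (allFin (suc w)) (λ i → trans
           (solve 3 (λ p q x → (p :- q) :* x := p :* (x :* con 1ℚ) :+ con (- 1ℚ) :* (q :* (x :* con 1ℚ))) refl (p i) (q i) (t ^ toℕ i))
           (cong (λ u → p i * (t ^ toℕ i * u) + - 1ℚ * (q i * (t ^ toℕ i * u))) (sym (1^n≡1 (w ℕ.∸ toℕ i))))) ⟩
    ∑ (allFin (suc w)) (λ i → p i * (t ^ toℕ i * 1ℚ ^ (w ℕ.∸ toℕ i)) + - 1ℚ * (q i * (t ^ toℕ i * 1ℚ ^ (w ℕ.∸ toℕ i))))
      ≡⟨ ∑-+ (allFin (suc w)) (λ i → p i * (t ^ toℕ i * 1ℚ ^ (w ℕ.∸ toℕ i))) (λ i → - 1ℚ * (q i * (t ^ toℕ i * 1ℚ ^ (w ℕ.∸ toℕ i)))) ⟩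
    ev p t 1ℚ + ∑ (allFin (suc w)) (λ i → - 1ℚ * (q i * (t ^ toℕ i * 1ℚ ^ (w ℕ.∸ toℕ i))))
      ≡⟨ cong (ev p t 1ℚ +_) (∑-*ˡ (allFin (suc w)) (- 1ℚ) (λ i → q i * (t ^ toℕ i * 1ℚ ^ (w ℕ.∸ toℕ i)))) ⟩
    ev p t 1ℚ + - 1ℚ * ev q t 1ℚ
      ≡⟨ cong (_+ - 1ℚ * ev q t 1ℚ) (h t 1ℚ) ⟩
    ev q t 1ℚ + - 1ℚ * ev q t 1ℚ
      ≡⟨ solve 1 (λ x → x :+ con (- 1ℚ) :* x := con 0ℚ) refl (ev q t 1ℚ) ⟩
    0ℚ ∎) i)
    where open ≡-Reasoning

  -- Identifies an image by its values. Composition, diagonal matrices, `δM`, `JM` and the identity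
  -- are all treated in this way.
  actV-unique : ∀ γ p q → let open M2 γ in
    (∀ X Y → ev q X Y ≡ ev p (ℤ→ℚ a * X + ℤ→ℚ b * Y) (ℤ→ℚ c * X + ℤ→ℚ d * Y)) → ∀ i → actV γ p i ≡ q i
  actV-unique γ p q h = ev-injective (actV γ p) q (λ X Y → trans (ev-actV γ p X Y) (sym (h X Y)))

  -- Two successive substitutions are one substitution by the product matrix. On coefficients the
  -- same fact would be an identity between multiple binomial sums.
  actV-⊗ : ∀ γ γ′ p i → actV γ′ (actV γ p) i ≡ actV (γ ⊗ γ′) p i
  actV-⊗ γ@(mat a b c d) γ′@(mat a′ b′ c′ d′) p i = sym (actV-unique (γ ⊗ γ′) p (actV γ′ (actV γ p)) (λ X Y → begin
    ev (actV γ′ (actV γ p)) X Y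
      ≡⟨ ev-actV γ′ (actV γ p) X Y ⟩
    ev (actV γ p) (ℤ→ℚ a′ * X + ℤ→ℚ b′ * Y) (ℤ→ℚ c′ * X + ℤ→ℚ d′ * Y)
      ≡⟨ ev-actV γ p (ℤ→ℚ a′ * X + ℤ→ℚ b′ * Y) (ℤ→ℚ c′ * X + ℤ→ℚ d′ * Y) ⟩
    _ ≡⟨ cong₂ (ev p) (row a b X Y) (row c d X Y) ⟩
    _ ∎) i)
    where
    open ≡-Reasoning
    row : ∀ x y X Y → ℤ→ℚ x * (ℤ→ℚ a′ * X + ℤ→ℚ b′ * Y) + ℤ→ℚ y * (ℤ→ℚ c′ * X + ℤ→ℚ d′ * Y)
        ≡ ℤ→ℚ (x ℤ.* a′ ℤ.+ y ℤ.* c′) * X + ℤ→ℚ (x ℤ.* b′ ℤ.+ y ℤ.* d′) * Y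
    row x y X Y
      rewrite ℤ→ℚ-+ (x ℤ.* a′) (y ℤ.* c′) | ℤ→ℚ-+ (x ℤ.* b′) (y ℤ.* d′)
            | ℤ→ℚ-* x a′ | ℤ→ℚ-* y c′ | ℤ→ℚ-* x b′ | ℤ→ℚ-* y d′
      = solve 8 (λ x y a b c d X Y → x :* (a :* X :+ b :* Y) :+ y :* (c :* X :+ d :* Y)
                                  := (x :* a :+ y :* c) :* X :+ (x :* b :+ y :* d) :* Y) refl
          (ℤ→ℚ x) (ℤ→ℚ y) (ℤ→ℚ a′) (ℤ→ℚ b′) (ℤ→ℚ c′) (ℤ→ℚ d′) X Y

  actV-cong : ∀ γ {p q} → (∀ i → p i ≡ q i) → ∀ i → actV γ p i ≡ actV γ q i
  actV-cong γ h i = ∑-cong (allFin (suc w)) (λ r → cong (_* coefficient w (toℕ r) γ (toℕ i)) (h r))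

  actV-+ : ∀ γ p q i → actV γ (λ j → p j + q j) i ≡ actV γ p i + actV γ q i
  actV-+ γ p q i = trans
    (∑-cong (allFin (suc w)) (λ r → ℚP.*-distribʳ-+ (coefficient w (toℕ r) γ (toℕ i)) (p r) (q r)))
    (∑-+ (allFin (suc w)) (λ r → p r * coefficient w (toℕ r) γ (toℕ i)) (λ r → q r * coefficient w (toℕ r) γ (toℕ i)))

  actV-* : ∀ γ x p i → actV γ (λ j → x * p j) i ≡ x * actV γ p i
  actV-* γ x p i = trans
    (∑-cong (allFin (suc w)) (λ r → ℚP.*-assoc x (p r) (coefficient w (toℕ r) γ (toℕ i))))
    (∑-*ˡ (allFin (suc w)) x (λ r → p r * coefficient w (toℕ r) γ (toℕ i)))

  monomial : Fin (suc w) → V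
  monomial r m = indicator (r FinP.≟ m)

  ev-monomial : ∀ r X Y → ev (monomial r) X Y ≡ X ^ toℕ r * Y ^ (w ℕ.∸ toℕ r)
  ev-monomial r X Y = trans
    (∑-Fin-single {suc w} r (λ i i≢r → *-zeroˡ′ (X ^ toℕ i * Y ^ (w ℕ.∸ toℕ i)) (indicator-no (r FinP.≟ i) (λ e → i≢r (sym e)))))
    (trans (cong (_* (X ^ toℕ r * Y ^ (w ℕ.∸ toℕ r))) (indicator-yes (r FinP.≟ r) refl))
           (ℚP.*-identityˡ (X ^ toℕ r * Y ^ (w ℕ.∸ toℕ r))))

  actV-diagonal : ∀ α β r m →
    actV (mat α (ℤ.+ 0) (ℤ.+ 0) β) (monomial r) m ≡ ℤ→ℚ α ^ toℕ r * ℤ→ℚ β ^ (w ℕ.∸ toℕ r) * monomial r m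
  actV-diagonal α β r = actV-unique (mat α (ℤ.+ 0) (ℤ.+ 0) β) (monomial r)
    (λ m → ℤ→ℚ α ^ toℕ r * ℤ→ℚ β ^ (w ℕ.∸ toℕ r) * monomial r m) (λ X Y → begin
    ∑ (allFin (suc w)) (λ i → x * monomial r i * (X ^ toℕ i * Y ^ (w ℕ.∸ toℕ i)))
      ≡⟨ ∑-cong (allFin (suc w)) (λ i → ℚP.*-assoc x (monomial r i) (X ^ toℕ i * Y ^ (w ℕ.∸ toℕ i))) ⟩
    ∑ (allFin (suc w)) (λ i → x * (monomial r i * (X ^ toℕ i * Y ^ (w ℕ.∸ toℕ i))))
      ≡⟨ ∑-*ˡ (allFin (suc w)) x (λ i → monomial r i * (X ^ toℕ i * Y ^ (w ℕ.∸ toℕ i))) ⟩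
    x * ev (monomial r) X Y
      ≡⟨ cong (x *_) (ev-monomial r X Y) ⟩
    x * (X ^ toℕ r * Y ^ (w ℕ.∸ toℕ r))
      ≡⟨ solve 4 (λ a b c d → a :* b :* (c :* d) := a :* c :* (b :* d)) refl
           (ℤ→ℚ α ^ toℕ r) (ℤ→ℚ β ^ (w ℕ.∸ toℕ r)) (X ^ toℕ r) (Y ^ (w ℕ.∸ toℕ r)) ⟩
    ℤ→ℚ α ^ toℕ r * X ^ toℕ r * (ℤ→ℚ β ^ (w ℕ.∸ toℕ r) * Y ^ (w ℕ.∸ toℕ r))
      ≡⟨ cong₂ _*_ (^-distrib-* (ℤ→ℚ α) X (toℕ r)) (^-distrib-* (ℤ→ℚ β) Y (w ℕ.∸ toℕ r)) ⟨
    (ℤ→ℚ α * X) ^ toℕ r * (ℤ→ℚ β * Y) ^ (w ℕ.∸ toℕ r)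
      ≡⟨ cong₂ (λ u v → u ^ toℕ r * v ^ (w ℕ.∸ toℕ r))
           (solve 2 (λ u v → u := u :+ con 0ℚ :* v) refl (ℤ→ℚ α * X) Y)
           (solve 2 (λ u v → v := con 0ℚ :* u :+ v) refl X (ℤ→ℚ β * Y)) ⟩
    (ℤ→ℚ α * X + 0ℚ * Y) ^ toℕ r * (0ℚ * X + ℤ→ℚ β * Y) ^ (w ℕ.∸ toℕ r)
      ≡⟨ ev-monomial r (ℤ→ℚ α * X + 0ℚ * Y) (0ℚ * X + ℤ→ℚ β * Y) ⟨
    ev (monomial r) (ℤ→ℚ α * X + 0ℚ * Y) (0ℚ * X + ℤ→ℚ β * Y) ∎)
    where
    open ≡-Reasoning
    x = ℤ→ℚ α ^ toℕ r * ℤ→ℚ β ^ (w ℕ.∸ toℕ r)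

  toℕ-opposite : (r : Fin (suc w)) → toℕ (Fin.opposite r) ≡ w ℕ.∸ toℕ r
  toℕ-opposite = FinP.opposite-prop

  toℕ-opposite′ : (r : Fin (suc w)) → w ℕ.∸ toℕ (Fin.opposite r) ≡ toℕ r
  toℕ-opposite′ r = trans (cong (w ℕ.∸_) (toℕ-opposite r)) (ℕP.m∸[m∸n]≡n (toℕ≤w r))

  actV-δ : ∀ r m → actV δM (monomial r) m ≡ monomial (Fin.opposite r) m
  actV-δ r = actV-unique δM (monomial r) (monomial (Fin.opposite r)) (λ X Y → begin
    ev (monomial (Fin.opposite r)) X Y
      ≡⟨ ev-monomial (Fin.opposite r) X Y ⟩
    X ^ toℕ (Fin.opposite r) * Y ^ (w ℕ.∸ toℕ (Fin.opposite r))
      ≡⟨ cong₂ (λ e e′ → X ^ e * Y ^ e′) (toℕ-opposite r) (toℕ-opposite′ r) ⟩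
    X ^ (w ℕ.∸ toℕ r) * Y ^ toℕ r
      ≡⟨ ℚP.*-comm (X ^ (w ℕ.∸ toℕ r)) (Y ^ toℕ r) ⟩
    Y ^ toℕ r * X ^ (w ℕ.∸ toℕ r)
      ≡⟨ cong₂ (λ u v → u ^ toℕ r * v ^ (w ℕ.∸ toℕ r))
           (solve 2 (λ X Y → Y := con 0ℚ :* X :+ con 1ℚ :* Y) refl X Y)
           (solve 2 (λ X Y → X := con 1ℚ :* X :+ con 0ℚ :* Y) refl X Y) ⟩
    (0ℚ * X + 1ℚ * Y) ^ toℕ r * (1ℚ * X + 0ℚ * Y) ^ (w ℕ.∸ toℕ r)
      ≡⟨ ev-monomial r (0ℚ * X + 1ℚ * Y) (1ℚ * X + 0ℚ * Y) ⟨
    ev (monomial r) (0ℚ * X + 1ℚ * Y) (1ℚ * X + 0ℚ * Y) ∎)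
    where open ≡-Reasoning

  actV-monomial : ∀ γ r m → actV γ (monomial r) m ≡ coefficient w (toℕ r) γ (toℕ m)
  actV-monomial γ r m = trans
    (∑-Fin-single {suc w} r (λ i i≢r → *-zeroˡ′ (coefficient w (toℕ i) γ (toℕ m)) (indicator-no (r FinP.≟ i) (λ e → i≢r (sym e)))))
    (trans (cong (_* coefficient w (toℕ r) γ (toℕ m)) (indicator-yes (r FinP.≟ r) refl))
           (ℚP.*-identityˡ (coefficient w (toℕ r) γ (toℕ m))))

  -- Under T the monomial X^r Y^s becomes (X+Y)^r Y^s. In the coefficient formula the zero entry is
  -- raised to the power m - i, so only i = m survives, with 0^0 = 1.
  actV-T : ∀ r m → actV TM (monomial r) m ≡ ℕ→ℚ (toℕ r C toℕ m)
  actV-T r m = trans (actV-monomial TM r m)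
    (trans (∑-upTo-single (toℕ m) ℕP.≤-refl (λ i i<1+m i≢m → off-diagonal i (ℕP.≤∧≢⇒< (ℕP.≤-pred i<1+m) i≢m))) diagonal)
    where
    s = w ℕ.∸ toℕ r
    0^ : ∀ {n} → 0 ℕ.< n → (ℤ.+ 0) ℤ.^ n ≡ ℤ.+ 0
    0^ (ℕ.s≤s _) = refl
    1^ : ∀ n → (ℤ.+ 1) ℤ.^ n ≡ ℤ.+ 1
    1^ = ℤP.^-zeroˡ
    off-diagonal : ∀ i → i ℕ.< toℕ m → summand w (toℕ r) TM (toℕ m) i ≡ 0ℚ
    off-diagonal i i<m = *-zeroʳ′ (ℕ→ℚ ((toℕ r C i) ℕ.* (s C (toℕ m ℕ.∸ i)))) (cong ℤ→ℚ
      (trans (cong (λ z → A ℤ.* z ℤ.* B) (0^ (ℕP.m<n⇒0<n∸m i<m)))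
      (trans (cong (ℤ._* B) (ℤP.*-zeroʳ A)) (ℤP.*-zeroˡ B))))
      where
      A = (ℤ.+ 1) ℤ.^ i ℤ.* (ℤ.+ 1) ℤ.^ (toℕ r ℕ.∸ i)
      B = (ℤ.+ 1) ℤ.^ (s ℕ.∸ (toℕ m ℕ.∸ i))
    diagonal : summand w (toℕ r) TM (toℕ m) (toℕ m) ≡ ℕ→ℚ (toℕ r C toℕ m)
    diagonal = trans (cong₂ (λ u v → ℕ→ℚ u * ℤ→ℚ v) binomials units) (ℚP.*-identityʳ (ℕ→ℚ (toℕ r C toℕ m)))
      where
      binomials : (toℕ r C toℕ m) ℕ.* (s C (toℕ m ℕ.∸ toℕ m)) ≡ toℕ r C toℕ m
      binomials = trans (cong (λ t → (toℕ r C toℕ m) ℕ.* (s C t)) (ℕP.n∸n≡0 (toℕ m))) (ℕP.*-identityʳ (toℕ r C toℕ m))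
      units : (ℤ.+ 1) ℤ.^ toℕ m ℤ.* (ℤ.+ 1) ℤ.^ (toℕ r ℕ.∸ toℕ m) ℤ.* (ℤ.+ 0) ℤ.^ (toℕ m ℕ.∸ toℕ m)
              ℤ.* (ℤ.+ 1) ℤ.^ (s ℕ.∸ (toℕ m ℕ.∸ toℕ m)) ≡ ℤ.+ 1
      units rewrite 1^ (toℕ m) | 1^ (toℕ r ℕ.∸ toℕ m) | ℕP.n∸n≡0 (toℕ m) | 1^ s = refl

-- Integer matrices.

det : M2 → ℤ.ℤ
det (mat a b c d) = a ℤ.* d ℤ.- b ℤ.* c

-- The square admits `εM` and `δM`, of determinant -1, along with the matrices of determinant 1.
Unimodular : M2 → Set
Unimodular γ = det γ ℤ.* det γ ≡ ℤ.+ 1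

mat-cong : ∀ {a b c d a′ b′ c′ d′} → a ≡ a′ → b ≡ b′ → c ≡ c′ → d ≡ d′ → mat a b c d ≡ mat a′ b′ c′ d′
mat-cong refl refl refl refl = refl

transpose-⊗ : ∀ γ γ′ → transpose γ′ ⊗ transpose γ ≡ transpose (γ ⊗ γ′)
transpose-⊗ (mat a b c d) (mat a′ b′ c′ d′) =
  mat-cong (swap a a′ b c′) (swap c a′ d c′) (swap a b′ b d′) (swap c b′ d d′)
  where
  swap : ∀ p q u v → q ℤ.* p ℤ.+ v ℤ.* u ≡ p ℤ.* q ℤ.+ u ℤ.* v
  swap = IntSolver.solve-∀

det-transpose : ∀ γ → det (transpose γ) ≡ det γ
det-transpose (mat a b c d) = cong (λ t → a ℤ.* d ℤ.- t) (ℤP.*-comm c b)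

-- Conjugation by S turns the adjugate into the transpose. After the change of variable by S the
-- rows are therefore moved by γᵗ without an inverse, which is why the coordinates g(C) = P(CS) are
-- used.
S⊗inv₁ : ∀ γ → SM ⊗ inv₁ γ ≡ transpose γ ⊗ SM
S⊗inv₁ (mat a b c d) = mat-cong (left d a c) (right b c a) (left′ d b c) (right′ b d a)
  where
  left : ∀ d a c → ℤ.+ 0 ℤ.* d ℤ.+ (ℤ.- ℤ.+ 1) ℤ.* (ℤ.- c) ≡ a ℤ.* ℤ.+ 0 ℤ.+ c ℤ.* ℤ.+ 1
  left = IntSolver.solve-∀
  right : ∀ b c a → ℤ.+ 0 ℤ.* (ℤ.- b) ℤ.+ (ℤ.- ℤ.+ 1) ℤ.* a ≡ a ℤ.* (ℤ.- ℤ.+ 1) ℤ.+ c ℤ.* ℤ.+ 0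
  right = IntSolver.solve-∀
  left′ : ∀ d b c → ℤ.+ 1 ℤ.* d ℤ.+ ℤ.+ 0 ℤ.* (ℤ.- c) ≡ b ℤ.* ℤ.+ 0 ℤ.+ d ℤ.* ℤ.+ 1
  left′ = IntSolver.solve-∀
  right′ : ∀ b d a → ℤ.+ 1 ℤ.* (ℤ.- b) ℤ.+ ℤ.+ 0 ℤ.* a ≡ b ℤ.* (ℤ.- ℤ.+ 1) ℤ.+ d ℤ.* ℤ.+ 0
  right′ = IntSolver.solve-∀

-- Residue classes mod N and the right action of matrices on rows.

module Residues (N : ℕ) .{{_ : NonZero N}} (w : ℕ) where
  open Setup N w

  infix 4 _≋_
  -- A record, so that u and v are recovered from the type; they could not be inferred from the
  -- difference alone.
  record _≋_ (u v : ℤ.ℤ) : Set where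
    constructor congruent
    field N∣difference : ℤ.+ N ℤS.∣ u ℤ.- v

  red-≋ : ∀ u → u ≋ toZ (red u)
  red-≋ u = congruent (ℤS.divides (u ℤD./ℕ N) (begin
    u ℤ.- toZ (red u)
      ≡⟨ cong (λ t → u ℤ.- ℤ.+ t) (FinP.toℕ-fromℕ< (ℤD.n%ℕd<d u N)) ⟩
    u ℤ.- r
      ≡⟨ cong (ℤ._- r) (ℤD.a≡a%ℕn+[a/ℕn]*n u N) ⟩
    r ℤ.+ q ℤ.- r
      ≡⟨ cancel r q ⟩
    q ∎))
    where
    open ≡-Reasoning
    r = ℤ.+ (u ℤD.%ℕ N)
    q = (u ℤD./ℕ N) ℤ.* ℤ.+ N
    cancel : ∀ r q → r ℤ.+ q ℤ.- r ≡ q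
    cancel = IntSolver.solve-∀

  private
    -- The difference of the representatives lies between 0 and N - 1 and is divisible by N.
    ≤-≋⇒≡ : ∀ x y → toℕ y ℕ.≤ toℕ x → toZ x ≋ toZ y → x ≡ y
    ≤-≋⇒≡ x y y≤x (congruent N∣) = FinP.toℕ-injective (ℕP.≤-antisym (ℕP.m∸n≡0⇒m≤n diff≡0) y≤x)
      where
      N∣′ : N ℕD.∣ toℕ x ℕ.∸ toℕ y
      N∣′ = ℤS.∣⇒∣ᵤ (subst (ℤ.+ N ℤS.∣_) (trans (ℤP.m-n≡m⊖n (toℕ x) (toℕ y)) (ℤP.⊖-≥ y≤x)) N∣)
      diff≡0 : toℕ x ℕ.∸ toℕ y ≡ 0
      diff≡0 = trans (sym (ℕDM.m<n⇒m%n≡m (ℕP.≤-<-trans (ℕP.m∸n≤m (toℕ x) (toℕ y)) (FinP.toℕ<n x))))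
                     (ℕD.n∣m⇒m%n≡0 (toℕ x ℕ.∸ toℕ y) N N∣′)

  ≋-sym : ∀ {u v} → u ≋ v → v ≋ u
  ≋-sym {u} {v} (congruent h) = congruent (subst (ℤ.+ N ℤS.∣_) (flip u v) (ℤS.∣m⇒∣-m h))
    where
    flip : ∀ u v → ℤ.- (u ℤ.- v) ≡ v ℤ.- u
    flip = IntSolver.solve-∀

  ≋-trans : ∀ {u v t} → u ≋ v → v ≋ t → u ≋ t
  ≋-trans {u} {v} {t} (congruent h) (congruent h′) =
    congruent (subst (ℤ.+ N ℤS.∣_) (telescope u v t) (ℤS.∣m∣n⇒∣m+n h h′))
    where
    telescope : ∀ u v t → u ℤ.- v ℤ.+ (v ℤ.- t) ≡ u ℤ.- t
    telescope = IntSolver.solve-∀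

  ≋⇒≡ : ∀ x y → toZ x ≋ toZ y → x ≡ y
  ≋⇒≡ x y h = [ (λ y≤x → ≤-≋⇒≡ x y y≤x h) , (λ x≤y → sym (≤-≋⇒≡ y x x≤y (≋-sym h))) ]′ (ℕP.≤-total (toℕ y) (toℕ x))

  red-cong : ∀ {u v} → u ≋ v → red u ≡ red v
  red-cong {u} {v} h = ≋⇒≡ (red u) (red v)
    (≋-trans (≋-sym (red-≋ u)) (≋-trans h (red-≋ v)))

  red-toZ : ∀ x → red (toZ x) ≡ x
  red-toZ x = ≋⇒≡ (red (toZ x)) x (≋-sym (red-≋ (toZ x)))

  -- Reduction between two steps of an integer combination does not matter. Associativity of the row
  -- action and the rules for negated residues rest on this.
  red-combination : ∀ u v a c → red (toZ (red u) ℤ.* a ℤ.+ toZ (red v) ℤ.* c) ≡ red (u ℤ.* a ℤ.+ v ℤ.* c)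
  red-combination u v a c = sym (red-cong {u ℤ.* a ℤ.+ v ℤ.* c} (congruent (subst (ℤ.+ N ℤS.∣_)
    (regroup u v (toZ (red u)) (toZ (red v)) a c)
    (ℤS.∣m∣n⇒∣m+n (ℤS.∣m⇒∣m*n a (_≋_.N∣difference (red-≋ u))) (ℤS.∣m⇒∣m*n c (_≋_.N∣difference (red-≋ v)))))))
    where
    regroup : ∀ u v u′ v′ a c → (u ℤ.- u′) ℤ.* a ℤ.+ (v ℤ.- v′) ℤ.* c ≡ u ℤ.* a ℤ.+ v ℤ.* c ℤ.- (u′ ℤ.* a ℤ.+ v′ ℤ.* c)
    regroup = IntSolver.solve-∀

  infixl 7 _⊙_
  _⊙_ : Fin N × Fin N → M2 → Fin N × Fin N
  (x , y) ⊙ γ = rowMul x y γ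

  ⊙-⊗ : ∀ v A B → (v ⊙ A) ⊙ B ≡ v ⊙ (A ⊗ B)
  ⊙-⊗ (x , y) (mat a b c d) (mat a′ b′ c′ d′) = cong₂ _,_
    (trans (red-combination (toZ x ℤ.* a ℤ.+ toZ y ℤ.* c) (toZ x ℤ.* b ℤ.+ toZ y ℤ.* d) a′ c′) (cong red (assoc (toZ x) (toZ y) a b c d a′ c′)))
    (trans (red-combination (toZ x ℤ.* a ℤ.+ toZ y ℤ.* c) (toZ x ℤ.* b ℤ.+ toZ y ℤ.* d) b′ d′) (cong red (assoc (toZ x) (toZ y) a b c d b′ d′)))
    where
    assoc : ∀ x y a b c d p q → (x ℤ.* a ℤ.+ y ℤ.* c) ℤ.* p ℤ.+ (x ℤ.* b ℤ.+ y ℤ.* d) ℤ.* q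
          ≡ x ℤ.* (a ℤ.* p ℤ.+ b ℤ.* q) ℤ.+ y ℤ.* (c ℤ.* p ℤ.+ d ℤ.* q)
    assoc = IntSolver.solve-∀

  ⊙-identity : ∀ v → v ⊙ mat (ℤ.+ 1) (ℤ.+ 0) (ℤ.+ 0) (ℤ.+ 1) ≡ v
  ⊙-identity (x , y) = cong₂ _,_ (trans (cong red (first (toZ x) (toZ y))) (red-toZ x))
                                 (trans (cong red (second (toZ x) (toZ y))) (red-toZ y))
    where
    first : ∀ x y → x ℤ.* ℤ.+ 1 ℤ.+ y ℤ.* ℤ.+ 0 ≡ x
    first = IntSolver.solve-∀
    second : ∀ x y → x ℤ.* ℤ.+ 0 ℤ.+ y ℤ.* ℤ.+ 1 ≡ y
    second = IntSolver.solve-∀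

  InA : Fin N × Fin N → Set
  InA (x , y) = IsA x y

  -- By Cramer's rule a common divisor of N and the new row divides the old entries multiplied by
  -- det² = 1.
  InA-⊙ : ∀ γ → Unimodular γ → ∀ v → InA v → InA (v ⊙ γ)
  InA-⊙ γ@(mat a b c d) unit v@(x , y) isA = ℕD.∣1⇒≡1 (subst (g ℕD.∣_) isA (ℕG.gcd-greatest (ℕG.gcd-greatest g∣x g∣y) g∣N))
    where
    u₁ = proj₁ (v ⊙ γ)
    u₂ = proj₂ (v ⊙ γ)
    z₁ = toZ x ℤ.* a ℤ.+ toZ y ℤ.* c
    z₂ = toZ x ℤ.* b ℤ.+ toZ y ℤ.* d
    D = det γ
    g = ℕG.gcd (ℕG.gcd (toℕ u₁) (toℕ u₂)) N
    g∣N : g ℕD.∣ N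
    g∣N = ℕG.gcd[m,n]∣n (ℕG.gcd (toℕ u₁) (toℕ u₂)) N
    lift : ∀ z → g ℕD.∣ toℕ (red z) → (ℤ.+ g) ℤS.∣ z
    lift z h = subst ((ℤ.+ g) ℤS.∣_) (cancel z (toZ (red z)))
      (ℤS.∣m∣n⇒∣m+n (ℤS.∣-trans (ℤS.∣ᵤ⇒∣ {ℤ.+ g} {ℤ.+ N} g∣N) (_≋_.N∣difference (red-≋ z))) (ℤS.∣ᵤ⇒∣ {ℤ.+ g} {toZ (red z)} h))
      where
      cancel : ∀ z r → z ℤ.- r ℤ.+ r ≡ z
      cancel = IntSolver.solve-∀
    g∣z₁ : (ℤ.+ g) ℤS.∣ z₁
    g∣z₁ = lift z₁ (ℕD.∣-trans (ℕG.gcd[m,n]∣m _ N) (ℕG.gcd[m,n]∣m (toℕ u₁) (toℕ u₂)))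
    g∣z₂ : (ℤ.+ g) ℤS.∣ z₂
    g∣z₂ = lift z₂ (ℕD.∣-trans (ℕG.gcd[m,n]∣m _ N) (ℕG.gcd[m,n]∣n (toℕ u₁) (toℕ u₂)))
    cramer₁ : ∀ x y a b c d → (x ℤ.* a ℤ.+ y ℤ.* c) ℤ.* (d ℤ.* (a ℤ.* d ℤ.- b ℤ.* c))
                  ℤ.+ (x ℤ.* b ℤ.+ y ℤ.* d) ℤ.* (ℤ.- c ℤ.* (a ℤ.* d ℤ.- b ℤ.* c))
                  ≡ x ℤ.* ((a ℤ.* d ℤ.- b ℤ.* c) ℤ.* (a ℤ.* d ℤ.- b ℤ.* c))
    cramer₁ = IntSolver.solve-∀
    cramer₂ : ∀ x y a b c d → (x ℤ.* a ℤ.+ y ℤ.* c) ℤ.* (ℤ.- b ℤ.* (a ℤ.* d ℤ.- b ℤ.* c))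
                  ℤ.+ (x ℤ.* b ℤ.+ y ℤ.* d) ℤ.* (a ℤ.* (a ℤ.* d ℤ.- b ℤ.* c))
                  ≡ y ℤ.* ((a ℤ.* d ℤ.- b ℤ.* c) ℤ.* (a ℤ.* d ℤ.- b ℤ.* c))
    cramer₂ = IntSolver.solve-∀
    ×unit : ∀ t → t ℤ.* (D ℤ.* D) ≡ t
    ×unit t = trans (cong (t ℤ.*_) unit) (ℤP.*-identityʳ t)
    g∣x : g ℕD.∣ toℕ x
    g∣x = ℤS.∣⇒∣ᵤ (subst ((ℤ.+ g) ℤS.∣_) (trans (cramer₁ (toZ x) (toZ y) a b c d) (×unit (toZ x)))
      (ℤS.∣m∣n⇒∣m+n (ℤS.∣m⇒∣m*n (d ℤ.* D) g∣z₁) (ℤS.∣m⇒∣m*n (ℤ.- c ℤ.* D) g∣z₂)))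
    g∣y : g ℕD.∣ toℕ y
    g∣y = ℤS.∣⇒∣ᵤ (subst ((ℤ.+ g) ℤS.∣_) (trans (cramer₂ (toZ x) (toZ y) a b c d) (×unit (toZ y)))
      (ℤS.∣m∣n⇒∣m+n (ℤS.∣m⇒∣m*n (ℤ.- b ℤ.* D) g∣z₁) (ℤS.∣m⇒∣m*n (a ℤ.* D) g∣z₂)))

-- The action of integer matrices on maps.

-- With bottom rows (x,y) and a map P, put g(x,y) = P((x,y)S).  Then the action of SL(2,Z) and of ε on P becomes
-- g‖γ (v; X,Y) = g(v γᵗ; (X,Y)γᵗ), which makes sense for every integer matrix γ.
module Action (N : ℕ) .{{_ : NonZero N}} (w : ℕ) where
  open Setup N w
  open Polynomials N w
  open Residues N w

  at : Map → Fin N × Fin N → V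
  at f (x , y) = f x y

  at-≡ : ∀ f {v v′} → v ≡ v′ → ∀ i → at f v i ≡ at f v′ i
  at-≡ f refl i = refl

  infixl 8 _∘S
  _∘S : Map → Map
  (P ∘S) x y = at P ((x , y) ⊙ SM)

  infixl 7 _‖_
  opaque
    -- Opaque, so that outside this block equations between maps are compared by the rules proved
    -- here and never by unfolding the sums in `actV`; `‖-def` leads back to the definition.
    _‖_ : Map → M2 → Map
    (f ‖ γ) x y = actV γ (at f ((x , y) ⊙ transpose γ))

    ‖-def : ∀ f γ x y i → (f ‖ γ) x y i ≡ actV γ (at f ((x , y) ⊙ transpose γ)) i
    ‖-def f γ x y i = refl

    ‖-ext : ∀ γ {f g : Map} → (∀ x y m → f x y m ≡ g x y m) → ∀ x y m → (f ‖ γ) x y m ≡ (g ‖ γ) x y m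
    ‖-ext γ h x y m = actV-cong γ (h (proj₁ ((x , y) ⊙ transpose γ)) (proj₂ ((x , y) ⊙ transpose γ))) m

    ‖-⊗ : ∀ f γ γ′ x y i → (f ‖ γ ‖ γ′) x y i ≡ (f ‖ (γ ⊗ γ′)) x y i
    ‖-⊗ f γ γ′ x y i = trans (actV-⊗ γ γ′ (at f ((x , y) ⊙ transpose γ′ ⊙ transpose γ)) i)
      (actV-cong (γ ⊗ γ′) (at-≡ f (trans (⊙-⊗ (x , y) (transpose γ′) (transpose γ))
                                         (cong ((x , y) ⊙_) (transpose-⊗ γ γ′)))) i)

    -- Here, unlike in `‖-ext`, equality is known on A(N) only, so the matrix has to preserve A(N).
    ‖-cong : ∀ γ → Unimodular γ → ∀ {f g} → f ≈M g → (f ‖ γ) ≈M (g ‖ γ)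
    ‖-cong γ unit f≈g x y isA i = actV-cong γ
      (f≈g (proj₁ ((x , y) ⊙ transpose γ)) (proj₂ ((x , y) ⊙ transpose γ)) (InA-⊙ (transpose γ) (trans (cong₂ ℤ._*_ (det-transpose γ) (det-transpose γ)) unit) (x , y) isA)) i

    ‖-+ : ∀ f g γ x y i → ((f +M g) ‖ γ) x y i ≡ (f ‖ γ) x y i + (g ‖ γ) x y i
    ‖-+ f g γ x y i = actV-+ γ (at f ((x , y) ⊙ transpose γ)) (at g ((x , y) ⊙ transpose γ)) i

    ‖-* : ∀ q f γ x y i → ((q *M f) ‖ γ) x y i ≡ q * (f ‖ γ) x y i
    ‖-* q f γ x y i = actV-* γ q (at f ((x , y) ⊙ transpose γ)) i

    ‖-- : ∀ f g γ x y i → ((f -M g) ‖ γ) x y i ≡ (f ‖ γ) x y i - (g ‖ γ) x y i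
    ‖-- f g γ x y i = begin
      ((f -M g) ‖ γ) x y i
        ≡⟨ ‖-ext γ {g = f +M ((- 1ℚ) *M g)}
             (λ x y j → solve 2 (λ a b → a :- b := a :+ con (- 1ℚ) :* b) refl (f x y j) (g x y j)) x y i ⟩
      ((f +M ((- 1ℚ) *M g)) ‖ γ) x y i
        ≡⟨ trans (‖-+ f ((- 1ℚ) *M g) γ x y i) (cong ((f ‖ γ) x y i +_) (‖-* (- 1ℚ) g γ x y i)) ⟩
      (f ‖ γ) x y i + - 1ℚ * (g ‖ γ) x y i
        ≡⟨ solve 2 (λ a b → a :+ con (- 1ℚ) :* b := a :- b) refl ((f ‖ γ) x y i) ((g ‖ γ) x y i) ⟩
      (f ‖ γ) x y i - (g ‖ γ) x y i ∎
      where open ≡-Reasoning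

    ∘S-∣ : ∀ P γ x y i → ((P ∣ γ) ∘S) x y i ≡ (P ∘S ‖ γ) x y i
    ∘S-∣ P γ x y = actV-cong γ (at-≡ P (trans (⊙-⊗ (x , y) SM (inv₁ γ))
      (trans (cong ((x , y) ⊙_) (S⊗inv₁ γ)) (sym (⊙-⊗ (x , y) (transpose γ) SM)))))

    -- The row of JεCε arises from that of C by diag(1,-1), and S diag(1,-1) = εS. As ε is its own
    -- transpose, its separately defined action becomes a case of the general rule.
    ∘S-∣ε : ∀ P x y i → ((P ∣ε) ∘S) x y i ≡ (P ∘S ‖ εM) x y i
    ∘S-∣ε P x y = actV-cong εM (at-≡ P (trans (reflect ((x , y) ⊙ SM))
      (trans (⊙-⊗ (x , y) SM (mat (ℤ.+ 1) (ℤ.+ 0) (ℤ.+ 0) (ℤ.- ℤ.+ 1))) (sym (⊙-⊗ (x , y) εM SM)))))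
      where
      reflect : ∀ v → (proj₁ v , ⊝ proj₂ v) ≡ v ⊙ mat (ℤ.+ 1) (ℤ.+ 0) (ℤ.+ 0) (ℤ.- ℤ.+ 1)
      reflect (x , y) = cong₂ _,_ (sym (trans (cong red (first (toZ x) (toZ y))) (red-toZ x)))
                                  (cong red (second (toZ x) (toZ y)))
        where
        first : ∀ x y → x ℤ.* ℤ.+ 1 ℤ.+ y ℤ.* ℤ.+ 0 ≡ x
        first = IntSolver.solve-∀
        second : ∀ x y → ℤ.- y ≡ x ℤ.* ℤ.+ 0 ℤ.+ y ℤ.* (ℤ.- ℤ.+ 1)
        second = IntSolver.solve-∀

  S⁻¹ : M2
  S⁻¹ = inv₁ SM

  ∘S-cong : ∀ {P Q} → P ≈M Q → (P ∘S) ≈M (Q ∘S)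
  ∘S-cong P≈Q x y isA = P≈Q _ _ (InA-⊙ SM refl (x , y) isA)

  ∘S-injective : ∀ {P Q} → (P ∘S) ≈M (Q ∘S) → P ≈M Q
  ∘S-injective {P} {Q} h x y isA i = begin
    at P (x , y) i           ≡⟨ at-≡ P v≡ i ⟨
    at P v i                 ≡⟨ h (proj₁ u) (proj₂ u) (InA-⊙ S⁻¹ refl (x , y) isA) i ⟩
    at Q v i                 ≡⟨ at-≡ Q v≡ i ⟩
    at Q (x , y) i           ∎
    where
    open ≡-Reasoning
    u = (x , y) ⊙ S⁻¹
    v = u ⊙ SM
    v≡ : v ≡ (x , y)
    v≡ = trans (⊙-⊗ (x , y) S⁻¹ SM) (⊙-identity (x , y))

  _∘S⁻¹ : Map → Map
  (f ∘S⁻¹) x y = at f ((x , y) ⊙ S⁻¹)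

  ∘S⁻¹-∘S : ∀ f x y i → ((f ∘S⁻¹) ∘S) x y i ≡ f x y i
  ∘S⁻¹-∘S f x y = at-≡ f (trans (⊙-⊗ (x , y) SM S⁻¹) (⊙-identity (x , y)))

-- The factorial identity behind the binomial coefficients in the relations of `D`.

C*k![n∸k]!≡n! : ∀ {n k} → k ℕ.≤ n → (n C k) ℕ.* (k ! ℕ.* (n ℕ.∸ k) !) ≡ n !
C*k![n∸k]!≡n! {n} {k} k≤n = trans (cong (ℕ._* (k ! ℕ.* (n ℕ.∸ k) !)) (nCk≡n!/k![n-k]! k≤n))
  (ℕDM.m/n*n≡m {{ k ℕP.!* (n ℕ.∸ k) !≢0 }} (k![n∸k]!∣n! k≤n))

-- With s = w - r and q = r - m this is C(s+q,q) r! s! = C(r,m) m! (s+q)!.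
C-factorials : ∀ {w r m} → r ℕ.≤ w → m ℕ.≤ r →
  ((w ℕ.∸ r ℕ.+ (r ℕ.∸ m)) C (r ℕ.∸ m)) ℕ.* (r ! ℕ.* (w ℕ.∸ r) !) ≡ (r C m) ℕ.* (m ! ℕ.* (w ℕ.∸ m) !)
C-factorials {w} {r} {m} r≤w m≤r = ℕP.*-cancelʳ-≡ _ _ (q !) {{ ℕP._!≢0 q }} (begin
  ((s ℕ.+ q) C q) ℕ.* (r ! ℕ.* s !) ℕ.* q !        ≡⟨ regroup₁ ((s ℕ.+ q) C q) (r !) (s !) (q !) ⟩
  ((s ℕ.+ q) C q) ℕ.* (q ! ℕ.* s !) ℕ.* r !        ≡⟨ cong (λ t → ((s ℕ.+ q) C q) ℕ.* (q ! ℕ.* t !) ℕ.* r !) (ℕP.m+n∸n≡m s q) ⟨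
  ((s ℕ.+ q) C q) ℕ.* (q ! ℕ.* (s ℕ.+ q ℕ.∸ q) !) ℕ.* r ! ≡⟨ cong (ℕ._* r !) (C*k![n∸k]!≡n! (ℕP.m≤n+m q s)) ⟩
  (s ℕ.+ q) ! ℕ.* r !                              ≡⟨ cong₂ (λ t t′ → t ! ℕ.* t′) s+q≡w∸m (sym (C*k![n∸k]!≡n! m≤r)) ⟩
  (w ℕ.∸ m) ! ℕ.* ((r C m) ℕ.* (m ! ℕ.* q !))      ≡⟨ regroup₂ ((w ℕ.∸ m) !) (r C m) (m !) (q !) ⟩
  (r C m) ℕ.* (m ! ℕ.* (w ℕ.∸ m) !) ℕ.* q !        ∎)
  where
  open ≡-Reasoning
  s = w ℕ.∸ r
  q = r ℕ.∸ m
  s+q≡w∸m : s ℕ.+ q ≡ w ℕ.∸ m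
  s+q≡w∸m = trans (sym (ℕP.+-∸-assoc s m≤r)) (cong (ℕ._∸ m) (ℕP.m∸n+n≡m r≤w))
  regroup₁ : ∀ a b c d → a ℕ.* (b ℕ.* c) ℕ.* d ≡ a ℕ.* (d ℕ.* c) ℕ.* b
  regroup₁ = NatSolver.solve-∀
  regroup₂ : ∀ a b c d → a ℕ.* (b ℕ.* (c ℕ.* d)) ≡ b ℕ.* (c ℕ.* a) ℕ.* d
  regroup₂ = NatSolver.solve-∀

-- Equal to Jε: the sign change in the second variable, as ε is that in the first.
ε′M : M2
ε′M = mat (ℤ.+ 1) (ℤ.+ 0) (ℤ.+ 0) (ℤ.- ℤ.+ 1)

-- The free space on the generators and its coordinates.

module FreeSpace (N : ℕ) .{{_ : NonZero N}} (w : ℕ) where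
  open Setup N w
  open Polynomials N w
  open Residues N w
  open Action N w

  fac : Fin (suc w) → ℚ
  fac i = ℕ→ℚ ((toℕ i) ! ℕ.* (w ℕ.∸ toℕ i) !)

  fac≢0 : ∀ i → fac i ≢ 0ℚ
  fac≢0 i = positive ((toℕ i) ! ℕ.* (w ℕ.∸ toℕ i) !) (ℕP.m*n≢0 _ _ {{ ℕP._!≢0 (toℕ i) }} {{ ℕP._!≢0 (w ℕ.∸ toℕ i) }})
    where
    positive : ∀ n → NonZero n → ℕ→ℚ n ≢ 0ℚ
    positive (suc n) _ = ℕ→ℚ-≢0 n

  1/fac : Fin (suc w) → ℚ
  1/fac i = ℚ.1/_ (fac i) {{ ℚ.≢-nonZero (fac≢0 i) }}

  fac*1/fac : ∀ i → fac i * 1/fac i ≡ 1ℚ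
  fac*1/fac i = ℚP.*-inverseʳ (fac i) {{ ℚ.≢-nonZero (fac≢0 i) }}

  fac-opposite : ∀ i → fac (Fin.opposite i) ≡ fac i
  fac-opposite i = cong ℕ→ℚ (trans
    (cong₂ (λ a b → a ! ℕ.* b !) (toℕ-opposite i) (toℕ-opposite′ i)) (ℕP.*-comm ((w ℕ.∸ toℕ i) !) ((toℕ i) !)))

  1/fac-cong : ∀ {i j} → fac i ≡ fac j → 1/fac i ≡ 1/fac j
  1/fac-cong {i} {j} e = begin
    1/fac i                        ≡⟨ ℚP.*-identityʳ (1/fac i) ⟨
    1/fac i * 1ℚ                   ≡⟨ cong (1/fac i *_) (fac*1/fac j) ⟨
    1/fac i * (fac j * 1/fac j)    ≡⟨ cong (λ t → 1/fac i * (t * 1/fac j)) e ⟨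
    1/fac i * (fac i * 1/fac j)    ≡⟨ solve 3 (λ a b c → a :* (b :* c) := b :* a :* c) refl (1/fac i) (fac i) (1/fac j) ⟩
    fac i * 1/fac i * 1/fac j      ≡⟨ cong (_* 1/fac j) (fac*1/fac i) ⟩
    1ℚ * 1/fac j                   ≡⟨ ℚP.*-identityˡ (1/fac j) ⟩
    1/fac j ∎
    where open ≡-Reasoning

  private
    T-∧ : ∀ {a b} → T (a ∧ b) → T a × T b
    T-∧ {true} t = tt , t
    ∧-T : ∀ {a b} → T a → T b → T (a ∧ b)
    ∧-T {true} _ t = t

  eqGen-sound : ∀ g h → T (eqGen g h) → g ≡ h
  eqGen-sound (Zg r s x y) (Zg r′ s′ x′ y′) t
    with T-∧ {r ℕ.≡ᵇ r′} t
  ... | t₁ , t with T-∧ {s ℕ.≡ᵇ s′} t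
  ... | t₂ , t with T-∧ {toℕ x ℕ.≡ᵇ toℕ x′} t
  ... | t₃ , t₄ with ℕP.≡ᵇ⇒≡ r r′ t₁ | ℕP.≡ᵇ⇒≡ s s′ t₂ | FinP.toℕ-injective {i = x} {x′} (ℕP.≡ᵇ⇒≡ _ _ t₃) | FinP.toℕ-injective {i = y} {y′} (ℕP.≡ᵇ⇒≡ _ _ t₄)
  ... | refl | refl | refl | refl = refl
  eqGen-sound (Pg r s x y) (Pg r′ s′ x′ y′) t
    with T-∧ {r ℕ.≡ᵇ r′} t
  ... | t₁ , t with T-∧ {s ℕ.≡ᵇ s′} t
  ... | t₂ , t with T-∧ {toℕ x ℕ.≡ᵇ toℕ x′} t
  ... | t₃ , t₄ with ℕP.≡ᵇ⇒≡ r r′ t₁ | ℕP.≡ᵇ⇒≡ s s′ t₂ | FinP.toℕ-injective {i = x} {x′} (ℕP.≡ᵇ⇒≡ _ _ t₃) | FinP.toℕ-injective {i = y} {y′} (ℕP.≡ᵇ⇒≡ _ _ t₄)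
  ... | refl | refl | refl | refl = refl
  eqGen-sound (Zk x) (Zk x′) t = cong Zk (FinP.toℕ-injective (ℕP.≡ᵇ⇒≡ _ _ t))

  eqGen-refl : ∀ g → T (eqGen g g)
  eqGen-refl (Zg r s x y) = ∧-T (ℕP.≡⇒≡ᵇ r r refl) (∧-T (ℕP.≡⇒≡ᵇ s s refl) (∧-T (ℕP.≡⇒≡ᵇ (toℕ x) _ refl) (ℕP.≡⇒≡ᵇ (toℕ y) _ refl)))
  eqGen-refl (Pg r s x y) = ∧-T (ℕP.≡⇒≡ᵇ r r refl) (∧-T (ℕP.≡⇒≡ᵇ s s refl) (∧-T (ℕP.≡⇒≡ᵇ (toℕ x) _ refl) (ℕP.≡⇒≡ᵇ (toℕ y) _ refl)))
  eqGen-refl (Zk x) = ℕP.≡⇒≡ᵇ (toℕ x) _ refl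

  private
    if-T : ∀ b → T b → (if b then 1ℚ else 0ℚ) ≡ 1ℚ
    if-T true _ = refl
    if-¬T : ∀ b → ¬ T b → (if b then 1ℚ else 0ℚ) ≡ 0ℚ
    if-¬T false _ = refl
    if-¬T true ¬t = contradiction tt ¬t

  gen-≡ : ∀ g → gen g g ≡ 1ℚ
  gen-≡ g = if-T (eqGen g g) (eqGen-refl g)

  gen-≢ : ∀ {g h} → g ≢ h → gen g h ≡ 0ℚ
  gen-≢ {g} {h} g≢h = if-¬T (eqGen g h) (λ t → g≢h (eqGen-sound g h t))

  gen-indicator : ∀ {A : Set} g h (d : Dec A) → (A → g ≡ h) → (g ≡ h → A) → gen g h ≡ indicator d
  gen-indicator g h (yes a) to from = trans (cong (gen g) (sym (to a))) (gen-≡ g)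
  gen-indicator g h (no ¬a) to from = gen-≢ (λ e → ¬a (from e))

  infix 4 _≟v_
  _≟v_ : (v v′ : Fin N × Fin N) → Dec (v ≡ v′)
  _≟v_ = ≡-dec FinP._≟_ FinP._≟_

  sumF-eval : {A : Set} (xs : List A) (t : A → F) (g : Gen) → sumF (map t xs) g ≡ ∑ xs (λ x → t x g)
  sumF-eval []       t g = refl
  sumF-eval (x ∷ xs) t g = cong (t x g +_) (sumF-eval xs t g)

  -- The factorials in λ are divided out, so that ρZ (lam P) = P ∘S on A(N).

  ρZ ρP : F → Map
  ρZ u x y m = u (Zg (suc (toℕ m)) (suc (w ℕ.∸ toℕ m)) x y) * 1/fac m
  ρP u x y m = u (Pg (suc (toℕ m)) (suc (w ℕ.∸ toℕ m)) x y) * 1/fac m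

  ρZ-cong : ∀ {u v} → u ≈F v → ∀ x y m → ρZ u x y m ≡ ρZ v x y m
  ρZ-cong u≈v x y m = cong (_* 1/fac m) (u≈v _)

  ρP-cong : ∀ {u v} → u ≈F v → ∀ x y m → ρP u x y m ≡ ρP v x y m
  ρP-cong u≈v x y m = cong (_* 1/fac m) (u≈v _)

  genZ genP genS : Fin N × Fin N → Fin (suc w) → F
  genZ (x , y) i = gen (Zg (suc (toℕ i)) (suc (w ℕ.∸ toℕ i)) x y)
  genP (x , y) i = gen (Pg (suc (toℕ i)) (suc (w ℕ.∸ toℕ i)) x y)
  genS (x , y) i = gen (Zk (x ⊕ y))

  -- The map supported at the single row v, with value X^i Y^(w-i) there. Up to `1/fac i` it is the
  -- coordinate of a generator with these indices.
  point : Fin N × Fin N → Fin (suc w) → Map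
  point v i x y m = indicator (v ≟v (x , y)) * monomial i m

  private
    indicator-× : {A B C : Set} (a : Dec A) (b : Dec B) (c : Dec C) → (A → B → C) → (C → A) → (C → B) →
                  indicator c ≡ indicator a * indicator b
    indicator-× (yes a) (yes b) c f g h = trans (indicator-yes c (f a b)) refl
    indicator-× (yes a) (no ¬b) c f g h = trans (indicator-no c (λ x → ¬b (h x))) refl
    indicator-× (no ¬a) b       c f g h = trans (indicator-no c (λ x → ¬a (g x))) (sym (ℚP.*-zeroˡ (indicator b)))

    /fac-indicator : ∀ {i m} (d : Dec (i ≡ m)) t → t * indicator d * 1/fac m ≡ 1/fac i * (t * indicator d)
    /fac-indicator {i} (yes refl) t = ℚP.*-comm (t * 1ℚ) (1/fac i)
    /fac-indicator {i} {m} (no _) t = trans (*-zeroˡ′ (1/fac m) (ℚP.*-zeroʳ t)) (sym (*-zeroʳ′ (1/fac i) (ℚP.*-zeroʳ t)))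

  module _ (G : ℕ → ℕ → Fin N → Fin N → Gen)
           (G-injective : ∀ {r s x y r′ s′ x′ y′} → G r s x y ≡ G r′ s′ x′ y′ → (r ≡ r′) × ((x , y) ≡ (x′ , y′))) where
    -- G stands for `Zg` or `Pg`. The second index is determined by the first, the weight being
    -- fixed, so injectivity in the first index and the row suffices.
    gen-point : ∀ v i x y m → gen (G (suc (toℕ i)) (suc (w ℕ.∸ toℕ i)) (proj₁ v) (proj₂ v)) (G (suc (toℕ m)) (suc (w ℕ.∸ toℕ m)) x y) * 1/fac m
                ≡ 1/fac i * point v i x y m
    gen-point v i x y m = trans (cong (_* 1/fac m) (trans (gen-indicator g h both to from)
      (indicator-× (v ≟v (x , y)) (i FinP.≟ m) both _,_ proj₁ proj₂)))
      (/fac-indicator (i FinP.≟ m) (indicator (v ≟v (x , y))))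
      where
      g = G (suc (toℕ i)) (suc (w ℕ.∸ toℕ i)) (proj₁ v) (proj₂ v)
      h = G (suc (toℕ m)) (suc (w ℕ.∸ toℕ m)) x y
      both : Dec ((v ≡ (x , y)) × (i ≡ m))
      both = (v ≟v (x , y)) ×-dec (i FinP.≟ m)
      to : (v ≡ (x , y)) × (i ≡ m) → g ≡ h
      to (refl , refl) = refl
      from : g ≡ h → (v ≡ (x , y)) × (i ≡ m)
      from e = proj₂ (G-injective e) , FinP.toℕ-injective (ℕP.suc-injective (proj₁ (G-injective e)))

  Zg-injective : ∀ {r s x y r′ s′ x′ y′} → Zg r s x y ≡ Zg r′ s′ x′ y′ → (r ≡ r′) × ((x , y) ≡ (x′ , y′))
  Zg-injective refl = refl , refl

  Pg-injective : ∀ {r s x y r′ s′ x′ y′} → Pg r s x y ≡ Pg r′ s′ x′ y′ → (r ≡ r′) × ((x , y) ≡ (x′ , y′))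
  Pg-injective refl = refl , refl

  ρZ-genZ : ∀ v i x y m → ρZ (genZ v i) x y m ≡ 1/fac i * point v i x y m
  ρZ-genZ = gen-point Zg Zg-injective

  ρP-genP : ∀ v i x y m → ρP (genP v i) x y m ≡ 1/fac i * point v i x y m
  ρP-genP = gen-point Pg Pg-injective

  -- A is the inverse of γᵗ, passed together with both identities: the row that γᵗ carries to v is
  -- vA, so the image is again supported at one row.
  point-‖ : ∀ γ A → transpose γ ⊗ A ≡ mat (ℤ.+ 1) (ℤ.+ 0) (ℤ.+ 0) (ℤ.+ 1) → A ⊗ transpose γ ≡ mat (ℤ.+ 1) (ℤ.+ 0) (ℤ.+ 0) (ℤ.+ 1) →
    ∀ v i x y m → (point v i ‖ γ) x y m ≡ indicator (v ⊙ A ≟v (x , y)) * actV γ (monomial i) m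
  point-‖ γ A left right v i x y m = trans (trans (‖-def (point v i) γ x y m)
    (actV-* γ (indicator (v ≟v (x , y) ⊙ transpose γ)) (monomial i) m))
    (cong (_* actV γ (monomial i) m) (indicator-⇔ (v ≟v (x , y) ⊙ transpose γ) (v ⊙ A ≟v (x , y)) to from))
    where
    to : v ≡ (x , y) ⊙ transpose γ → v ⊙ A ≡ (x , y)
    to refl = trans (⊙-⊗ (x , y) (transpose γ) A) (trans (cong ((x , y) ⊙_) left) (⊙-identity (x , y)))
    from : v ⊙ A ≡ (x , y) → v ≡ (x , y) ⊙ transpose γ
    from e = trans (sym (trans (⊙-⊗ v A (transpose γ)) (trans (cong (v ⊙_) right) (⊙-identity v))))
                   (cong (_⊙ transpose γ) e)

  point-‖δ : ∀ x y i x′ y′ m → (point (x , y) i ‖ δM) x′ y′ m ≡ point (y , x) (Fin.opposite i) x′ y′ m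
  point-‖δ x y i x′ y′ m = trans (point-‖ δM δM refl refl (x , y) i x′ y′ m)
    (cong₂ (λ u t → indicator (u ≟v (x′ , y′)) * t) swap (actV-δ i m))
    where
    swap : (x , y) ⊙ δM ≡ (y , x)
    swap = cong₂ _,_ (trans (cong red (first (toZ x) (toZ y))) (red-toZ y)) (trans (cong red (second (toZ x) (toZ y))) (red-toZ x))
      where
      first : ∀ x y → x ℤ.* ℤ.+ 0 ℤ.+ y ℤ.* ℤ.+ 1 ≡ y
      first = IntSolver.solve-∀
      second : ∀ x y → x ℤ.* ℤ.+ 1 ℤ.+ y ℤ.* ℤ.+ 0 ≡ x
      second = IntSolver.solve-∀

  -- The matrix is the inverse of Tᵗ. This is the origin of the index (a-b, b) in the relations.
  shear : ∀ {x y} → (x , y) ⊙ mat (ℤ.+ 1) (ℤ.+ 0) (ℤ.- ℤ.+ 1) (ℤ.+ 1) ≡ (x ⊖ y , y)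
  shear {x} {y} = cong₂ _,_ (cong red (first (toZ x) (toZ y))) (trans (cong red (second (toZ x) (toZ y))) (red-toZ y))
    where
    first : ∀ x y → x ℤ.* ℤ.+ 1 ℤ.+ y ℤ.* (ℤ.- ℤ.+ 1) ≡ x ℤ.- y
    first = IntSolver.solve-∀
    second : ∀ x y → x ℤ.* ℤ.+ 0 ℤ.+ y ℤ.* ℤ.+ 1 ≡ y
    second = IntSolver.solve-∀

  point-‖T : ∀ x y i x′ y′ m → (point (x , y) i ‖ TM) x′ y′ m ≡ indicator ((x ⊖ y , y) ≟v (x′ , y′)) * ℕ→ℚ (toℕ i C toℕ m)
  point-‖T x y i x′ y′ m = trans (point-‖ TM (mat (ℤ.+ 1) (ℤ.+ 0) (ℤ.- ℤ.+ 1) (ℤ.+ 1)) refl refl (x , y) i x′ y′ m)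
    (cong₂ (λ u t → indicator (u ≟v (x′ , y′)) * t) (shear {x} {y}) (actV-T i m))

-- The relations and the even vectors in coordinates.

module Relations (N : ℕ) .{{_ : NonZero N}} (w : ℕ) where
  open Setup N w
  open Polynomials N w
  open Residues N w
  open Action N w
  open FreeSpace N w

  -- One half of `Pexpr₁`; the other half is the same sum with r, s and x, y exchanged.
  zSum : ℕ → ℕ → Fin N → Fin N → F
  zSum r s x y = sumF (map (λ j → ℕ→ℚ ((s ℕ.∸ 1 ℕ.+ j) C j) • gen (Zg (r ℕ.∸ j) (s ℕ.+ j) (x ⊖ y) y)) (upTo r))

  private
    /fac-move : ∀ a c i m → a * fac i ≡ c * fac m → a * 1/fac m ≡ 1/fac i * c
    /fac-move a c i m e = begin
      a * 1/fac m                        ≡⟨ cong (_* 1/fac m) (ℚP.*-identityʳ a) ⟨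
      a * 1ℚ * 1/fac m                   ≡⟨ cong (λ t → a * t * 1/fac m) (fac*1/fac i) ⟨
      a * (fac i * 1/fac i) * 1/fac m    ≡⟨ solve 4 (λ a b c d → a :* (b :* c) :* d := a :* b :* c :* d) refl a (fac i) (1/fac i) (1/fac m) ⟩
      a * fac i * 1/fac i * 1/fac m      ≡⟨ cong (λ t → t * 1/fac i * 1/fac m) e ⟩
      c * fac m * 1/fac i * 1/fac m      ≡⟨ solve 4 (λ c b d e → c :* b :* d :* e := b :* e :* (d :* c)) refl c (fac m) (1/fac i) (1/fac m) ⟩
      fac m * 1/fac m * (1/fac i * c)    ≡⟨ cong (_* (1/fac i * c)) (fac*1/fac m) ⟩
      1ℚ * (1/fac i * c)                 ≡⟨ ℚP.*-identityˡ (1/fac i * c) ⟩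
      1/fac i * c                        ∎
      where open ≡-Reasoning

  -- Only the term j = r - m has first index m + 1. Its coefficient C(s+j, j), rescaled by the
  -- factorials of the coordinates, becomes C(r, m) by `C-factorials`, which is the coefficient in
  -- (X+Y)^r Y^s.
  ρZ-zSum : ∀ x y i x′ y′ m →
    ρZ (zSum (suc (toℕ i)) (suc (w ℕ.∸ toℕ i)) x y) x′ y′ m ≡ 1/fac i * (point (x , y) i ‖ TM) x′ y′ m
  ρZ-zSum x y i x′ y′ m = begin
    zSum (suc r) (suc s) x y h * 1/fac m
      ≡⟨ cong (_* 1/fac m) (sumF-eval (upTo (suc r)) (λ j → ℕ→ℚ (c j) • gen (g j)) h) ⟩
    ∑ (upTo (suc r)) (λ j → ℕ→ℚ (c j) * gen (g j) h) * 1/fac m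
      ≡⟨ main (toℕ m ℕP.≤? r) ⟩
    1/fac i * (δ * ℕ→ℚ (r C toℕ m))
      ≡⟨ cong (1/fac i *_) (point-‖T x y i x′ y′ m) ⟨
    1/fac i * (point (x , y) i ‖ TM) x′ y′ m ∎
    where
    open ≡-Reasoning
    r = toℕ i
    s = w ℕ.∸ toℕ i
    h = Zg (suc (toℕ m)) (suc (w ℕ.∸ toℕ m)) x′ y′
    c : ℕ → ℕ
    c j = (s ℕ.+ j) C j
    g : ℕ → Gen
    g j = Zg (suc r ℕ.∸ j) (suc s ℕ.+ j) (x ⊖ y) y
    δ = indicator ((x ⊖ y , y) ≟v (x′ , y′))
    first-index : ∀ j → j ℕ.< suc r → g j ≡ h → r ℕ.∸ j ≡ toℕ m
    first-index j (ℕ.s≤s j≤r) e = ℕP.suc-injective (trans (sym (ℕP.+-∸-assoc 1 j≤r)) (proj₁ (Zg-injective e)))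
    main : Dec (toℕ m ℕ.≤ r) →
      ∑ (upTo (suc r)) (λ j → ℕ→ℚ (c j) * gen (g j) h) * 1/fac m ≡ 1/fac i * (δ * ℕ→ℚ (r C toℕ m))
    main (no m≰r) = trans
      (*-zeroˡ′ (1/fac m) (∑-upTo-zero (suc r) (λ j j<1+r → *-zeroʳ′ (ℕ→ℚ (c j)) (gen-≢ (λ e →
        m≰r (subst (ℕ._≤ r) (first-index j j<1+r e) (ℕP.m∸n≤m r j)))))))
      (sym (*-zeroʳ′ (1/fac i) (*-zeroʳ′ δ (cong ℕ→ℚ (k>n⇒nCk≡0 (ℕP.≰⇒> m≰r))))))
    main (yes m≤r) = begin
      ∑ (upTo (suc r)) (λ j → ℕ→ℚ (c j) * gen (g j) h) * 1/fac m
        ≡⟨ cong (_* 1/fac m) (∑-upTo-single q (ℕ.s≤s (ℕP.m∸n≤m r (toℕ m))) (λ j j<1+r j≢q →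
             *-zeroʳ′ (ℕ→ℚ (c j)) (gen-≢ (λ e → j≢q (trans (sym (ℕP.m∸[m∸n]≡n (ℕP.≤-pred j<1+r))) (cong (r ℕ.∸_) (first-index j j<1+r e))))))) ⟩
      ℕ→ℚ (c q) * gen (g q) h * 1/fac m
        ≡⟨ cong (λ t → ℕ→ℚ (c q) * t * 1/fac m) (gen-indicator (g q) h ((x ⊖ y , y) ≟v (x′ , y′)) to (λ e → proj₂ (Zg-injective e))) ⟩
      ℕ→ℚ (c q) * δ * 1/fac m
        ≡⟨ solve 3 (λ a d f → a :* d :* f := d :* (a :* f)) refl (ℕ→ℚ (c q)) δ (1/fac m) ⟩
      δ * (ℕ→ℚ (c q) * 1/fac m)
        ≡⟨ cong (δ *_) (/fac-move (ℕ→ℚ (c q)) (ℕ→ℚ (r C toℕ m)) i m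
             (trans (sym (ℕ→ℚ-* (c q) _)) (trans (cong ℕ→ℚ (C-factorials (toℕ≤w i) m≤r)) (ℕ→ℚ-* (r C toℕ m) _)))) ⟩
      δ * (1/fac i * ℕ→ℚ (r C toℕ m))
        ≡⟨ solve 3 (λ d f a → d :* (f :* a) := f :* (d :* a)) refl δ (1/fac i) (ℕ→ℚ (r C toℕ m)) ⟩
      1/fac i * (δ * ℕ→ℚ (r C toℕ m)) ∎
      where
      q = r ℕ.∸ toℕ m
      to : (x ⊖ y , y) ≡ (x′ , y′) → g q ≡ h
      to refl = cong₂ (λ a b → Zg a b (x ⊖ y) y)
        (trans (ℕP.+-∸-assoc 1 (ℕP.m∸n≤m r (toℕ m))) (cong suc (ℕP.m∸[m∸n]≡n m≤r)))
        (cong suc (trans (sym (ℕP.+-∸-assoc s m≤r)) (cong (ℕ._∸ toℕ m) (ℕP.m∸n+n≡m (toℕ≤w i)))))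

  1/fac-opposite : ∀ i → 1/fac (Fin.opposite i) ≡ 1/fac i
  1/fac-opposite i = 1/fac-cong {Fin.opposite i} {i} (fac-opposite i)

  ρZ-zSum-swap : ∀ x y i x′ y′ m →
    ρZ (zSum (suc (w ℕ.∸ toℕ i)) (suc (toℕ i)) y x) x′ y′ m ≡ 1/fac i * (point (x , y) i ‖ δM ‖ TM) x′ y′ m
  ρZ-zSum-swap x y i x′ y′ m = begin
    ρZ (zSum (suc (w ℕ.∸ toℕ i)) (suc (toℕ i)) y x) x′ y′ m
      ≡⟨ cong₂ (λ a b → ρZ (zSum (suc a) (suc b) y x) x′ y′ m) (toℕ-opposite i) (toℕ-opposite′ i) ⟨
    ρZ (zSum (suc (toℕ (Fin.opposite i))) (suc (w ℕ.∸ toℕ (Fin.opposite i))) y x) x′ y′ m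
      ≡⟨ ρZ-zSum y x (Fin.opposite i) x′ y′ m ⟩
    1/fac (Fin.opposite i) * (point (y , x) (Fin.opposite i) ‖ TM) x′ y′ m
      ≡⟨ cong₂ _*_ (1/fac-opposite i)
           (‖-ext TM (λ x′ y′ m → sym (point-‖δ x y i x′ y′ m)) x′ y′ m) ⟩
    1/fac i * (point (x , y) i ‖ δM ‖ TM) x′ y′ m ∎
    where open ≡-Reasoning

  ρZ-genZ-swap : ∀ x y i x′ y′ m →
    ρZ (gen (Zg (suc (w ℕ.∸ toℕ i)) (suc (toℕ i)) y x)) x′ y′ m ≡ 1/fac i * (point (x , y) i ‖ δM) x′ y′ m
  ρZ-genZ-swap x y i x′ y′ m = begin
    ρZ (gen (Zg (suc (w ℕ.∸ toℕ i)) (suc (toℕ i)) y x)) x′ y′ m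
      ≡⟨ cong₂ (λ a b → ρZ (gen (Zg (suc a) (suc b) y x)) x′ y′ m) (toℕ-opposite i) (toℕ-opposite′ i) ⟨
    ρZ (genZ (y , x) (Fin.opposite i)) x′ y′ m
      ≡⟨ ρZ-genZ (y , x) (Fin.opposite i) x′ y′ m ⟩
    1/fac (Fin.opposite i) * point (y , x) (Fin.opposite i) x′ y′ m
      ≡⟨ cong₂ _*_ (1/fac-opposite i) (sym (point-‖δ x y i x′ y′ m)) ⟩
    1/fac i * (point (x , y) i ‖ δM) x′ y′ m ∎
    where open ≡-Reasoning

  ‖-scaled : ∀ q f {g : Map} → (∀ x y m → g x y m ≡ q * f x y m) → ∀ γ x y m → (g ‖ γ) x y m ≡ q * (f ‖ γ) x y m
  ‖-scaled q f {g} h γ x y m = trans (‖-ext γ h x y m) (‖-* q f γ x y m)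

  ρP-genP-‖ : ∀ γ v i x y m → (ρP (genP v i) ‖ γ) x y m ≡ 1/fac i * (point v i ‖ γ) x y m
  ρP-genP-‖ γ v i = ‖-scaled (1/fac i) (point v i) (ρP-genP v i) γ

  ρP-genP-‖‖ : ∀ γ γ′ v i x y m → (ρP (genP v i) ‖ γ ‖ γ′) x y m ≡ 1/fac i * (point v i ‖ γ ‖ γ′) x y m
  ρP-genP-‖‖ γ γ′ v i = ‖-scaled (1/fac i) (point v i ‖ γ) (ρP-genP-‖ γ v i) γ′

  relation : Bool → Fin N × Fin N → Fin (suc w) → F
  relation b (x , y) i = relVec (b , suc (toℕ i) , suc (w ℕ.∸ toℕ i) , x , y)

  evenP : Fin N × Fin N → Fin (suc w) → F
  evenP (x , y) i = pevVec (pIdx (suc (toℕ i) , suc (w ℕ.∸ toℕ i) , x , y))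

  -- If f is the coordinate at the generators P, these are the Z-coordinates of the two expressions
  -- for them: f|(1+δ)T from `Pexpr₁` and f|(1+δ) from `Pexpr₂`.
  Z₁ Z₂ : Map → Map
  Z₁ f x y m = (f ‖ TM) x y m + (f ‖ δM ‖ TM) x y m
  Z₂ f x y m = f x y m + (f ‖ δM) x y m

  ρZ-relation₁ : ∀ v i x y m → ρZ (relation false v i) x y m ≡ - Z₁ (ρP (genP v i)) x y m
  ρZ-relation₁ (a , b) i x y m = begin
    (gen p h - (A h + B h)) * 1/fac m
      ≡⟨ cong (λ t → (t - (A h + B h)) * 1/fac m) (gen-≢ {p} {h} λ ()) ⟩
    (0ℚ - (A h + B h)) * 1/fac m
      ≡⟨ solve 3 (λ a b f → (con 0ℚ :- (a :+ b)) :* f := :- (a :* f :+ b :* f)) refl (A h) (B h) (1/fac m) ⟩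
    - (ρZ A x y m + ρZ B x y m)
      ≡⟨ cong₂ (λ s t → - (s + t))
           (trans (ρZ-zSum a b i x y m) (sym (ρP-genP-‖ TM (a , b) i x y m)))
           (trans (ρZ-zSum-swap a b i x y m) (sym (ρP-genP-‖‖ δM TM (a , b) i x y m))) ⟩
    - Z₁ (ρP (genP (a , b) i)) x y m ∎
    where
    open ≡-Reasoning
    h = Zg (suc (toℕ m)) (suc (w ℕ.∸ toℕ m)) x y
    p = Pg (suc (toℕ i)) (suc (w ℕ.∸ toℕ i)) a b
    A = zSum (suc (toℕ i)) (suc (w ℕ.∸ toℕ i)) a b
    B = zSum (suc (w ℕ.∸ toℕ i)) (suc (toℕ i)) b a

  ρZ-relation₂ : ∀ v i x y m → ρZ (relation true v i) x y m ≡ - Z₂ (ρP (genP v i)) x y m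
  ρZ-relation₂ (a , b) i x y m = begin
    (gen p h - (gen z h + gen z′ h + gen (Zk (a ⊕ b)) h)) * 1/fac m
      ≡⟨ cong₂ (λ t t′ → (t - (gen z h + gen z′ h + t′)) * 1/fac m) (gen-≢ {p} {h} λ ()) (gen-≢ {Zk (a ⊕ b)} {h} λ ()) ⟩
    (0ℚ - (gen z h + gen z′ h + 0ℚ)) * 1/fac m
      ≡⟨ solve 3 (λ a b f → (con 0ℚ :- (a :+ b :+ con 0ℚ)) :* f := :- (a :* f :+ b :* f)) refl (gen z h) (gen z′ h) (1/fac m) ⟩
    - (ρZ (gen z) x y m + ρZ (gen z′) x y m)
      ≡⟨ cong₂ (λ s t → - (s + t))
           (trans (ρZ-genZ (a , b) i x y m) (sym (ρP-genP (a , b) i x y m)))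
           (trans (ρZ-genZ-swap a b i x y m) (sym (ρP-genP-‖ δM (a , b) i x y m))) ⟩
    - Z₂ (ρP (genP (a , b) i)) x y m ∎
    where
    open ≡-Reasoning
    h = Zg (suc (toℕ m)) (suc (w ℕ.∸ toℕ m)) x y
    p = Pg (suc (toℕ i)) (suc (w ℕ.∸ toℕ i)) a b
    z = Zg (suc (toℕ i)) (suc (w ℕ.∸ toℕ i)) a b
    z′ = Zg (suc (w ℕ.∸ toℕ i)) (suc (toℕ i)) b a

  zSum-avoids : ∀ r s x y g → (∀ r′ s′ x′ y′ → Zg r′ s′ x′ y′ ≢ g) → zSum r s x y g ≡ 0ℚ
  zSum-avoids r s x y g g≢ = trans (sumF-eval (upTo r) (λ j → ℕ→ℚ ((s ℕ.∸ 1 ℕ.+ j) C j) • gen (Zg (r ℕ.∸ j) (s ℕ.+ j) (x ⊖ y) y)) g)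
    (∑-zero (upTo r) (λ j → *-zeroʳ′ (ℕ→ℚ ((s ℕ.∸ 1 ℕ.+ j) C j)) (gen-≢ (g≢ (r ℕ.∸ j) (s ℕ.+ j) (x ⊖ y) y))))

  ρP-relation : ∀ b v i x y m → ρP (relation b v i) x y m ≡ ρP (genP v i) x y m
  ρP-relation false (x , y) i x′ y′ m = cong (_* 1/fac m) (begin
    gen p h - (A h + B h)  ≡⟨ cong₂ (λ s t → gen p h - (s + t)) (zSum-avoids (suc (toℕ i)) (suc (w ℕ.∸ toℕ i)) x y h λ _ _ _ _ → λ ())
                                 (zSum-avoids (suc (w ℕ.∸ toℕ i)) (suc (toℕ i)) y x h λ _ _ _ _ → λ ()) ⟩
    gen p h - (0ℚ + 0ℚ)    ≡⟨ solve 1 (λ a → a :- (con 0ℚ :+ con 0ℚ) := a) refl (gen p h) ⟩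
    gen p h                ∎)
    where
    open ≡-Reasoning
    h = Pg (suc (toℕ m)) (suc (w ℕ.∸ toℕ m)) x′ y′
    p = Pg (suc (toℕ i)) (suc (w ℕ.∸ toℕ i)) x y
    A = zSum (suc (toℕ i)) (suc (w ℕ.∸ toℕ i)) x y
    B = zSum (suc (w ℕ.∸ toℕ i)) (suc (toℕ i)) y x
  ρP-relation true (x , y) i x′ y′ m = cong (_* 1/fac m) (begin
    gen p h - (gen z h + gen z′ h + gen (Zk (x ⊕ y)) h)
      ≡⟨ cong₂ (λ s t → gen p h - (s + t)) (cong₂ _+_ (gen-≢ {z} {h} λ ()) (gen-≢ {z′} {h} λ ())) (gen-≢ {Zk (x ⊕ y)} {h} λ ()) ⟩
    gen p h - (0ℚ + 0ℚ + 0ℚ)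
      ≡⟨ solve 1 (λ a → a :- (con 0ℚ :+ con 0ℚ :+ con 0ℚ) := a) refl (gen p h) ⟩
    gen p h ∎)
    where
    open ≡-Reasoning
    h = Pg (suc (toℕ m)) (suc (w ℕ.∸ toℕ m)) x′ y′
    p = Pg (suc (toℕ i)) (suc (w ℕ.∸ toℕ i)) x y
    z = Zg (suc (toℕ i)) (suc (w ℕ.∸ toℕ i)) x y
    z′ = Zg (suc (w ℕ.∸ toℕ i)) (suc (toℕ i)) y x

  relation₁-Zk : ∀ v i c → relation false v i (Zk c) ≡ 0ℚ
  relation₁-Zk (x , y) i c = trans
    (cong₂ (λ s t → s - t) (gen-≢ {Pg (suc (toℕ i)) (suc (w ℕ.∸ toℕ i)) x y} {Zk c} λ ())
      (cong₂ _+_ (zSum-avoids (suc (toℕ i)) (suc (w ℕ.∸ toℕ i)) x y (Zk c) λ _ _ _ _ → λ ())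
                 (zSum-avoids (suc (w ℕ.∸ toℕ i)) (suc (toℕ i)) y x (Zk c) λ _ _ _ _ → λ ())))
    refl

  relation₂-Zk : ∀ v i c → relation true v i (Zk c) ≡ - genS v i (Zk c)
  relation₂-Zk (x , y) i c = trans
    (cong₂ (λ s t → s - (t + genS (x , y) i (Zk c))) (gen-≢ {Pg (suc (toℕ i)) (suc (w ℕ.∸ toℕ i)) x y} {Zk c} λ ())
      (cong₂ _+_ (gen-≢ {Zg (suc (toℕ i)) (suc (w ℕ.∸ toℕ i)) x y} {Zk c} λ ())
                 (gen-≢ {Zg (suc (w ℕ.∸ toℕ i)) (suc (toℕ i)) y x} {Zk c} λ ())))
    (solve 1 (λ a → con 0ℚ :- (con 0ℚ :+ con 0ℚ :+ a) := :- a) refl (genS (x , y) i (Zk c)))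

  -- f|(1-ε)(1+J), expanded.
  even : Map → Map
  even f x y m = f x y m - (f ‖ εM) x y m - (f ‖ ε′M) x y m + (f ‖ JM) x y m

  sign-+ : ∀ m n → sign (m ℕ.+ n) ≡ sign m * sign n
  sign-+ zero    n = sym (ℚP.*-identityˡ (sign n))
  sign-+ (suc m) n = trans (cong -_ (sign-+ m n)) (ℚP.neg-distribˡ-* (sign m) (sign n))

  -1^≡sign : ∀ n → ℤ→ℚ (ℤ.- ℤ.+ 1) ^ n ≡ sign n
  -1^≡sign zero = refl
  -1^≡sign (suc n) = trans (cong (ℤ→ℚ (ℤ.- ℤ.+ 1) *_) (-1^≡sign n))
    (solve 1 (λ a → con (- 1ℚ) :* a := :- a) refl (sign n))

  private
    scale-right : ∀ v v′ x y i m t → v ≡ v′ → indicator (v ≟v (x , y)) * (t * monomial i m) ≡ t * point v′ i x y m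
    scale-right v .v x y i m t refl = solve 3 (λ a t b → a :* (t :* b) := t :* (a :* b)) refl (indicator (v ≟v (x , y))) t (monomial i m)

    ⊙-diagonal : ∀ α β x y a b → toZ x ℤ.* α ≡ a → toZ y ℤ.* β ≡ b → (x , y) ⊙ mat α (ℤ.+ 0) (ℤ.+ 0) β ≡ (red a , red b)
    ⊙-diagonal α β x y a b refl refl = cong₂ _,_ (cong red (first (toZ x ℤ.* α) (toZ y))) (cong red (second (toZ x) (toZ y ℤ.* β)))
      where
      first : ∀ x y → x ℤ.+ y ℤ.* ℤ.+ 0 ≡ x
      first = IntSolver.solve-∀
      second : ∀ x y → x ℤ.* ℤ.+ 0 ℤ.+ y ≡ y
      second = IntSolver.solve-∀

    *-1 : ∀ x → x ℤ.* (ℤ.- ℤ.+ 1) ≡ ℤ.- x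
    *-1 = IntSolver.solve-∀

  ⊙ε : ∀ x y → (x , y) ⊙ εM ≡ (⊝ x , y)
  ⊙ε x y = trans (⊙-diagonal (ℤ.- ℤ.+ 1) (ℤ.+ 1) x y _ _ (*-1 (toZ x)) (ℤP.*-identityʳ (toZ y))) (cong (⊝ x ,_) (red-toZ y))

  ⊙J : ∀ x y → (x , y) ⊙ JM ≡ (⊝ x , ⊝ y)
  ⊙J x y = ⊙-diagonal (ℤ.- ℤ.+ 1) (ℤ.- ℤ.+ 1) x y _ _ (*-1 (toZ x)) (*-1 (toZ y))

  point-‖ε : ∀ a b i x y m → (point (a , b) i ‖ εM) x y m ≡ sign (toℕ i) * point (⊝ a , b) i x y m
  point-‖ε a b i x y m = trans (point-‖ εM εM refl refl (a , b) i x y m)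
    (trans (cong (indicator ((a , b) ⊙ εM ≟v (x , y)) *_) (trans (actV-diagonal (ℤ.- ℤ.+ 1) (ℤ.+ 1) i m)
      (cong (_* monomial i m) (trans (cong₂ _*_ (-1^≡sign (toℕ i)) (1^n≡1 (w ℕ.∸ toℕ i))) (ℚP.*-identityʳ (sign (toℕ i)))))))
    (scale-right ((a , b) ⊙ εM) (⊝ a , b) x y i m (sign (toℕ i))
      (⊙ε a b)))

  point-‖ε′ : ∀ a b i x y m → (point (a , b) i ‖ ε′M) x y m ≡ sign (w ℕ.∸ toℕ i) * point (a , ⊝ b) i x y m
  point-‖ε′ a b i x y m = trans (point-‖ ε′M ε′M refl refl (a , b) i x y m)
    (trans (cong (indicator ((a , b) ⊙ ε′M ≟v (x , y)) *_) (trans (actV-diagonal (ℤ.+ 1) (ℤ.- ℤ.+ 1) i m)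
      (cong (_* monomial i m) (trans (cong₂ _*_ (1^n≡1 (toℕ i)) (-1^≡sign (w ℕ.∸ toℕ i))) (ℚP.*-identityˡ (sign (w ℕ.∸ toℕ i)))))))
    (scale-right ((a , b) ⊙ ε′M) (a , ⊝ b) x y i m (sign (w ℕ.∸ toℕ i))
      (trans (⊙-diagonal (ℤ.+ 1) (ℤ.- ℤ.+ 1) a b _ _ (ℤP.*-identityʳ (toZ a)) (*-1 (toZ b))) (cong (_, ⊝ b) (red-toZ a)))))

  point-‖J : ∀ a b i x y m → (point (a , b) i ‖ JM) x y m ≡ sign (toℕ i) * sign (w ℕ.∸ toℕ i) * point (⊝ a , ⊝ b) i x y m
  point-‖J a b i x y m = trans (point-‖ JM JM refl refl (a , b) i x y m)
    (trans (cong (indicator ((a , b) ⊙ JM ≟v (x , y)) *_) (trans (actV-diagonal (ℤ.- ℤ.+ 1) (ℤ.- ℤ.+ 1) i m)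
      (cong (_* monomial i m) (cong₂ _*_ (-1^≡sign (toℕ i)) (-1^≡sign (w ℕ.∸ toℕ i))))))
    (scale-right ((a , b) ⊙ JM) (⊝ a , ⊝ b) x y i m (sign (toℕ i) * sign (w ℕ.∸ toℕ i))
      (⊙J a b)))

  -- The signs of the even vectors use the indices r and s, one more than the degrees in X and Y.
  -- This shift produces the minus signs at ε and ε′ in `even`.
  ρP-evenP : ∀ v i x y m → ρP (evenP v i) x y m ≡ even (ρP (genP v i)) x y m
  ρP-evenP (a , b) i x y m = begin
    (p a b + sign (suc r) * p (⊝ a) b + sign (suc s) * p a (⊝ b) + sign (suc r ℕ.+ suc s) * p (⊝ a) (⊝ b)) * 1/fac m
      ≡⟨ cong (λ t → (p a b + sign (suc r) * p (⊝ a) b + sign (suc s) * p a (⊝ b) + t * p (⊝ a) (⊝ b)) * 1/fac m) (sign-+ (suc r) (suc s)) ⟩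
    (p a b + (- sign r) * p (⊝ a) b + (- sign s) * p a (⊝ b) + (- sign r) * (- sign s) * p (⊝ a) (⊝ b)) * 1/fac m
      ≡⟨ solve 7 (λ p₁ p₂ p₃ p₄ r s f → (p₁ :+ (:- r) :* p₂ :+ (:- s) :* p₃ :+ (:- r) :* (:- s) :* p₄) :* f
                 := p₁ :* f :- r :* (p₂ :* f) :- s :* (p₃ :* f) :+ r :* s :* (p₄ :* f)) refl
           (p a b) (p (⊝ a) b) (p a (⊝ b)) (p (⊝ a) (⊝ b)) (sign r) (sign s) (1/fac m) ⟩
    ρ a b - sign r * ρ (⊝ a) b - sign s * ρ a (⊝ b) + sign r * sign s * ρ (⊝ a) (⊝ b)
      ≡⟨ cong₂ (λ t t′ → ρ a b - t - sign s * ρ a (⊝ b) + t′)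
           (transfer (⊝ a) b (sign r) εM (point-‖ε a b i x y m))
           (transfer (⊝ a) (⊝ b) (sign r * sign s) JM (point-‖J a b i x y m)) ⟩
    ρ a b - (e ‖ εM) x y m - sign s * ρ a (⊝ b) + (e ‖ JM) x y m
      ≡⟨ cong (λ t → ρ a b - (e ‖ εM) x y m - t + (e ‖ JM) x y m)
           (transfer a (⊝ b) (sign s) ε′M (point-‖ε′ a b i x y m)) ⟩
    even e x y m ∎
    where
    open ≡-Reasoning
    r = toℕ i
    s = w ℕ.∸ toℕ i
    e = ρP (genP (a , b) i)
    p ρ : Fin N → Fin N → ℚ
    p a b = genP (a , b) i (Pg (suc (toℕ m)) (suc (w ℕ.∸ toℕ m)) x y)
    ρ a b = ρP (genP (a , b) i) x y m
    transfer : ∀ a′ b′ t γ → (point (a , b) i ‖ γ) x y m ≡ t * point (a′ , b′) i x y m → t * ρ a′ b′ ≡ (e ‖ γ) x y m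
    transfer a′ b′ t γ h = begin
      t * ρ a′ b′                               ≡⟨ cong (t *_) (ρP-genP (a′ , b′) i x y m) ⟩
      t * (1/fac i * point (a′ , b′) i x y m)   ≡⟨ solve 3 (λ t f p → t :* (f :* p) := f :* (t :* p)) refl t (1/fac i) (point (a′ , b′) i x y m) ⟩
      1/fac i * (t * point (a′ , b′) i x y m)   ≡⟨ cong (1/fac i *_) h ⟨
      1/fac i * (point (a , b) i ‖ γ) x y m     ≡⟨ ρP-genP-‖ γ (a , b) i x y m ⟨
      (e ‖ γ) x y m ∎

-- Linear relations, sums over A(N), supports and spans.

module Spans (N : ℕ) .{{_ : NonZero N}} (w : ℕ) where
  open Setup N w
  open Polynomials N w
  open Residues N w
  open Action N w
  open FreeSpace N w
  open Relations N w

  -- A subspace of F × F. A predicate is the case where the second argument is ignored, so one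
  -- induction over sums serves for supports, for membership in spans and for the comparison of
  -- functionals.
  record LinearRelation (R : F → F → Set) : Set where
    field
      zero-R  : R 0F 0F
      plus-R  : ∀ {u u′ v v′} → R u u′ → R v v′ → R (u +F v) (u′ +F v′)
      scale-R : ∀ q {u u′} → R u u′ → R (q • u) (q • u′)

  open LinearRelation

  sumF-relation : ∀ {R} → LinearRelation R → {A : Set} (xs : List A) {t t′ : A → F} →
    (∀ x → R (t x) (t′ x)) → R (sumF (map t xs)) (sumF (map t′ xs))
  sumF-relation lin []       h = zero-R lin
  sumF-relation lin (x ∷ xs) h = plus-R lin (h x) (sumF-relation lin xs h)

  -- The common shape of all sums over cosets: by computation `lam R` is `bigSum genZ (R ∘S)` and
  -- `lamS R` is `bigSum genS (R ∘S)`. Sums of relation vectors and of even vectors take the same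
  -- form.
  bigSum : (Fin N × Fin N → Fin (suc w) → F) → Map → F
  bigSum B f = sumF (map (λ v → if isAᵇ (proj₁ v) (proj₂ v)
                                then sumF (map (λ i → (at f v i * fac i) • B v i) (allFin (suc w)))
                                else 0F) pairs)

  private
    if-relation : ∀ {R} → LinearRelation R → ∀ b {u u′} → (T b → R u u′) → R (if b then u else 0F) (if b then u′ else 0F)
    if-relation lin true  h = h tt
    if-relation lin false h = zero-R lin

  isAᵇ-sound : ∀ v → T (isAᵇ (proj₁ v) (proj₂ v)) → InA v
  isAᵇ-sound v t = ℕP.≡ᵇ⇒≡ _ 1 t

  isAᵇ-complete : ∀ v → InA v → T (isAᵇ (proj₁ v) (proj₂ v))
  isAᵇ-complete v isA = ℕP.≡⇒≡ᵇ _ 1 isA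

  bigSum-relation : ∀ {R} → LinearRelation R → ∀ {B B′} f → (∀ v i → InA v → R (B v i) (B′ v i)) →
    R (bigSum B f) (bigSum B′ f)
  bigSum-relation lin f h = sumF-relation lin pairs (λ v → if-relation lin (isAᵇ (proj₁ v) (proj₂ v)) (λ t →
    sumF-relation lin (allFin (suc w)) (λ i → scale-R lin (at f v i * fac i) (h v i (isAᵇ-sound v t)))))

  record Linear (ℓ : F → ℚ) : Set where
    field
      zero-ℓ  : ℓ 0F ≡ 0ℚ
      plus-ℓ  : ∀ u v → ℓ (u +F v) ≡ ℓ u + ℓ v
      scale-ℓ : ∀ q u → ℓ (q • u) ≡ q * ℓ u

  open Linear

  equal-functionals : ∀ {ℓ ℓ′} → Linear ℓ → Linear ℓ′ → LinearRelation (λ u u′ → ℓ u ≡ ℓ′ u′)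
  equal-functionals lin lin′ = record
    { zero-R  = trans (zero-ℓ lin) (sym (zero-ℓ lin′))
    ; plus-R  = λ {u} {u′} {v} {v′} e e′ → trans (plus-ℓ lin u v) (trans (cong₂ _+_ e e′) (sym (plus-ℓ lin′ u′ v′)))
    ; scale-R = λ q {u} {u′} e → trans (scale-ℓ lin q u) (trans (cong (q *_) e) (sym (scale-ℓ lin′ q u′)))
    }

  LinearMap : (F → Map) → Set
  LinearMap L = ∀ x y m → Linear (λ u → L u x y m)

  coefficient-linear : ∀ g → Linear (λ u → u g)
  coefficient-linear g = record { zero-ℓ = refl ; plus-ℓ = λ u v → refl ; scale-ℓ = λ q u → refl }

  zero-linear : Linear (λ _ → 0ℚ)
  zero-linear = record { zero-ℓ = refl ; plus-ℓ = λ u v → refl ; scale-ℓ = λ q u → sym (ℚP.*-zeroʳ q) }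

  neg-linear : ∀ {ℓ} → Linear ℓ → Linear (λ u → - ℓ u)
  neg-linear {ℓ} lin = record
    { zero-ℓ  = cong -_ (zero-ℓ lin)
    ; plus-ℓ  = λ u v → trans (cong -_ (plus-ℓ lin u v)) (ℚP.neg-distrib-+ (ℓ u) (ℓ v))
    ; scale-ℓ = λ q u → trans (cong -_ (scale-ℓ lin q u)) (ℚP.neg-distribʳ-* q (ℓ u))
    }

  plus-linear : ∀ {ℓ ℓ′} → Linear ℓ → Linear ℓ′ → Linear (λ u → ℓ u + ℓ′ u)
  plus-linear {ℓ} {ℓ′} lin lin′ = record
    { zero-ℓ  = cong₂ _+_ (zero-ℓ lin) (zero-ℓ lin′)
    ; plus-ℓ  = λ u v → trans (cong₂ _+_ (plus-ℓ lin u v) (plus-ℓ lin′ u v))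
        (solve 4 (λ a b c d → a :+ b :+ (c :+ d) := a :+ c :+ (b :+ d)) refl (ℓ u) (ℓ v) (ℓ′ u) (ℓ′ v))
    ; scale-ℓ = λ q u → trans (cong₂ _+_ (scale-ℓ lin q u) (scale-ℓ lin′ q u)) (sym (ℚP.*-distribˡ-+ q (ℓ u) (ℓ′ u)))
    }

  minus-linear : ∀ {ℓ ℓ′} → Linear ℓ → Linear ℓ′ → Linear (λ u → ℓ u - ℓ′ u)
  minus-linear lin lin′ = plus-linear lin (neg-linear lin′)

  scaled-coefficient-linear : ∀ g c → Linear (λ u → u g * c)
  scaled-coefficient-linear g c = record
    { zero-ℓ = ℚP.*-zeroˡ c ; plus-ℓ = λ u v → ℚP.*-distribʳ-+ c (u g) (v g) ; scale-ℓ = λ q u → ℚP.*-assoc q (u g) c }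

  ρZ-linear : LinearMap ρZ
  ρZ-linear x y m = scaled-coefficient-linear _ (1/fac m)

  ρP-linear : LinearMap ρP
  ρP-linear x y m = scaled-coefficient-linear _ (1/fac m)

  ‖-linear : ∀ {L} → LinearMap L → ∀ γ → LinearMap (λ u → L u ‖ γ)
  ‖-linear {L} lin γ x y m = record
    { zero-ℓ  = trans (‖-ext γ {g = 0ℚ *M 0M} (λ x y m → zero-ℓ (lin x y m)) x y m)
                      (trans (‖-* 0ℚ 0M γ x y m) (ℚP.*-zeroˡ ((0M ‖ γ) x y m)))
    ; plus-ℓ  = λ u v → trans (‖-ext γ (λ x y m → plus-ℓ (lin x y m) u v) x y m) (‖-+ (L u) (L v) γ x y m)
    ; scale-ℓ = λ q u → trans (‖-ext γ (λ x y m → scale-ℓ (lin x y m) q u) x y m) (‖-* q (L u) γ x y m)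
    }

  Z₁-linear : ∀ {L} → LinearMap L → LinearMap (λ u → Z₁ (L u))
  Z₁-linear lin x y m = plus-linear (‖-linear lin TM x y m) (‖-linear (‖-linear lin δM) TM x y m)

  Z₂-linear : ∀ {L} → LinearMap L → LinearMap (λ u → Z₂ (L u))
  Z₂-linear lin x y m = plus-linear (lin x y m) (‖-linear lin δM x y m)

  even-linear : ∀ {L} → LinearMap L → LinearMap (λ u → even (L u))
  even-linear lin x y m =
    plus-linear (minus-linear (minus-linear (lin x y m) (‖-linear lin εM x y m)) (‖-linear lin ε′M x y m)) (‖-linear lin JM x y m)

  bigSum-equal : ∀ {ℓ ℓ′} → Linear ℓ → Linear ℓ′ → ∀ {B B′} f → (∀ v i → InA v → ℓ (B v i) ≡ ℓ′ (B′ v i)) →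
    ℓ (bigSum B f) ≡ ℓ′ (bigSum B′ f)
  bigSum-equal lin lin′ = bigSum-relation (equal-functionals lin lin′)

  if-map : (ℓ : F → ℚ) → ℓ 0F ≡ 0ℚ → ∀ b u → ℓ (if b then u else 0F) ≡ (if b then ℓ u else 0ℚ)
  if-map ℓ e true  u = refl
  if-map ℓ e false u = e

  sumF-map : ∀ {ℓ} → Linear ℓ → {A : Set} (xs : List A) (t : A → F) → ℓ (sumF (map t xs)) ≡ ∑ xs (λ x → ℓ (t x))
  sumF-map lin []       t = zero-ℓ lin
  sumF-map {ℓ} lin (x ∷ xs) t = trans (plus-ℓ lin (t x) _) (cong (ℓ (t x) +_) (sumF-map lin xs t))

  bigSum-map : ∀ {ℓ} → Linear ℓ → ∀ B f → ℓ (bigSum B f) ≡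
    ∑ pairs (λ v → if isAᵇ (proj₁ v) (proj₂ v) then ∑ (allFin (suc w)) (λ i → at f v i * fac i * ℓ (B v i)) else 0ℚ)
  bigSum-map {ℓ} lin B f = trans (sumF-map lin pairs _) (∑-cong pairs (λ v → trans
    (if-map ℓ (zero-ℓ lin) (isAᵇ (proj₁ v) (proj₂ v)) _)
    (cong (λ t → if isAᵇ (proj₁ v) (proj₂ v) then t else 0ℚ)
      (trans (sumF-map lin (allFin (suc w)) _) (∑-cong (allFin (suc w)) (λ i → scale-ℓ lin (at f v i * fac i) (B v i)))))))

  private
    if-cong : ∀ b {p q : ℚ} → (T b → p ≡ q) → (if b then p else 0ℚ) ≡ (if b then q else 0ℚ)
    if-cong true  h = h tt
    if-cong false h = refl

    if-T : ∀ b (p : ℚ) → T b → (if b then p else 0ℚ) ≡ p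
    if-T true p _ = refl

    if-0 : ∀ b {p : ℚ} → p ≡ 0ℚ → (if b then p else 0ℚ) ≡ 0ℚ
    if-0 true  e = e
    if-0 false e = refl

  bigSum-cong : ∀ B {f g} → f ≈M g → bigSum B f ≈F bigSum B g
  bigSum-cong B {f} {g} f≈g h = trans (bigSum-map (coefficient-linear h) B f) (trans
    (∑-cong pairs (λ v → if-cong (isAᵇ (proj₁ v) (proj₂ v)) (λ t → ∑-cong (allFin (suc w)) (λ i →
      cong (λ q → q * fac i * B v i h) (f≈g (proj₁ v) (proj₂ v) (isAᵇ-sound v t) i)))))
    (sym (bigSum-map (coefficient-linear h) B g)))

  ∑-concatMap : {A B : Set} (xs : List A) (t : A → List B) (h : B → ℚ) → ∑ (concatMap t xs) h ≡ ∑ xs (λ x → ∑ (t x) h)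
  ∑-concatMap []       t h = refl
  ∑-concatMap (x ∷ xs) t h = trans (∑-++ (t x) (concatMap t xs) h) (cong (∑ (t x) h +_) (∑-concatMap xs t h))

  ∑-pairs : ∀ h → ∑ pairs h ≡ ∑ (allFin N) (λ x → ∑ (allFin N) (λ y → h (x , y)))
  ∑-pairs h = trans (∑-concatMap (allFin N) (λ x → map (x ,_) (allFin N)) h)
    (∑-cong (allFin N) (λ x → ∑-map (allFin N) (x ,_) h))

  ∑-pairs-single : ∀ h v → (∀ v′ → v′ ≢ v → h v′ ≡ 0ℚ) → ∑ pairs h ≡ h v
  ∑-pairs-single h (x , y) h≡0 = trans (∑-pairs h) (trans
    (∑-Fin-single x (λ x′ x′≢x → ∑-zero (allFin N) (λ y′ → h≡0 (x′ , y′) (λ e → x′≢x (cong proj₁ e)))))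
    (∑-Fin-single y (λ y′ y′≢y → h≡0 (x , y′) (λ e → y′≢y (cong proj₂ e)))))

  -- The value at σ v is written as a sum over u against the indicator of u = σ v. After the sums
  -- are exchanged, each u is met exactly once, at v = σ u.
  ∑-pairs-involution : ∀ h (σ : Fin N × Fin N → Fin N × Fin N) → (∀ v → σ (σ v) ≡ v) →
    ∑ pairs (λ v → h (σ v)) ≡ ∑ pairs h
  ∑-pairs-involution h σ invol = begin
    ∑ pairs (λ v → h (σ v))
      ≡⟨ ∑-cong pairs (λ v → sym (single-out v)) ⟩
    ∑ pairs (λ v → ∑ pairs (λ u → h u * indicator (u ≟v σ v)))
      ≡⟨ ∑-swap pairs pairs (λ v u → h u * indicator (u ≟v σ v)) ⟩
    ∑ pairs (λ u → ∑ pairs (λ v → h u * indicator (u ≟v σ v)))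
      ≡⟨ ∑-cong pairs hit-once ⟩
    ∑ pairs h ∎
    where
    open ≡-Reasoning
    single-out : ∀ v → ∑ pairs (λ u → h u * indicator (u ≟v σ v)) ≡ h (σ v)
    single-out v = trans (∑-pairs-single (λ u → h u * indicator (u ≟v σ v)) (σ v) (λ u u≢ → *-zeroʳ′ (h u) (indicator-no (u ≟v σ v) u≢)))
      (trans (cong (h (σ v) *_) (indicator-yes (σ v ≟v σ v) refl)) (ℚP.*-identityʳ (h (σ v))))
    hit-once : ∀ u → ∑ pairs (λ v → h u * indicator (u ≟v σ v)) ≡ h u
    hit-once u = trans (∑-pairs-single (λ v → h u * indicator (u ≟v σ v)) (σ u)
        (λ v v≢ → *-zeroʳ′ (h u) (indicator-no (u ≟v σ v) (λ e → v≢ (trans (sym (invol v)) (cong σ (sym e)))))))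
      (trans (cong (h u *_) (indicator-yes (u ≟v σ (σ u)) (sym (invol u)))) (ℚP.*-identityʳ (h u)))

  -- The factorials in `bigSum` cancel those in the coordinate, and the double sum reduces to its
  -- term at the row (x, y) and i = m.
  bigSum-points : ∀ {ℓ} → Linear ℓ → ∀ B f x y m → (∀ v i → ℓ (B v i) ≡ 1/fac i * point v i x y m) → IsA x y →
    ℓ (bigSum B f) ≡ f x y m
  bigSum-points {ℓ} lin B f x y m h isA = begin
    ℓ (bigSum B f)
      ≡⟨ bigSum-map lin B f ⟩
    ∑ pairs (λ v → if isAᵇ (proj₁ v) (proj₂ v) then ∑ (allFin (suc w)) (λ i → at f v i * fac i * ℓ (B v i)) else 0ℚ)
      ≡⟨ ∑-cong pairs (λ v → cong (λ t → if isAᵇ (proj₁ v) (proj₂ v) then t else 0ℚ) (inner v)) ⟩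
    ∑ pairs (λ v → if isAᵇ (proj₁ v) (proj₂ v) then indicator (v ≟v (x , y)) * at f v m else 0ℚ)
      ≡⟨ ∑-pairs-single _ (x , y) (λ v v≢ → if-0 (isAᵇ (proj₁ v) (proj₂ v)) (*-zeroˡ′ (at f v m) (indicator-no (v ≟v (x , y)) v≢))) ⟩
    (if isAᵇ x y then indicator ((x , y) ≟v (x , y)) * f x y m else 0ℚ)
      ≡⟨ if-T (isAᵇ x y) _ (isAᵇ-complete (x , y) isA) ⟩
    indicator ((x , y) ≟v (x , y)) * f x y m
      ≡⟨ cong (_* f x y m) (indicator-yes ((x , y) ≟v (x , y)) refl) ⟩
    1ℚ * f x y m
      ≡⟨ ℚP.*-identityˡ (f x y m) ⟩
    f x y m ∎
    where
    open ≡-Reasoning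
    inner : ∀ v → ∑ (allFin (suc w)) (λ i → at f v i * fac i * ℓ (B v i)) ≡ indicator (v ≟v (x , y)) * at f v m
    inner v = begin
      ∑ (allFin (suc w)) (λ i → at f v i * fac i * ℓ (B v i))
        ≡⟨ ∑-cong (allFin (suc w)) (λ i → trans (cong (at f v i * fac i *_) (h v i)) (cancel i)) ⟩
      ∑ (allFin (suc w)) (λ i → d * (at f v i * monomial i m))
        ≡⟨ ∑-*ˡ (allFin (suc w)) d (λ i → at f v i * monomial i m) ⟩
      d * ∑ (allFin (suc w)) (λ i → at f v i * monomial i m)
        ≡⟨ cong (d *_) (trans (∑-Fin-single m (λ i i≢m → *-zeroʳ′ (at f v i) (indicator-no (i FinP.≟ m) i≢m)))
             (trans (cong (at f v m *_) (indicator-yes (m FinP.≟ m) refl)) (ℚP.*-identityʳ (at f v m)))) ⟩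
      d * at f v m ∎
      where
      d = indicator (v ≟v (x , y))
      cancel : ∀ i → at f v i * fac i * (1/fac i * (d * monomial i m)) ≡ d * (at f v i * monomial i m)
      cancel i = begin
        at f v i * fac i * (1/fac i * (d * monomial i m))
          ≡⟨ solve 5 (λ a f g d p → a :* f :* (g :* (d :* p)) := f :* g :* (d :* (a :* p))) refl (at f v i) (fac i) (1/fac i) d (monomial i m) ⟩
        fac i * 1/fac i * (d * (at f v i * monomial i m))
          ≡⟨ cong (_* (d * (at f v i * monomial i m))) (fac*1/fac i) ⟩
        1ℚ * (d * (at f v i * monomial i m))
          ≡⟨ ℚP.*-identityˡ (d * (at f v i * monomial i m)) ⟩
        d * (at f v i * monomial i m) ∎

  ρZ-bigSum-genZ : ∀ f → ρZ (bigSum genZ f) ≈M f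
  ρZ-bigSum-genZ f x y isA m = bigSum-points (ρZ-linear x y m) genZ f x y m (λ v i → ρZ-genZ v i x y m) isA

  ρP-bigSum-genP : ∀ f → ρP (bigSum genP f) ≈M f
  ρP-bigSum-genP f x y isA m = bigSum-points (ρP-linear x y m) genP f x y m (λ v i → ρP-genP v i x y m) isA

  bigSum-zero : ∀ {ℓ} → Linear ℓ → ∀ B f → (∀ v i → ℓ (B v i) ≡ 0ℚ) → ℓ (bigSum B f) ≡ 0ℚ
  bigSum-zero lin B f h = bigSum-equal lin zero-linear {B} {B} f (λ v i _ → h v i)

  Valid-gen : Gen → Set
  Valid-gen (Zg r s x y) = ValidIdx (r , s , x , y)
  Valid-gen (Pg r s x y) = ValidIdx (r , s , x , y)
  Valid-gen (Zk c)       = ⊤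

  -- `F` also allows coefficients at generators of the wrong weight or with a row outside A(N),
  -- about which `ρZ` and `ρP` on A(N) say nothing. Vanishing there makes the coordinates decisive.
  Supported : F → Set
  Supported u = ∀ g → ¬ Valid-gen g → u g ≡ 0ℚ

  Supported-linear : LinearRelation (λ u _ → Supported u)
  Supported-linear = record
    { zero-R  = λ g _ → refl
    ; plus-R  = λ h h′ g ¬v → cong₂ _+_ (h g ¬v) (h′ g ¬v)
    ; scale-R = λ q h g ¬v → *-zeroʳ′ q (h g ¬v)
    }

  Supported-plus : ∀ {u v} → Supported u → Supported v → Supported (u +F v)
  Supported-plus h h′ g ¬v = cong₂ _+_ (h g ¬v) (h′ g ¬v)

  Supported-minus : ∀ {u v} → Supported u → Supported v → Supported (u -F v)
  Supported-minus h h′ g ¬v = cong₂ _-_ (h g ¬v) (h′ g ¬v)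

  Supported-scale : ∀ q {u} → Supported u → Supported (q • u)
  Supported-scale q h g ¬v = *-zeroʳ′ q (h g ¬v)

  Supported-gen : ∀ g → Valid-gen g → Supported (gen g)
  Supported-gen g valid h ¬v = gen-≢ {g} {h} (λ e → ¬v (subst Valid-gen e valid))

  Supported-bigSum : ∀ B f → (∀ v i → InA v → Supported (B v i)) → Supported (bigSum B f)
  Supported-bigSum B f h = bigSum-relation Supported-linear {B} {B} f h

  ValidIdx-monomial : ∀ i x y → IsA x y → ValidIdx (suc (toℕ i) , suc (w ℕ.∸ toℕ i) , x , y)
  ValidIdx-monomial i x y isA = ℕ.s≤s ℕ.z≤n , ℕ.s≤s ℕ.z≤n ,
    trans (cong suc (trans (ℕP.+-suc (toℕ i) _) (cong suc (ℕP.m+[n∸m]≡n (toℕ≤w i))))) (ℕP.+-comm 2 w) , isA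

  InA-swap : ∀ {x y} → IsA x y → IsA y x
  InA-swap {x} {y} isA = trans (cong (λ t → ℕG.gcd t N) (ℕG.gcd-comm (toℕ y) (toℕ x))) isA

  InA-⊖ : ∀ x y → IsA x y → IsA (x ⊖ y) y
  InA-⊖ x y isA = subst InA (shear {x} {y}) (InA-⊙ (mat (ℤ.+ 1) (ℤ.+ 0) (ℤ.- ℤ.+ 1) (ℤ.+ 1)) refl (x , y) isA)

  Supported-zSum : ∀ r s x y → ValidIdx (r , s , x , y) → Supported (zSum r s x y)
  Supported-zSum (suc r) (suc s) x y (_ , _ , r+s≡k , isA) h ¬v = trans
    (sumF-eval (upTo (suc r)) (λ j → ℕ→ℚ ((s ℕ.+ j) C j) • gen (Zg (suc r ℕ.∸ j) (suc s ℕ.+ j) (x ⊖ y) y)) h)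
    (∑-upTo-zero (suc r) (λ j j<1+r → *-zeroʳ′ (ℕ→ℚ ((s ℕ.+ j) C j))
      (Supported-gen (Zg (suc r ℕ.∸ j) (suc s ℕ.+ j) (x ⊖ y) y)
        ( ℕP.m<n⇒0<n∸m j<1+r , ℕ.s≤s ℕ.z≤n
        , trans (sym (ℕP.+-assoc (suc r ℕ.∸ j) (suc s) j)) (trans (reorder (suc r ℕ.∸ j) (suc s) j)
            (trans (cong (ℕ._+ suc s) (ℕP.m∸n+n≡m (ℕP.<⇒≤ j<1+r))) r+s≡k))
        , InA-⊖ x y isA) h ¬v)))
    where
    reorder : ∀ a b c → a ℕ.+ b ℕ.+ c ≡ a ℕ.+ c ℕ.+ b
    reorder = NatSolver.solve-∀

  ValidIdx-swap : ∀ {r s x y} → ValidIdx (r , s , x , y) → ValidIdx (s , r , y , x)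
  ValidIdx-swap {r} {s} {x} {y} (1≤r , 1≤s , r+s≡k , isA) = 1≤s , 1≤r , trans (ℕP.+-comm s r) r+s≡k , InA-swap {x} {y} isA

  Supported-relation : ∀ b v i → InA v → Supported (relation b v i)
  Supported-relation false (x , y) i isA = Supported-minus
    (Supported-gen (Pg _ _ x y) valid)
    (Supported-plus (Supported-zSum _ _ x y valid) (Supported-zSum _ _ y x (ValidIdx-swap {x = x} {y} valid)))
    where valid = ValidIdx-monomial i x y isA
  Supported-relation true (x , y) i isA = Supported-minus
    (Supported-gen (Pg _ _ x y) valid)
    (Supported-plus (Supported-plus (Supported-gen (Zg _ _ x y) valid) (Supported-gen (Zg _ _ y x) (ValidIdx-swap {x = x} {y} valid)))
                    (Supported-gen (Zk (x ⊕ y)) tt))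
    where valid = ValidIdx-monomial i x y isA

  InA-neg₁ : ∀ x y → IsA x y → IsA (⊝ x) y
  InA-neg₁ x y isA = subst InA (⊙ε x y) (InA-⊙ εM refl (x , y) isA)

  InA-neg₂ : ∀ x y → IsA x y → IsA x (⊝ y)
  InA-neg₂ x y isA = InA-swap {⊝ y} {x} (InA-neg₁ y x (InA-swap {x} {y} isA))

  Supported-evenP : ∀ v i → InA v → Supported (evenP v i)
  Supported-evenP (x , y) i isA = Supported-plus (Supported-plus (Supported-plus
    (Supported-gen (Pg _ _ x y) (ValidIdx-monomial i x y isA))
    (Supported-scale (sign (suc (toℕ i))) (Supported-gen (Pg _ _ (⊝ x) y) (ValidIdx-monomial i (⊝ x) y (InA-neg₁ x y isA)))))
    (Supported-scale (sign (suc (w ℕ.∸ toℕ i))) (Supported-gen (Pg _ _ x (⊝ y)) (ValidIdx-monomial i x (⊝ y) (InA-neg₂ x y isA)))))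
    (Supported-scale (sign (suc (toℕ i) ℕ.+ suc (w ℕ.∸ toℕ i))) (Supported-gen (Pg _ _ (⊝ x) (⊝ y)) (ValidIdx-monomial i (⊝ x) (⊝ y) (InA-neg₁ x (⊝ y) (InA-neg₂ x y isA)))))

  -- A valid index is (i+1, w-i+1) for some i ≤ w. This passes from the indexing of the relations to
  -- that of the coefficients of `V`.
  ValidIdx-elim : (Q : ℕ × ℕ × Fin N × Fin N → Set) →
    (∀ i x y → IsA x y → Q (suc (toℕ i) , suc (w ℕ.∸ toℕ i) , x , y)) → ∀ idx → ValidIdx idx → Q idx
  ValidIdx-elim Q h (suc r , suc s , x , y) (_ , _ , r+s≡k , isA) =
    subst (λ rs → Q (suc (proj₁ rs) , suc (proj₂ rs) , x , y)) (cong₂ _,_ toℕi≡r w∸i≡s) (h i x y isA)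
    where
    r+s≡w : r ℕ.+ s ≡ w
    r+s≡w = ℕP.+-cancelʳ-≡ 2 (r ℕ.+ s) w (trans (shift r s) r+s≡k)
      where
      shift : ∀ r s → r ℕ.+ s ℕ.+ 2 ≡ suc r ℕ.+ suc s
      shift = NatSolver.solve-∀
    r<1+w : r ℕ.< suc w
    r<1+w = ℕ.s≤s (subst (r ℕ.≤_) r+s≡w (ℕP.m≤m+n r s))
    i : Fin (suc w)
    i = Fin.fromℕ< r<1+w
    toℕi≡r : toℕ i ≡ r
    toℕi≡r = FinP.toℕ-fromℕ< r<1+w
    w∸i≡s : w ℕ.∸ toℕ i ≡ s
    w∸i≡s = trans (cong₂ ℕ._∸_ (sym r+s≡w) toℕi≡r) (ℕP.m+n∸m≡n r s)

  Valid-gen? : ∀ g → Dec (Valid-gen g)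
  Valid-gen? (Zg r s x y) = (1 ℕP.≤? r) ×-dec (1 ℕP.≤? s) ×-dec (r ℕ.+ s ℕP.≟ k) ×-dec (_ ℕP.≟ 1)
  Valid-gen? (Pg r s x y) = (1 ℕP.≤? r) ×-dec (1 ℕP.≤? s) ×-dec (r ℕ.+ s ℕP.≟ k) ×-dec (_ ℕP.≟ 1)
  Valid-gen? (Zk c)       = yes tt

  private
    cancel-1/fac : ∀ m {p q} → p * 1/fac m ≡ q * 1/fac m → p ≡ q
    cancel-1/fac m {p} {q} e = trans (sym (undo p)) (trans (cong (_* fac m) e) (undo q))
      where
      undo : ∀ p → p * 1/fac m * fac m ≡ p
      undo p = trans (solve 3 (λ p g f → p :* g :* f := p :* (f :* g)) refl p (1/fac m) (fac m))
                     (trans (cong (p *_) (fac*1/fac m)) (ℚP.*-identityʳ p))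

  -- At valid generators the division by `fac m` is undone; at the others both sides vanish. The
  -- direct statement verifies its identities in the free space in this way.
  Supported-≈F : ∀ {u v} → Supported u → Supported v → ρZ u ≈M ρZ v → ρP u ≈M ρP v → (∀ c → u (Zk c) ≡ v (Zk c)) → u ≈F v
  Supported-≈F {u} {v} su sv eZ eP eK g = case (Valid-gen? g)
    where
    on-valid : ∀ g → Valid-gen g → u g ≡ v g
    on-valid (Zg r s x y) = ValidIdx-elim (λ (r , s , x , y) → u (Zg r s x y) ≡ v (Zg r s x y))
      (λ m x y isA → cancel-1/fac m (eZ x y isA m)) (r , s , x , y)
    on-valid (Pg r s x y) = ValidIdx-elim (λ (r , s , x , y) → u (Pg r s x y) ≡ v (Pg r s x y))
      (λ m x y isA → cancel-1/fac m (eP x y isA m)) (r , s , x , y)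
    on-valid (Zk c) _ = eK c
    case : Dec (Valid-gen g) → u g ≡ v g
    case (yes valid) = on-valid g valid
    case (no ¬valid) = trans (su g ¬valid) (sym (sv g ¬valid))

  module _ {I : Set} {Valid : I → Set} {vec : I → F} where

    InSpan-≈F : ∀ {u v} → u ≈F v → InSpan Valid vec v → InSpan Valid vec u
    InSpan-≈F u≈v (L , valid , e) = L , valid , λ g → trans (u≈v g) (e g)

    InSpan-vec : ∀ {i} → Valid i → InSpan Valid vec (vec i)
    InSpan-vec {i} valid = (1ℚ , i) ∷ [] , valid ∷ [] , λ g →
      sym (trans (ℚP.+-identityʳ (1ℚ * vec i g)) (ℚP.*-identityˡ (vec i g)))

    private
      term : ℚ × I → F
      term (q , i) = q • vec i

      sum-++ : ∀ L L′ g → sumF (map term (L ++ L′)) g ≡ sumF (map term L) g + sumF (map term L′) g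
      sum-++ L L′ g = trans (sumF-eval (L ++ L′) term g) (trans (∑-++ L L′ (λ x → term x g))
        (sym (cong₂ _+_ (sumF-eval L term g) (sumF-eval L′ term g))))

    InSpan-+ : ∀ {u v} → InSpan Valid vec u → InSpan Valid vec v → InSpan Valid vec (u +F v)
    InSpan-+ (L , valid , e) (L′ , valid′ , e′) =
      L ++ L′ , AllP.++⁺ valid valid′ , λ g → trans (cong₂ _+_ (e g) (e′ g)) (sym (sum-++ L L′ g))

    InSpan-• : ∀ q {u} → InSpan Valid vec u → InSpan Valid vec (q • u)
    InSpan-• q {u} (L , valid , e) = map (λ (p , i) → q * p , i) L , AllP.map⁺ valid , λ g → begin
      q * u g                                     ≡⟨ cong (q *_) (trans (e g) (sumF-eval L term g)) ⟩
      q * ∑ L (λ x → term x g)                    ≡⟨ ∑-*ˡ L q (λ x → term x g) ⟨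
      ∑ L (λ x → q * term x g)                    ≡⟨ ∑-cong L (λ (p , i) → sym (ℚP.*-assoc q p (vec i g))) ⟩
      ∑ L (λ (p , i) → q * p * vec i g)           ≡⟨ ∑-map L (λ (p , i) → q * p , i) (λ x → term x g) ⟨
      ∑ (map (λ (p , i) → q * p , i) L) (λ x → term x g) ≡⟨ sumF-eval (map (λ (p , i) → q * p , i) L) term g ⟨
      sumF (map term (map (λ (p , i) → q * p , i) L)) g ∎
      where open ≡-Reasoning

    InSpan-linear : LinearRelation (λ u _ → InSpan Valid vec u)
    InSpan-linear = record
      { zero-R  = [] , [] , λ g → refl
      ; plus-R  = InSpan-+
      ; scale-R = λ q → InSpan-• q
      }

    -- A companion t is chosen for each generator and combined with the same coefficients. R is not
    -- assumed to respect `≈F`, so the conclusion is about the list sum u₀ and not about u.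
    InSpan-elim : ∀ {R : F → F → Set} → LinearRelation R → (∀ i → Valid i → Σ F (R (vec i))) →
      ∀ {u} → InSpan Valid vec u → Σ F λ u₀ → Σ F λ t → (u ≈F u₀) × R u₀ t
    InSpan-elim {R} lin h (L , valid , e) = sumF (map (λ qi → proj₁ qi • vec (proj₂ qi)) L) , proj₁ (collect L valid) , e , proj₂ (collect L valid)
      where
      collect : ∀ L → All (λ qi → Valid (proj₂ qi)) L → Σ F (R (sumF (map (λ qi → proj₁ qi • vec (proj₂ qi)) L)))
      collect [] [] = 0F , zero-R lin
      collect ((q , i) ∷ L) (v ∷ vs) = (q • proj₁ (h i v)) +F proj₁ (collect L vs) ,
        plus-R lin (scale-R lin q (proj₂ (h i v))) (proj₂ (collect L vs))

  InRel-bigSum : ∀ b f → InRel (bigSum (relation b) f)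
  InRel-bigSum b f = bigSum-relation InSpan-linear {relation b} {relation b} f
    (λ (x , y) i isA → InSpan-vec {i = b , suc (toℕ i) , suc (w ℕ.∸ toℕ i) , x , y} (ValidIdx-monomial i x y isA))

-- Coordinates of the families of relations, and elements of P^ev.

module Coordinates (N : ℕ) .{{_ : NonZero N}} (w : ℕ) where
  open Setup N w
  open Polynomials N w
  open Residues N w
  open Action N w
  open FreeSpace N w
  open Relations N w
  open Spans N w

  Z₁-cong : ∀ {f g} → f ≈M g → Z₁ f ≈M Z₁ g
  Z₁-cong f≈g x y isA m = cong₂ _+_ (‖-cong TM refl f≈g x y isA m) (‖-cong TM refl (‖-cong δM refl f≈g) x y isA m)

  Z₂-cong : ∀ {f g} → f ≈M g → Z₂ f ≈M Z₂ g
  Z₂-cong f≈g x y isA m = cong₂ _+_ (f≈g x y isA m) (‖-cong δM refl f≈g x y isA m)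

  even-cong : ∀ {f g} → f ≈M g → even f ≈M even g
  even-cong f≈g x y isA m = cong₂ _+_
    (cong₂ _-_ (cong₂ _-_ (f≈g x y isA m) (‖-cong εM refl f≈g x y isA m)) (‖-cong ε′M refl f≈g x y isA m))
    (‖-cong JM refl f≈g x y isA m)

  ρZ-bigSum-relation₁ : ∀ f x y → IsA x y → ∀ m → ρZ (bigSum (relation false) f) x y m ≡ - Z₁ f x y m
  ρZ-bigSum-relation₁ f x y isA m = trans
    (bigSum-equal (ρZ-linear x y m) (neg-linear (Z₁-linear ρP-linear x y m)) {relation false} {genP} f (λ v i _ → ρZ-relation₁ v i x y m))
    (cong -_ (Z₁-cong (ρP-bigSum-genP f) x y isA m))

  ρZ-bigSum-relation₂ : ∀ f x y → IsA x y → ∀ m → ρZ (bigSum (relation true) f) x y m ≡ - Z₂ f x y m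
  ρZ-bigSum-relation₂ f x y isA m = trans
    (bigSum-equal (ρZ-linear x y m) (neg-linear (Z₂-linear ρP-linear x y m)) {relation true} {genP} f (λ v i _ → ρZ-relation₂ v i x y m))
    (cong -_ (Z₂-cong (ρP-bigSum-genP f) x y isA m))

  ρP-bigSum-relation : ∀ b f x y → IsA x y → ∀ m → ρP (bigSum (relation b) f) x y m ≡ f x y m
  ρP-bigSum-relation b f x y isA m = trans
    (bigSum-equal (ρP-linear x y m) (ρP-linear x y m) {relation b} {genP} f (λ v i _ → ρP-relation b v i x y m))
    (ρP-bigSum-genP f x y isA m)

  bigSum-relation₁-Zk : ∀ f c → bigSum (relation false) f (Zk c) ≡ 0ℚ
  bigSum-relation₁-Zk f c = bigSum-zero (coefficient-linear (Zk c)) (relation false) f (λ v i → relation₁-Zk v i c)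

  bigSum-relation₂-Zk : ∀ f c → bigSum (relation true) f (Zk c) ≡ - bigSum genS f (Zk c)
  bigSum-relation₂-Zk f c = bigSum-equal (coefficient-linear (Zk c)) (neg-linear (coefficient-linear (Zk c)))
    {relation true} {genS} f (λ v i _ → relation₂-Zk v i c)

  ρP-evenP-bigSum : ∀ f x y → IsA x y → ∀ m → ρP (bigSum evenP f) x y m ≡ even f x y m
  ρP-evenP-bigSum f x y isA m = trans
    (bigSum-equal (ρP-linear x y m) (even-linear ρP-linear x y m) {evenP} {genP} f (λ v i _ → ρP-evenP v i x y m))
    (even-cong (ρP-bigSum-genP f) x y isA m)

  evenP-avoids : ∀ v i g → (∀ r s x y → Pg r s x y ≢ g) → evenP v i g ≡ 0ℚ
  evenP-avoids (x , y) i g g≢ = cong₂ _+_ (cong₂ _+_ (cong₂ _+_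
    (gen-≢ (g≢ r s x y))
    (*-zeroʳ′ (sign r) (gen-≢ (g≢ r s (⊝ x) y))))
    (*-zeroʳ′ (sign s) (gen-≢ (g≢ r s x (⊝ y)))))
    (*-zeroʳ′ (sign (r ℕ.+ s)) (gen-≢ (g≢ r s (⊝ x) (⊝ y))))
    where
    r = suc (toℕ i)
    s = suc (w ℕ.∸ toℕ i)

  private
    neg : Fin N × Fin N → Fin N × Fin N
    neg v = v ⊙ JM

  neg-involutive : ∀ v → neg (neg v) ≡ v
  neg-involutive v = trans (⊙-⊗ v JM JM) (⊙-identity v)

  ⊝-involutive : ∀ x → ⊝ (⊝ x) ≡ x
  ⊝-involutive x = cong proj₁ (trans (sym (trans (cong neg (⊙J x x)) (⊙J (⊝ x) (⊝ x)))) (neg-involutive (x , x)))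

  ⊝-⊕ : ∀ x y → (⊝ x) ⊕ (⊝ y) ≡ ⊝ (x ⊕ y)
  ⊝-⊕ x y = begin
    red (toZ (⊝ x) ℤ.+ toZ (⊝ y))                       ≡⟨ cong red (ones (toZ (⊝ x)) (toZ (⊝ y))) ⟩
    red (toZ (⊝ x) ℤ.* ℤ.+ 1 ℤ.+ toZ (⊝ y) ℤ.* ℤ.+ 1)   ≡⟨ red-combination (ℤ.- toZ x) (ℤ.- toZ y) (ℤ.+ 1) (ℤ.+ 1) ⟩
    red (ℤ.- toZ x ℤ.* ℤ.+ 1 ℤ.+ ℤ.- toZ y ℤ.* ℤ.+ 1)   ≡⟨ cong red (negate (toZ x) (toZ y)) ⟩
    red (z ℤ.* (ℤ.- ℤ.+ 1) ℤ.+ z ℤ.* ℤ.+ 0)             ≡⟨ red-combination z z (ℤ.- ℤ.+ 1) (ℤ.+ 0) ⟨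
    red (toZ (red z) ℤ.* (ℤ.- ℤ.+ 1) ℤ.+ toZ (red z) ℤ.* ℤ.+ 0) ≡⟨ cong red (minus (toZ (red z))) ⟩
    red (ℤ.- toZ (red z)) ∎
    where
    open ≡-Reasoning
    z = toZ x ℤ.+ toZ y
    ones : ∀ x y → x ℤ.+ y ≡ x ℤ.* ℤ.+ 1 ℤ.+ y ℤ.* ℤ.+ 1
    ones = IntSolver.solve-∀
    negate : ∀ x y → ℤ.- x ℤ.* ℤ.+ 1 ℤ.+ ℤ.- y ℤ.* ℤ.+ 1 ≡ (x ℤ.+ y) ℤ.* (ℤ.- ℤ.+ 1) ℤ.+ (x ℤ.+ y) ℤ.* ℤ.+ 0
    negate = IntSolver.solve-∀
    minus : ∀ z → z ℤ.* (ℤ.- ℤ.+ 1) ℤ.+ z ℤ.* ℤ.+ 0 ≡ ℤ.- z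
    minus = IntSolver.solve-∀

  genS-neg : ∀ v i c → genS (neg v) i (Zk (⊝ c)) ≡ genS v i (Zk c)
  genS-neg v@(x , y) i c = begin
    genS (neg v) i (Zk (⊝ c))         ≡⟨ cong (λ u → genS u i (Zk (⊝ c))) (⊙J x y) ⟩
    gen (Zk ((⊝ x) ⊕ (⊝ y))) (Zk (⊝ c))   ≡⟨ cong (λ t → gen (Zk t) (Zk (⊝ c))) (⊝-⊕ x y) ⟩
    gen (Zk (⊝ (x ⊕ y))) (Zk (⊝ c))   ≡⟨ gen-indicator _ _ (x ⊕ y FinP.≟ c) (λ e → cong (λ t → Zk (⊝ t)) e) (λ e → ⊝-injective (Zk-injective e)) ⟩
    indicator (x ⊕ y FinP.≟ c)        ≡⟨ gen-indicator _ _ (x ⊕ y FinP.≟ c) (cong Zk) Zk-injective ⟨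
    gen (Zk (x ⊕ y)) (Zk c)           ∎
    where
    open ≡-Reasoning
    Zk-injective : ∀ {a b} → Zk a ≡ Zk b → a ≡ b
    Zk-injective refl = refl
    ⊝-injective : ∀ {a b} → ⊝ a ≡ ⊝ b → a ≡ b
    ⊝-injective {a} {b} e = trans (sym (⊝-involutive a)) (trans (cong ⊝_ e) (⊝-involutive b))

  sign² : ∀ n → sign n * sign n ≡ 1ℚ
  sign² zero    = refl
  sign² (suc n) = trans (solve 1 (λ a → (:- a) :* (:- a) := a :* a) refl (sign n)) (sign² n)

  actV-J : ∀ p i → actV JM p i ≡ sign w * p i
  actV-J p = actV-unique JM p (λ i → sign w * p i) (λ X Y → ∑-cong (allFin (suc w)) (λ i → begin
    sign w * p i * (X ^ toℕ i * Y ^ (w ℕ.∸ toℕ i))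
      ≡⟨ cong (λ t → t * p i * (X ^ toℕ i * Y ^ (w ℕ.∸ toℕ i)))
           (trans (cong sign (sym (ℕP.m+[n∸m]≡n (toℕ≤w i)))) (sign-+ (toℕ i) (w ℕ.∸ toℕ i))) ⟩
    sign (toℕ i) * sign (w ℕ.∸ toℕ i) * p i * (X ^ toℕ i * Y ^ (w ℕ.∸ toℕ i))
      ≡⟨ solve 5 (λ a b p x y → a :* b :* p :* (x :* y) := p :* (a :* x :* (b :* y))) refl
           (sign (toℕ i)) (sign (w ℕ.∸ toℕ i)) (p i) (X ^ toℕ i) (Y ^ (w ℕ.∸ toℕ i)) ⟩
    p i * (sign (toℕ i) * X ^ toℕ i * (sign (w ℕ.∸ toℕ i) * Y ^ (w ℕ.∸ toℕ i)))
      ≡⟨ cong₂ (λ s t → p i * (s * t)) (power X Y (toℕ i)) (power′ X Y (w ℕ.∸ toℕ i)) ⟩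
    p i * ((-1ℤ * X + 0ℚ * Y) ^ toℕ i * (0ℚ * X + -1ℤ * Y) ^ (w ℕ.∸ toℕ i)) ∎))
    where
    open ≡-Reasoning
    -1ℤ = ℤ→ℚ (ℤ.- ℤ.+ 1)
    power : ∀ X Y n → sign n * X ^ n ≡ (-1ℤ * X + 0ℚ * Y) ^ n
    power X Y n = trans (cong (_* X ^ n) (sym (-1^≡sign n))) (trans (sym (^-distrib-* -1ℤ X n))
      (cong (_^ n) (solve 2 (λ u v → u := u :+ con 0ℚ :* v) refl (-1ℤ * X) Y)))
    power′ : ∀ X Y n → sign n * Y ^ n ≡ (0ℚ * X + -1ℤ * Y) ^ n
    power′ X Y n = trans (cong (_* Y ^ n) (sym (-1^≡sign n))) (trans (sym (^-distrib-* -1ℤ Y n))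
      (cong (_^ n) (solve 2 (λ u v → v := con 0ℚ :* u :+ v) refl X (-1ℤ * Y))))

  J-invariant : ∀ {f} → (f ‖ JM) ≈M f → ∀ v → InA v → ∀ i → at f (neg v) i ≡ sign w * at f v i
  J-invariant {f} f‖J≈f v@(x , y) isA i = begin
    at f (neg v) i                       ≡⟨ ℚP.*-identityˡ (at f (neg v) i) ⟨
    1ℚ * at f (neg v) i                  ≡⟨ cong (_* at f (neg v) i) (sign² w) ⟨
    sign w * sign w * at f (neg v) i     ≡⟨ ℚP.*-assoc (sign w) (sign w) (at f (neg v) i) ⟩
    sign w * (sign w * at f (neg v) i)   ≡⟨ cong (sign w *_) (trans (‖-def f JM x y i) (actV-J (at f (neg v)) i)) ⟨
    sign w * (f ‖ JM) x y i              ≡⟨ cong (sign w *_) (f‖J≈f x y isA i) ⟩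
    sign w * at f v i                    ∎
    where open ≡-Reasoning

  isAᵇ-neg : ∀ v → isAᵇ (proj₁ (neg v)) (proj₂ (neg v)) ≡ isAᵇ (proj₁ v) (proj₂ v)
  isAᵇ-neg v = T-ext _ _
    (λ t → isAᵇ-complete v (subst InA (neg-involutive v) (InA-⊙ JM refl (neg v) (isAᵇ-sound (neg v) t))))
    (λ t → isAᵇ-complete (neg v) (InA-⊙ JM refl v (isAᵇ-sound v t)))
    where
    T-ext : ∀ a b → (T a → T b) → (T b → T a) → a ≡ b
    T-ext true  true  f g = refl
    T-ext true  false f g = ⊥-elim (f tt)
    T-ext false true  f g = ⊥-elim (g tt)
    T-ext false false f g = refl

  -- The sum over rows is reindexed by v ↦ -v. Since J acts on polynomials of degree w by (-1)^w,
  -- invariance under J gives f(-v) = (-1)^w f(v).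
  bigSum-genS-neg : ∀ f → (f ‖ JM) ≈M f → ∀ c → bigSum genS f (Zk (⊝ c)) ≡ sign w * bigSum genS f (Zk c)
  bigSum-genS-neg f f‖J≈f c = begin
    bigSum genS f (Zk (⊝ c))
      ≡⟨ bigSum-map (coefficient-linear (Zk (⊝ c))) genS f ⟩
    ∑ pairs h
      ≡⟨ ∑-pairs-involution h neg neg-involutive ⟨
    ∑ pairs (λ v → h (neg v))
      ≡⟨ ∑-cong pairs (λ v → trans
           (cong (λ b → if b then ∑ (allFin (suc w)) (λ i → at f (neg v) i * fac i * genS (neg v) i (Zk (⊝ c))) else 0ℚ) (isAᵇ-neg v))
           (if-scale (isAᵇ (proj₁ v) (proj₂ v)) (∑ (allFin (suc w)) (λ i → at f v i * fac i * genS v i (Zk c))) (sign w) (λ t → trans (∑-cong (allFin (suc w)) (term v (isAᵇ-sound v t)))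
              (∑-*ˡ (allFin (suc w)) (sign w) (λ i → at f v i * fac i * genS v i (Zk c)))))) ⟩
    ∑ pairs (λ v → sign w * h′ v)
      ≡⟨ ∑-*ˡ pairs (sign w) h′ ⟩
    sign w * ∑ pairs h′
      ≡⟨ cong (sign w *_) (bigSum-map (coefficient-linear (Zk c)) genS f) ⟨
    sign w * bigSum genS f (Zk c) ∎
    where
    open ≡-Reasoning
    h h′ : Fin N × Fin N → ℚ
    h v = if isAᵇ (proj₁ v) (proj₂ v) then ∑ (allFin (suc w)) (λ i → at f v i * fac i * genS v i (Zk (⊝ c))) else 0ℚ
    h′ v = if isAᵇ (proj₁ v) (proj₂ v) then ∑ (allFin (suc w)) (λ i → at f v i * fac i * genS v i (Zk c)) else 0ℚ
    if-scale : ∀ b {p} (q s : ℚ) → (T b → p ≡ s * q) → (if b then p else 0ℚ) ≡ s * (if b then q else 0ℚ)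
    if-scale true  q s e = e tt
    if-scale false q s e = sym (ℚP.*-zeroʳ s)
    term : ∀ v → InA v → ∀ i →
      at f (neg v) i * fac i * genS (neg v) i (Zk (⊝ c)) ≡ sign w * (at f v i * fac i * genS v i (Zk c))
    term v isA i = begin
      at f (neg v) i * fac i * genS (neg v) i (Zk (⊝ c))
        ≡⟨ cong₂ (λ s t → s * fac i * t) (J-invariant {f} f‖J≈f v isA i) (genS-neg v i c) ⟩
      sign w * at f v i * fac i * genS v i (Zk c)
        ≡⟨ solve 4 (λ s a f g → s :* a :* f :* g := s :* (a :* f :* g)) refl (sign w) (at f v i) (fac i) (genS v i (Zk c)) ⟩
      sign w * (at f v i * fac i * genS v i (Zk c)) ∎

  evenS : Fin N × Fin N → Fin (suc w) → F
  evenS (x , y) i = pevVec (zIdx (x ⊕ y))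

  private
    gen-⊝ : ∀ a c → gen (Zk (⊝ a)) (Zk c) ≡ gen (Zk a) (Zk (⊝ c))
    gen-⊝ a c = trans
      (gen-indicator _ _ (⊝ a FinP.≟ c) (cong Zk) (λ { refl → refl }))
      (sym (gen-indicator _ _ (⊝ a FinP.≟ c)
        (λ e → cong Zk (trans (sym (⊝-involutive a)) (cong ⊝_ e)))
        (λ e → trans (cong ⊝_ (Zk-injective e)) (⊝-involutive c))))
      where
      Zk-injective : ∀ {a b} → Zk a ≡ Zk b → a ≡ b
      Zk-injective refl = refl

  evenS-avoids : ∀ v i g → (∀ c → Zk c ≢ g) → evenS v i g ≡ 0ℚ
  evenS-avoids (x , y) i g g≢ = cong₂ _+_ (gen-≢ (g≢ (x ⊕ y))) (*-zeroʳ′ (sign k) (gen-≢ (g≢ (⊝ (x ⊕ y)))))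

  bigSum-genS-avoids : ∀ f g → (∀ c → Zk c ≢ g) → bigSum genS f g ≡ 0ℚ
  bigSum-genS-avoids f g g≢ = bigSum-zero (coefficient-linear g) genS f (λ (x , y) i → gen-≢ (g≢ (x ⊕ y)))

  bigSum-genZ-avoids : ∀ f g → (∀ r s x y → Zg r s x y ≢ g) → bigSum genZ f g ≡ 0ℚ
  bigSum-genZ-avoids f g g≢ = bigSum-zero (coefficient-linear g) genZ f (λ (x , y) i → gen-≢ (g≢ _ _ x y))

  bigSum-evenP-avoids : ∀ f g → (∀ r s x y → Pg r s x y ≢ g) → bigSum evenP f g ≡ 0ℚ
  bigSum-evenP-avoids f g g≢ = bigSum-zero (coefficient-linear g) evenP f (λ v i → evenP-avoids v i g g≢)

  sign-k : sign k ≡ sign w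
  sign-k = trans (sign-+ w 2) (ℚP.*-identityʳ (sign w))

  bigSum-genS-even : ∀ f → (f ‖ JM) ≈M f → bigSum genS f ≈F (½ • bigSum evenS f)
  bigSum-genS-even f f‖J≈f = Supported-≈F
    (Supported-bigSum genS f (λ (x , y) i _ → Supported-gen (Zk (x ⊕ y)) tt))
    (Supported-scale ½ (Supported-bigSum evenS f (λ (x , y) i _ →
      Supported-plus (Supported-gen (Zk (x ⊕ y)) tt) (Supported-scale (sign k) (Supported-gen (Zk (⊝ (x ⊕ y))) tt)))))
    (λ x y _ m → both-vanish m (Zg (suc (toℕ m)) (suc (w ℕ.∸ toℕ m)) x y) (λ _ → λ ()))
    (λ x y _ m → both-vanish m (Pg (suc (toℕ m)) (suc (w ℕ.∸ toℕ m)) x y) (λ _ → λ ()))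
    (λ c → sym (begin
      ½ * bigSum evenS f (Zk c)
        ≡⟨ cong (½ *_) (bigSum-equal (coefficient-linear (Zk c))
             (plus-linear (coefficient-linear (Zk c)) (scaled-coefficient-linear (Zk (⊝ c)) (sign k))) {evenS} {genS} f
             (λ (x , y) i _ → cong (gen (Zk (x ⊕ y)) (Zk c) +_)
               (trans (ℚP.*-comm (sign k) _) (cong (_* sign k) (gen-⊝ (x ⊕ y) c))))) ⟩
      ½ * (bigSum genS f (Zk c) + bigSum genS f (Zk (⊝ c)) * sign k)
        ≡⟨ cong₂ (λ s t → ½ * (bigSum genS f (Zk c) + s * t)) (bigSum-genS-neg f f‖J≈f c) sign-k ⟩
      ½ * (bigSum genS f (Zk c) + sign w * bigSum genS f (Zk c) * sign w)
        ≡⟨ solve 2 (λ b s → con ½ :* (b :+ s :* b :* s) := con ½ :* (b :+ s :* s :* b)) refl (bigSum genS f (Zk c)) (sign w) ⟩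
      ½ * (bigSum genS f (Zk c) + sign w * sign w * bigSum genS f (Zk c))
        ≡⟨ cong (λ t → ½ * (bigSum genS f (Zk c) + t * bigSum genS f (Zk c))) (sign² w) ⟩
      ½ * (bigSum genS f (Zk c) + 1ℚ * bigSum genS f (Zk c))
        ≡⟨ solve 1 (λ b → con ½ :* (b :+ con 1ℚ :* b) := b) refl (bigSum genS f (Zk c)) ⟩
      bigSum genS f (Zk c) ∎))
    where
    open ≡-Reasoning
    both-vanish : ∀ m g → (∀ c → Zk c ≢ g) → bigSum genS f g * 1/fac m ≡ ½ * bigSum evenS f g * 1/fac m
    both-vanish m g g≢ = cong (_* 1/fac m) (trans (bigSum-genS-avoids f g g≢)
      (sym (*-zeroʳ′ ½ (bigSum-zero (coefficient-linear g) evenS f (λ v i → evenS-avoids v i g g≢)))))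

  Pev-bigSum-evenP : ∀ f → InSpan ValidPev pevVec (bigSum evenP f)
  Pev-bigSum-evenP f = bigSum-relation InSpan-linear {evenP} {evenP} f (λ (x , y) i isA →
    InSpan-vec {i = pIdx (suc (toℕ i) , suc (w ℕ.∸ toℕ i) , x , y)} (ValidIdx-monomial i x y isA))

  Pev-bigSum-genS : ∀ f → (f ‖ JM) ≈M f → InSpan ValidPev pevVec (bigSum genS f)
  Pev-bigSum-genS f f‖J≈f = InSpan-≈F (bigSum-genS-even f f‖J≈f)
    (InSpan-• ½ (bigSum-relation InSpan-linear {evenS} {evenS} f (λ (x , y) i _ → InSpan-vec {i = zIdx (x ⊕ y)} tt)))

-- Consequences of the relations of the modular group.

module GroupAlgebra (N : ℕ) .{{_ : NonZero N}} (w : ℕ) where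
  open Setup N w
  open Polynomials N w
  open Residues N w
  open Action N w
  open Relations N w
  open Coordinates N w

  U² : M2
  U² = UM ⊗ UM

  ≈M-trans : ∀ {f g h} → f ≈M g → g ≈M h → f ≈M h
  ≈M-trans p q x y isA m = trans (p x y isA m) (q x y isA m)

  ≈M-sym : ∀ {f g} → f ≈M g → g ≈M f
  ≈M-sym p x y isA m = sym (p x y isA m)

  ‖-⊗≈ : ∀ f γ γ′ → (f ‖ γ ‖ γ′) ≈M (f ‖ (γ ⊗ γ′))
  ‖-⊗≈ f γ γ′ x y _ m = ‖-⊗ f γ γ′ x y m

  -- Applied to factorizations whose first factor has a known effect on f. For explicit matrices
  -- such factorizations hold by computation and need no proof where they are used.
  absorb : ∀ γ γ′ → Unimodular γ′ → ∀ {f g} → (f ‖ γ) ≈M g → (f ‖ (γ ⊗ γ′)) ≈M (g ‖ γ′)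
  absorb γ γ′ unit {f} {g} h = ≈M-trans {f ‖ (γ ⊗ γ′)} {f ‖ γ ‖ γ′} {g ‖ γ′}
    (≈M-sym {f ‖ γ ‖ γ′} {f ‖ (γ ⊗ γ′)} (‖-⊗≈ f γ γ′)) (‖-cong γ′ unit h)

  ‖-identity : ∀ f x y m → (f ‖ mat (ℤ.+ 1) (ℤ.+ 0) (ℤ.+ 0) (ℤ.+ 1)) x y m ≡ f x y m
  ‖-identity f x y m = trans (trans (‖-def f I x y m) (actV-identity (at f ((x , y) ⊙ I)) m)) (at-≡ f (⊙-identity (x , y)) m)
    where
    I : M2
    I = mat (ℤ.+ 1) (ℤ.+ 0) (ℤ.+ 0) (ℤ.+ 1)
    actV-identity : ∀ p i → actV I p i ≡ p i
    actV-identity p = actV-unique I p p (λ X Y → cong₂ (ev p)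
      (solve 2 (λ X Y → X := con 1ℚ :* X :+ con 0ℚ :* Y) refl X Y)
      (solve 2 (λ X Y → Y := con 0ℚ :* X :+ con 1ℚ :* Y) refl X Y))

  -- The conditions defining W⁺, for the map P ∘S.
  record InW′ (Φ : Map) : Set where
    field
      Φ‖J : (Φ ‖ JM) ≈M Φ
      Φ‖S : (Φ +M (Φ ‖ SM)) ≈M 0M
      Φ‖U : ((Φ +M (Φ ‖ UM)) +M (Φ ‖ U²)) ≈M 0M
      Φ‖ε : (Φ ‖ εM) ≈M Φ

  -- Identities for Q = P|U.

  module PeriodPolynomial {Φ : Map} (Φ∈W : InW′ Φ) where
    open InW′ Φ∈W

    Q Q⁺ Q⁻ : Map
    Q  = Φ ‖ UM
    Q⁺ = ½ *M (Q +M (Q ‖ εM))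
    Q⁻ = ½ *M (Q -M (Q ‖ εM))

    private
      Φ‖S′ : (Φ ‖ SM) ≈M ((- 1ℚ) *M Φ)
      Φ‖S′ x y isA m = begin
        s                ≡⟨ solve 2 (λ a s → s := a :+ s :+ con (- 1ℚ) :* a) refl a s ⟩
        a + s + - 1ℚ * a ≡⟨ cong (_+ - 1ℚ * a) (Φ‖S x y isA m) ⟩
        0ℚ + - 1ℚ * a    ≡⟨ ℚP.+-identityˡ (- 1ℚ * a) ⟩
        - 1ℚ * a         ∎
        where
        open ≡-Reasoning
        a = Φ x y m
        s = (Φ ‖ SM) x y m

      ‖-S⊗ : ∀ γ → Unimodular γ → ∀ x y → IsA x y → ∀ m → (Φ ‖ (SM ⊗ γ)) x y m ≡ - (Φ ‖ γ) x y m
      ‖-S⊗ γ unit x y isA m = trans (absorb SM γ unit {Φ} {(- 1ℚ) *M Φ} Φ‖S′ x y isA m) (trans (‖-* (- 1ℚ) Φ γ x y m)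
        (solve 1 (λ a → con (- 1ℚ) :* a := :- a) refl ((Φ ‖ γ) x y m)))

    module _ (x y : Fin N) (isA : IsA x y) (m : Fin (suc w)) where
      private
        a b c d e : ℚ
        a = Φ x y m
        b = Q x y m
        c = (Φ ‖ U²) x y m
        d = (Φ ‖ (UM ⊗ SM)) x y m
        e = (Φ ‖ (U² ⊗ SM)) x y m

      sum-U : a + b + c ≡ 0ℚ
      sum-U = Φ‖U x y isA m

      -- The three-term relation acted on by S, in which Φ|S = -Φ.
      sum-US : d + e ≡ a
      sum-US = begin
        d + e             ≡⟨ solve 3 (λ a d e → d :+ e := a :+ (:- a :+ d :+ e)) refl a d e ⟩
        a + (- a + d + e) ≡⟨ cong (a +_) -a+d+e≡0 ⟩
        a + 0ℚ            ≡⟨ ℚP.+-identityʳ a ⟩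
        a                 ∎
        where
        open ≡-Reasoning
        -a+d+e≡0 : - a + d + e ≡ 0ℚ
        -a+d+e≡0 = begin
          - a + d + e
            ≡⟨ cong₂ _+_ (cong₂ _+_ (trans (solve 1 (λ a → :- a := con (- 1ℚ) :* a) refl a) (sym (Φ‖S′ x y isA m)))
                                    (sym (‖-⊗ Φ UM SM x y m)))
                         (sym (‖-⊗ Φ U² SM x y m)) ⟩
          (Φ ‖ SM) x y m + (Φ ‖ UM ‖ SM) x y m + (Φ ‖ U² ‖ SM) x y m
            ≡⟨ cong (_+ (Φ ‖ U² ‖ SM) x y m) (‖-+ Φ (Φ ‖ UM) SM x y m) ⟨
          ((Φ +M (Φ ‖ UM)) ‖ SM) x y m + (Φ ‖ U² ‖ SM) x y m
            ≡⟨ ‖-+ (Φ +M (Φ ‖ UM)) (Φ ‖ U²) SM x y m ⟨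
          (((Φ +M (Φ ‖ UM)) +M (Φ ‖ U²)) ‖ SM) x y m
            -- Zero is written as a multiple of Φ so that `‖-*` evaluates its image under S.
            ≡⟨ ‖-cong SM refl {(Φ +M (Φ ‖ UM)) +M (Φ ‖ U²)} {0ℚ *M Φ} (λ x y isA m → trans (Φ‖U x y isA m) (sym (ℚP.*-zeroˡ (Φ x y m)))) x y isA m ⟩
          ((0ℚ *M Φ) ‖ SM) x y m
            ≡⟨ trans (‖-* 0ℚ Φ SM x y m) (ℚP.*-zeroˡ ((Φ ‖ SM) x y m)) ⟩
          0ℚ ∎

      -- Uε = ε(S(U²S))
      Q‖ε≡ : (Q ‖ εM) x y m ≡ - e
      Q‖ε≡ = trans (‖-⊗ Φ UM εM x y m) (trans
        (absorb εM (SM ⊗ (U² ⊗ SM)) refl {Φ} {Φ} Φ‖ε x y isA m)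
        (‖-S⊗ (U² ⊗ SM) refl x y isA m))

      -- Uδ = ε(S(JU²))
      Q‖δ≡ : (Q ‖ δM) x y m ≡ - c
      Q‖δ≡ = trans (‖-⊗ Φ UM δM x y m) (trans
        (absorb εM (SM ⊗ (JM ⊗ U²)) refl {Φ} {Φ} Φ‖ε x y isA m)
        (trans (‖-S⊗ (JM ⊗ U²) refl x y isA m) (cong -_ (absorb JM U² refl {Φ} {Φ} Φ‖J x y isA m))))

      -- UT = J(U²S)
      Q‖T≡ : (Q ‖ TM) x y m ≡ e
      Q‖T≡ = trans (‖-⊗ Φ UM TM x y m) (absorb JM (U² ⊗ SM) refl {Φ} {Φ} Φ‖J x y isA m)

      -- UδT = ε
      Q‖δT≡ : (Q ‖ δM ‖ TM) x y m ≡ a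
      Q‖δT≡ = trans (‖-⊗ (Φ ‖ UM) δM TM x y m) (trans (‖-⊗ Φ UM (δM ⊗ TM) x y m) (Φ‖ε x y isA m))

      -- Uεδ = US
      Q‖εδ≡ : (Q ‖ εM ‖ δM) x y m ≡ d
      Q‖εδ≡ = trans (‖-⊗ (Φ ‖ UM) εM δM x y m) (‖-⊗ Φ UM (εM ⊗ δM) x y m)

      -- The sides are -(c+d)/2 and (b+e)/2. They agree since (a+b+c) + (d+e-a) = 0.
      Q⁻‖δ≡ : (Q⁻ ‖ δM) x y m ≡ Q⁻ x y m
      Q⁻‖δ≡ = begin
        (Q⁻ ‖ δM) x y m
          ≡⟨ trans (‖-* ½ (Q -M (Q ‖ εM)) δM x y m) (cong (½ *_) (‖-- Q (Q ‖ εM) δM x y m)) ⟩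
        ½ * ((Q ‖ δM) x y m - (Q ‖ εM ‖ δM) x y m)
          ≡⟨ cong₂ (λ s t → ½ * (s - t)) Q‖δ≡ Q‖εδ≡ ⟩
        ½ * (- c - d)
          ≡⟨ solve 5 (λ a b c d e → con ½ :* (:- c :- d) := con ½ :* (b :- :- e) :- con ½ :* (a :+ b :+ c) :- con ½ :* (d :+ e :- a)) refl a b c d e ⟩
        ½ * (b - - e) - ½ * (a + b + c) - ½ * (d + e - a)
          ≡⟨ cong₂ (λ s t → ½ * (b - - e) - ½ * s - ½ * (t - a)) sum-U sum-US ⟩
        ½ * (b - - e) - ½ * 0ℚ - ½ * (a - a)
          ≡⟨ solve 3 (λ a b e → con ½ :* (b :- :- e) :- con ½ :* con 0ℚ :- con ½ :* (a :- a) := con ½ :* (b :- :- e)) refl a b e ⟩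
        ½ * (b - - e)
          ≡⟨ cong (λ t → ½ * (b - t)) Q‖ε≡ ⟨
        Q⁻ x y m ∎
        where open ≡-Reasoning

      -- Both sides equal 2b - e: the left is b - c - e - a with a + b + c = 0, and the right uses
      -- Q|ε = -e.
      relations-Q : - Z₁ Q x y m + Z₂ Q x y m ≡ 3ℚ * Q⁺ x y m + Q⁻ x y m
      relations-Q = begin
        - Z₁ Q x y m + Z₂ Q x y m
          ≡⟨ cong₂ (λ s t → - s + (b + t)) (cong₂ _+_ Q‖T≡ Q‖δT≡) Q‖δ≡ ⟩
        - (e + a) + (b + - c)
          ≡⟨ solve 4 (λ a b c e → :- (e :+ a) :+ (b :+ :- c) := con 3ℚ :* (con ½ :* (b :+ :- e)) :+ con ½ :* (b :- :- e) :- (a :+ b :+ c)) refl a b c e ⟩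
        3ℚ * (½ * (b + - e)) + ½ * (b - - e) - (a + b + c)
          ≡⟨ cong₂ (λ s t → 3ℚ * (½ * (b + s)) + ½ * (b - s) - t) (sym Q‖ε≡) sum-U ⟩
        3ℚ * Q⁺ x y m + Q⁻ x y m - 0ℚ
          ≡⟨ solve 1 (λ a → a :- con 0ℚ := a) refl (3ℚ * Q⁺ x y m + Q⁻ x y m) ⟩
        3ℚ * Q⁺ x y m + Q⁻ x y m ∎
        where open ≡-Reasoning

    Q‖J : (Q ‖ JM) ≈M Q
    Q‖J = ≈M-trans {Q ‖ JM} {Φ ‖ (UM ⊗ JM)} {Q} (‖-⊗≈ Φ UM JM) (absorb JM UM refl {Φ} {Φ} Φ‖J)

    Q⁻‖J : (Q⁻ ‖ JM) ≈M Q⁻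
    Q⁻‖J x y isA m = trans (‖-* ½ (Q -M (Q ‖ εM)) JM x y m) (cong (½ *_) (trans (‖-- Q (Q ‖ εM) JM x y m)
      (cong₂ _-_ (Q‖J x y isA m) (trans (‖-⊗ Q εM JM x y m) (absorb JM εM refl {Q} {Q} Q‖J x y isA m)))))

    Q⁻‖ε : (Q⁻ ‖ εM) ≈M ((- 1ℚ) *M Q⁻)
    Q⁻‖ε x y isA m = begin
      (Q⁻ ‖ εM) x y m
        ≡⟨ trans (‖-* ½ (Q -M (Q ‖ εM)) εM x y m) (cong (½ *_) (‖-- Q (Q ‖ εM) εM x y m)) ⟩
      ½ * ((Q ‖ εM) x y m - (Q ‖ εM ‖ εM) x y m)
        ≡⟨ cong (λ t → ½ * ((Q ‖ εM) x y m - t)) (trans (‖-⊗ Q εM εM x y m) (‖-identity Q x y m)) ⟩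
      ½ * ((Q ‖ εM) x y m - Q x y m)
        ≡⟨ solve 2 (λ b c → con ½ :* (c :- b) := con (- 1ℚ) :* (con ½ :* (b :- c))) refl (Q x y m) ((Q ‖ εM) x y m) ⟩
      - 1ℚ * Q⁻ x y m ∎
      where open ≡-Reasoning

    -- All four terms agree: J acts trivially on Q⁻, and since ε′ = Jε both ε and ε′ act as -1.
    even-Q⁻ : ∀ x y → IsA x y → ∀ m → even Q⁻ x y m ≡ ℕ→ℚ 4 * Q⁻ x y m
    even-Q⁻ x y isA m = begin
      q - (Q⁻ ‖ εM) x y m - (Q⁻ ‖ ε′M) x y m + (Q⁻ ‖ JM) x y m
        ≡⟨ cong₂ (λ s t → s - (Q⁻ ‖ ε′M) x y m + t) (cong (λ t → q - t) (Q⁻‖ε x y isA m)) (Q⁻‖J x y isA m) ⟩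
      q - - 1ℚ * q - (Q⁻ ‖ ε′M) x y m + q
        ≡⟨ cong (λ t → q - - 1ℚ * q - t + q) (trans (absorb JM εM refl {Q⁻} {Q⁻} Q⁻‖J x y isA m) (Q⁻‖ε x y isA m)) ⟩
      q - - 1ℚ * q - - 1ℚ * q + q
        ≡⟨ solve 1 (λ q → q :- con (- 1ℚ) :* q :- con (- 1ℚ) :* q :+ q := con (ℕ→ℚ 4) :* q) refl q ⟩
      ℕ→ℚ 4 * q ∎
      where
      open ≡-Reasoning
      q = Q⁻ x y m

  -- Recovering an element of W⁺ from ψ and E.

  module Reconstruction {ψ E g : Map} (ψ‖J : (ψ ‖ JM) ≈M ψ) (ψ‖δ : (ψ ‖ δM) ≈M ψ) (E‖δ : (E ‖ δM) ≈M E)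
                        (E‖ε : (E ‖ εM) ≈M ((- 1ℚ) *M E)) (g‖ε : (g ‖ εM) ≈M g)
                        (g≈ : g ≈M (((ψ ‖ TM) -M ψ) +M E)) where

    -- The difference makes the three-term relation automatic: U³ = J fixes ψ, so Φ|(1+U+U²)
    -- telescopes to zero.
    Φ : Map
    Φ = (ψ ‖ UM) -M (ψ ‖ U²)

    private
      Jδ⊗ : ∀ γ → Unimodular γ → (ψ ‖ (JM ⊗ (δM ⊗ γ))) ≈M (ψ ‖ γ)
      Jδ⊗ γ unit = ≈M-trans {ψ ‖ (JM ⊗ (δM ⊗ γ))} {ψ ‖ δM ‖ γ} {ψ ‖ γ}
        (λ x y isA m → trans (cong-assoc x y m) (absorb (JM ⊗ δM) γ unit {ψ} {ψ ‖ δM} (absorb JM δM refl {ψ} {ψ} ψ‖J) x y isA m))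
        (‖-cong γ unit ψ‖δ)
        where
        -- For a variable γ the two bracketings do not agree by computation; they are compared
        -- through the action instead.
        cong-assoc : ∀ x y m → (ψ ‖ (JM ⊗ (δM ⊗ γ))) x y m ≡ (ψ ‖ (JM ⊗ δM ⊗ γ)) x y m
        cong-assoc x y m = trans (sym (‖-⊗ ψ JM (δM ⊗ γ) x y m)) (trans (sym (‖-⊗ (ψ ‖ JM) δM γ x y m))
          (trans (‖-ext γ (‖-⊗ ψ JM δM) x y m) (‖-⊗ ψ (JM ⊗ δM) γ x y m)))

      δ⊗ : ∀ γ → Unimodular γ → (ψ ‖ (δM ⊗ γ)) ≈M (ψ ‖ γ)
      δ⊗ γ unit = absorb δM γ unit {ψ} {ψ} ψ‖δ

    module _ (x y : Fin N) (isA : IsA x y) (m : Fin (suc w)) where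
      private
        p₀ p χ χδ u₁ u₂ e₀ : ℚ
        p₀ = ψ x y m
        p = (ψ ‖ εM) x y m
        χ = (ψ ‖ (UM ⊗ SM)) x y m
        χδ = (ψ ‖ (U² ⊗ SM)) x y m
        u₁ = (ψ ‖ UM) x y m
        u₂ = (ψ ‖ U²) x y m
        e₀ = E x y m

      -- T = J(US), Tε = J(δU²), Tδ = J(δ(U²S)), Tεδ = U and εδ = J(δε).
      ψ‖T≡ : (ψ ‖ TM) x y m ≡ χ
      ψ‖T≡ = absorb JM (UM ⊗ SM) refl {ψ} {ψ} ψ‖J x y isA m

      ψ‖Tε≡ : (ψ ‖ TM ‖ εM) x y m ≡ u₂
      ψ‖Tε≡ = trans (‖-⊗ ψ TM εM x y m) (Jδ⊗ U² refl x y isA m)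

      ψ‖Tδ≡ : (ψ ‖ TM ‖ δM) x y m ≡ χδ
      ψ‖Tδ≡ = trans (‖-⊗ ψ TM δM x y m) (Jδ⊗ (U² ⊗ SM) refl x y isA m)

      ψ‖Tεδ≡ : (ψ ‖ TM ‖ εM ‖ δM) x y m ≡ u₁
      ψ‖Tεδ≡ = trans (‖-⊗ (ψ ‖ TM) εM δM x y m) (‖-⊗ ψ TM (εM ⊗ δM) x y m)

      ψ‖εδ≡ : (ψ ‖ εM ‖ δM) x y m ≡ p
      ψ‖εδ≡ = trans (‖-⊗ ψ εM δM x y m) (Jδ⊗ εM refl x y isA m)

      g≡ : g x y m ≡ χ - p₀ + e₀
      g≡ = trans (g≈ x y isA m) (cong (λ t → t - p₀ + e₀) ψ‖T≡)

      g≡′ : g x y m ≡ u₂ - p - e₀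
      g≡′ = begin
        g x y m
          ≡⟨ g‖ε x y isA m ⟨
        (g ‖ εM) x y m
          ≡⟨ ‖-cong εM refl {g} {((ψ ‖ TM) -M ψ) +M E} g≈ x y isA m ⟩
        ((((ψ ‖ TM) -M ψ) +M E) ‖ εM) x y m
          ≡⟨ trans (‖-+ ((ψ ‖ TM) -M ψ) E εM x y m) (cong (_+ (E ‖ εM) x y m) (‖-- (ψ ‖ TM) ψ εM x y m)) ⟩
        (ψ ‖ TM ‖ εM) x y m - p + (E ‖ εM) x y m
          ≡⟨ cong₂ (λ s t → s - p + t) ψ‖Tε≡ (E‖ε x y isA m) ⟩
        u₂ - p + - 1ℚ * e₀
          ≡⟨ solve 3 (λ u p e → u :- p :+ con (- 1ℚ) :* e := u :- p :- e) refl u₂ p e₀ ⟩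
        u₂ - p - e₀ ∎
        where open ≡-Reasoning

      -- Equates the expression for g with the one for g|ε. E enters them with opposite signs, being
      -- odd for ε, and so appears doubled.
      difference : χ - u₂ ≡ p₀ - p - 2ℚ * e₀
      difference = begin
        χ - u₂
          ≡⟨ solve 5 (λ χ u p₀ p e → χ :- u := (χ :- p₀ :+ e) :- (u :- p :- e) :+ (p₀ :- p :- con 2ℚ :* e)) refl χ u₂ p₀ p e₀ ⟩
        χ - p₀ + e₀ - (u₂ - p - e₀) + (p₀ - p - 2ℚ * e₀)
          ≡⟨ cong₂ (λ s t → s - t + (p₀ - p - 2ℚ * e₀)) (sym g≡) (sym g≡′) ⟩
        g x y m - g x y m + (p₀ - p - 2ℚ * e₀)
          ≡⟨ solve 2 (λ g r → g :- g :+ r := r) refl (g x y m) (p₀ - p - 2ℚ * e₀) ⟩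
        p₀ - p - 2ℚ * e₀ ∎
        where open ≡-Reasoning

    -- A new module with fresh x and y: applying δ to `difference` requires it at all rows of A(N),
    -- not only at the current one.
    module _ (x y : Fin N) (isA : IsA x y) (m : Fin (suc w)) where
      private
        p₀ p χ χδ u₁ u₂ e₀ : ℚ
        p₀ = ψ x y m
        p = (ψ ‖ εM) x y m
        χ = (ψ ‖ (UM ⊗ SM)) x y m
        χδ = (ψ ‖ (U² ⊗ SM)) x y m
        u₁ = (ψ ‖ UM) x y m
        u₂ = (ψ ‖ U²) x y m
        e₀ = E x y m

      -- In `difference` the right side is fixed by δ, hence so is the left.
      δ-invariance : χ - u₂ ≡ χδ - u₁
      δ-invariance = begin
        χ - u₂
          ≡⟨ difference x y isA m ⟩
        p₀ - p - 2ℚ * e₀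
          ≡⟨ cong₂ (λ s t → s - t - 2ℚ * e₀) (sym (ψ‖δ x y isA m)) (sym (ψ‖εδ≡ x y isA m)) ⟩
        (ψ ‖ δM) x y m - (ψ ‖ εM ‖ δM) x y m - 2ℚ * e₀
          ≡⟨ cong₂ (λ s t → s - 2ℚ * t) (sym (‖-- ψ (ψ ‖ εM) δM x y m)) (sym (E‖δ x y isA m)) ⟩
        ((ψ -M (ψ ‖ εM)) ‖ δM) x y m - 2ℚ * (E ‖ δM) x y m
          ≡⟨ trans (cong (λ t → ((ψ -M (ψ ‖ εM)) ‖ δM) x y m - t) (sym (‖-* 2ℚ E δM x y m)))
                   (sym (‖-- (ψ -M (ψ ‖ εM)) (2ℚ *M E) δM x y m)) ⟩
        (((ψ -M (ψ ‖ εM)) -M (2ℚ *M E)) ‖ δM) x y m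
          ≡⟨ ‖-cong δM refl {(ψ -M (ψ ‖ εM)) -M (2ℚ *M E)} {(ψ ‖ TM) -M (ψ ‖ TM ‖ εM)} (λ x y isA m →
               trans (sym (difference x y isA m)) (cong₂ _-_ (sym (ψ‖T≡ x y isA m)) (sym (ψ‖Tε≡ x y isA m)))) x y isA m ⟩
        (((ψ ‖ TM) -M (ψ ‖ TM ‖ εM)) ‖ δM) x y m
          ≡⟨ ‖-- (ψ ‖ TM) (ψ ‖ TM ‖ εM) δM x y m ⟩
        (ψ ‖ TM ‖ δM) x y m - (ψ ‖ TM ‖ εM ‖ δM) x y m
          ≡⟨ cong₂ _-_ (ψ‖Tδ≡ x y isA m) (ψ‖Tεδ≡ x y isA m) ⟩
        χδ - u₁ ∎
        where open ≡-Reasoning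

      private
        use-invariance : ∀ r t → r ≡ t + (χ - u₂ - (χδ - u₁)) → r ≡ t
        use-invariance r t e = trans e (trans (cong (λ s → t + (s - (χδ - u₁))) δ-invariance)
          (solve 2 (λ t s → t :+ (s :- s) := t) refl t (χδ - u₁)))

        use-invariance⁻ : ∀ r t → r ≡ t - (χ - u₂ - (χδ - u₁)) → r ≡ t
        use-invariance⁻ r t e = trans e (trans (cong (λ s → t - (s - (χδ - u₁))) δ-invariance)
          (solve 2 (λ t s → t :- (s :- s) := t) refl t (χδ - u₁)))

      Φ‖γ≡ : ∀ γ → (Φ ‖ γ) x y m ≡ (ψ ‖ (UM ⊗ γ)) x y m - (ψ ‖ (U² ⊗ γ)) x y m
      Φ‖γ≡ γ = trans (‖-- (ψ ‖ UM) (ψ ‖ U²) γ x y m) (cong₂ _-_ (‖-⊗ ψ UM γ x y m) (‖-⊗ ψ U² γ x y m))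

      Φ‖J≡ : (Φ ‖ JM) x y m ≡ Φ x y m
      Φ‖J≡ = trans (Φ‖γ≡ JM) (cong₂ _-_ (absorb JM UM refl {ψ} {ψ} ψ‖J x y isA m) (absorb JM U² refl {ψ} {ψ} ψ‖J x y isA m))

      -- The sum Φ + Φ|S is u₁ - u₂ + χ - χδ, exactly the difference of the two sides of
      -- `δ-invariance`.
      Φ‖S≡ : Φ x y m + (Φ ‖ SM) x y m ≡ 0ℚ
      Φ‖S≡ = trans (cong (Φ x y m +_) (Φ‖γ≡ SM)) (use-invariance (u₁ - u₂ + (χ - χδ)) 0ℚ
        (solve 4 (λ u₁ u₂ χ χδ → u₁ :- u₂ :+ (χ :- χδ) := con 0ℚ :+ (χ :- u₂ :- (χδ :- u₁))) refl u₁ u₂ χ χδ))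

      Φ‖U≡ : (Φ ‖ UM) x y m ≡ u₂ - p₀
      Φ‖U≡ = trans (Φ‖γ≡ UM) (cong (λ t → u₂ - t) (ψ‖J x y isA m))

      Φ‖U²≡ : (Φ ‖ U²) x y m ≡ p₀ - u₁
      Φ‖U²≡ = trans (Φ‖γ≡ U²) (cong₂ _-_ (ψ‖J x y isA m) (absorb JM UM refl {ψ} {ψ} ψ‖J x y isA m))

      -- Uε = δ(U²S) and U²ε = δ(US), so Φ|ε is χδ - χ. By `δ-invariance` this is u₁ - u₂.
      Φ‖ε≡ : (Φ ‖ εM) x y m ≡ Φ x y m
      Φ‖ε≡ = trans (Φ‖γ≡ εM) (trans
        (cong₂ _-_ (δ⊗ (U² ⊗ SM) refl x y isA m) (δ⊗ (UM ⊗ SM) refl x y isA m))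
        (use-invariance⁻ (χδ - χ) (u₁ - u₂)
          (solve 4 (λ u₁ u₂ χ χδ → χδ :- χ := u₁ :- u₂ :- (χ :- u₂ :- (χδ :- u₁))) refl u₁ u₂ χ χδ)))

      -- U²ε = δ(US) and U³ε = Jε.
      Φ‖Uε≡ : (Φ ‖ UM ‖ εM) x y m ≡ χ - p
      Φ‖Uε≡ = trans (‖-⊗ Φ UM εM x y m) (trans (Φ‖γ≡ (UM ⊗ εM)) (cong₂ _-_
        (δ⊗ (UM ⊗ SM) refl x y isA m) (absorb JM εM refl {ψ} {ψ} ψ‖J x y isA m)))

      -- In the sum of the two expressions for g the map E cancels.
      g≡½ : g x y m ≡ ½ * ((Φ ‖ UM) x y m + (Φ ‖ UM ‖ εM) x y m)
      g≡½ = begin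
        g x y m
          ≡⟨ solve 1 (λ g → g := con ½ :* (g :+ g)) refl (g x y m) ⟩
        ½ * (g x y m + g x y m)
          ≡⟨ cong₂ (λ s t → ½ * (s + t)) (g≡ x y isA m) (g≡′ x y isA m) ⟩
        ½ * (χ - p₀ + e₀ + (u₂ - p - e₀))
          ≡⟨ solve 5 (λ χ p₀ e u p → con ½ :* (χ :- p₀ :+ e :+ (u :- p :- e)) := con ½ :* (u :- p₀ :+ (χ :- p))) refl χ p₀ e₀ u₂ p ⟩
        ½ * (u₂ - p₀ + (χ - p))
          ≡⟨ cong₂ (λ s t → ½ * (s + t)) Φ‖U≡ Φ‖Uε≡ ⟨
        ½ * ((Φ ‖ UM) x y m + (Φ ‖ UM ‖ εM) x y m) ∎
        where open ≡-Reasoning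

    Φ∈W : InW′ Φ
    Φ∈W = record
      { Φ‖J = Φ‖J≡
      ; Φ‖S = Φ‖S≡
      ; Φ‖U = λ x y isA m → trans (cong₂ (λ s t → Φ x y m + s + t) (Φ‖U≡ x y isA m) (Φ‖U²≡ x y isA m))
          (solve 3 (λ a b c → a :- b :+ (b :- c) :+ (c :- a) := con 0ℚ) refl ((ψ ‖ UM) x y m) ((ψ ‖ U²) x y m) (ψ x y m))
      ; Φ‖ε = Φ‖ε≡
      }

-- The direct statement.

module Direct (N : ℕ) .{{_ : NonZero N}} (w : ℕ) where
  open Setup N w
  open Action N w
  open FreeSpace N w
  open Relations N w
  open Spans N w
  open Coordinates N w
  open GroupAlgebra N w

  ∣-transfer : ∀ {P f} γ → (∀ x y m → (P ∘S) x y m ≡ f x y m) → ∀ x y m → ((P ∣ γ) ∘S) x y m ≡ (f ‖ γ) x y m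
  ∣-transfer {P} γ h x y m = trans (∘S-∣ P γ x y m) (‖-ext γ h x y m)

  ε-transfer : ∀ {P f} → (∀ x y m → (P ∘S) x y m ≡ f x y m) → ∀ x y m → ((P ∣ε) ∘S) x y m ≡ (f ‖ εM) x y m
  ε-transfer {P} h x y m = trans (∘S-∣ε P x y m) (‖-ext εM h x y m)

  ≈M-transfer : ∀ {P Q f g} → (∀ x y m → (P ∘S) x y m ≡ f x y m) → (∀ x y m → (Q ∘S) x y m ≡ g x y m) → f ≈M g → P ≈M Q
  ≈M-transfer {P} {Q} h h′ f≈g = ∘S-injective {P} {Q} (λ x y isA m → trans (h x y m) (trans (f≈g x y isA m) (sym (h′ x y m))))

  InW⁺⇒InW′ : ∀ {P} → InW⁺ P → InW′ (P ∘S)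
  InW⁺⇒InW′ {P} (P∣J , P∣S , P∣U , P∣ε) = record
    { Φ‖J = λ x y isA m → trans (sym (∘S-∣ P JM x y m)) (∘S-cong {P ∣ JM} {P} P∣J x y isA m)
    ; Φ‖S = λ x y isA m → trans (cong ((P ∘S) x y m +_) (sym (∘S-∣ P SM x y m)))
                                (∘S-cong {P +M (P ∣ SM)} {0M} P∣S x y isA m)
    ; Φ‖U = λ x y isA m → trans (cong₂ (λ s t → (P ∘S) x y m + s + t) (sym (∘S-∣ P UM x y m)) (sym (∘S-∣ P U² x y m)))
                                (∘S-cong {(P +M (P ∣ UM)) +M (P ∣ U²)} {0M} P∣U x y isA m)
    ; Φ‖ε = λ x y isA m → trans (sym (∘S-∣ε P x y m)) (∘S-cong {P ∣ε} {P} P∣ε x y isA m)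
    }

  InW′⇒InW⁺ : ∀ {P Φ} → (∀ x y m → (P ∘S) x y m ≡ Φ x y m) → InW′ Φ → InW⁺ P
  InW′⇒InW⁺ {P} {Φ} h Φ∈W =
      ≈M-transfer {P ∣ JM} {P} {Φ ‖ JM} {Φ} (∣-transfer {P} {Φ} JM h) h Φ‖J
    , ≈M-transfer {P +M (P ∣ SM)} {0M} {Φ +M (Φ ‖ SM)} {0M}
        (λ x y m → cong₂ _+_ (h x y m) (∣-transfer {P} {Φ} SM h x y m)) (λ _ _ _ → refl) Φ‖S
    , ≈M-transfer {(P +M (P ∣ UM)) +M (P ∣ U²)} {0M} {(Φ +M (Φ ‖ UM)) +M (Φ ‖ U²)} {0M}
        (λ x y m → cong₂ _+_ (cong₂ _+_ (h x y m) (∣-transfer {P} {Φ} UM h x y m)) (∣-transfer {P} {Φ} U² h x y m)) (λ _ _ _ → refl) Φ‖U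
    , ≈M-transfer {P ∣ε} {P} {Φ ‖ εM} {Φ} (ε-transfer {P} {Φ} h) h Φ‖ε
    where open InW′ Φ∈W

  module ForPeriodPolynomial {P : Map} (P∈W : InW⁺ P) where
    open PeriodPolynomial (InW⁺⇒InW′ {P} P∈W)

    QP Q⁺P Q⁻P : Map
    QP = P ∣ UM
    Q⁺P = ½ *M (QP +M (QP ∣ε))
    Q⁻P = ½ *M (QP -M (QP ∣ε))

    QP∘S : ∀ x y m → (QP ∘S) x y m ≡ Q x y m
    QP∘S = ∘S-∣ P UM

    QPε∘S : ∀ x y m → ((QP ∣ε) ∘S) x y m ≡ (Q ‖ εM) x y m
    QPε∘S = ε-transfer {QP} {Q} QP∘S

    Q⁺P∘S : ∀ x y m → (Q⁺P ∘S) x y m ≡ Q⁺ x y m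
    Q⁺P∘S x y m = cong₂ (λ s t → ½ * (s + t)) (QP∘S x y m) (QPε∘S x y m)

    Q⁻P∘S : ∀ x y m → (Q⁻P ∘S) x y m ≡ Q⁻ x y m
    Q⁻P∘S x y m = cong₂ (λ s t → ½ * (s - t)) (QP∘S x y m) (QPε∘S x y m)

    Q⁻P-symmetric : InVbar⁻sym Q⁻P
    Q⁻P-symmetric =
      ( ≈M-transfer {Q⁻P ∣ JM} {Q⁻P} {Q⁻ ‖ JM} {Q⁻} (∣-transfer {Q⁻P} {Q⁻} JM Q⁻P∘S) Q⁻P∘S Q⁻‖J
      , ≈M-transfer {Q⁻P ∣ε} {(- 1ℚ) *M Q⁻P} {Q⁻ ‖ εM} {(- 1ℚ) *M Q⁻} (ε-transfer {Q⁻P} {Q⁻} Q⁻P∘S)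
          (λ x y m → cong (- 1ℚ *_) (Q⁻P∘S x y m)) Q⁻‖ε )
      , ≈M-transfer {(Q⁻P ∣ε) ∣ SM} {Q⁻P} {Q⁻ ‖ δM} {Q⁻}
          (λ x y m → trans (∣-transfer {Q⁻P ∣ε} {Q⁻ ‖ εM} SM (ε-transfer {Q⁻P} {Q⁻} Q⁻P∘S) x y m) (‖-⊗ Q⁻ εM SM x y m))
          Q⁻P∘S Q⁻‖δ≡

    private
      Zc Pc : Fin N → Fin N → Fin (suc w) → Gen
      Zc x y m = Zg (suc (toℕ m)) (suc (w ℕ.∸ toℕ m)) x y
      Pc x y m = Pg (suc (toℕ m)) (suc (w ℕ.∸ toℕ m)) x y

      ρZ-Q⁺ : ∀ x y → IsA x y → ∀ m → lam Q⁺P (Zc x y m) * 1/fac m ≡ Q⁺ x y m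
      ρZ-Q⁺ x y isA m = trans (ρZ-bigSum-genZ (Q⁺P ∘S) x y isA m) (Q⁺P∘S x y m)

      ρZ-Q⁻ : ∀ x y → IsA x y → ∀ m → lam Q⁻P (Zc x y m) * 1/fac m ≡ Q⁻ x y m
      ρZ-Q⁻ x y isA m = trans (ρZ-bigSum-genZ (Q⁻P ∘S) x y isA m) (Q⁻P∘S x y m)

      lam-avoids : ∀ R g → (∀ r s x y → Zg r s x y ≢ g) → lam R g ≡ 0ℚ
      lam-avoids R = bigSum-genZ-avoids (R ∘S)

      lamS-QP : ∀ g → lamS QP g ≡ bigSum genS Q g
      lamS-QP = bigSum-cong genS {QP ∘S} {Q} (λ x y _ m → QP∘S x y m)

      Supported-lam : ∀ R → Supported (lam R)
      Supported-lam R = Supported-bigSum genZ (R ∘S) (λ (x , y) i isA → Supported-gen (Zc x y i) (ValidIdx-monomial i x y isA))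

      Supported-genS : ∀ f → Supported (bigSum genS f)
      Supported-genS f = Supported-bigSum genS f (λ (x , y) i _ → Supported-gen (Zk (x ⊕ y)) tt)

      Supported-rel : ∀ b f → Supported (bigSum (relation b) f)
      Supported-rel b f = Supported-bigSum (relation b) f (Supported-relation b)

      A B : F
      A = bigSum (relation false) Q
      B = bigSum (relation true) Q

    -- The witness is the first family of relations minus the second, both taken at Q. The
    -- P-coordinates cancel, the Z-coordinates are `relations-Q`, and the coefficients at the Z_c
    -- give λ^S(Q).
    lam-Q⁺ : (3ℚ • lam Q⁺P) ≈D ((0F -F lam Q⁻P) -F lamS QP)
    lam-Q⁺ = InSpan-≈F {u = (3ℚ • lam Q⁺P) -F ((0F -F lam Q⁻P) -F lamS QP)} {A +F ((- 1ℚ) • B)}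
      (Supported-≈F
        (Supported-minus (Supported-scale 3ℚ (Supported-lam Q⁺P))
          (Supported-minus (Supported-minus {0F} (λ _ _ → refl) (Supported-lam Q⁻P)) (Supported-genS (QP ∘S))))
        (Supported-plus (Supported-rel false Q) (Supported-scale (- 1ℚ) (Supported-rel true Q)))
        onZ onP onK)
      (InSpan-+ {u = A} {(- 1ℚ) • B} (InRel-bigSum false Q) (InSpan-• (- 1ℚ) {B} (InRel-bigSum true Q)))
      where
      open ≡-Reasoning
      onZ : ∀ x y → IsA x y → ∀ m → ρZ ((3ℚ • lam Q⁺P) -F ((0F -F lam Q⁻P) -F lamS QP)) x y m ≡ ρZ (A +F ((- 1ℚ) • B)) x y m
      onZ x y isA m = begin
        (3ℚ * a - (0ℚ - b - lamS QP h)) * φ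
          ≡⟨ cong (λ t → (3ℚ * a - (0ℚ - b - t)) * φ) (bigSum-genS-avoids (QP ∘S) h λ _ → λ ()) ⟩
        (3ℚ * a - (0ℚ - b - 0ℚ)) * φ
          ≡⟨ solve 3 (λ a b f → (con 3ℚ :* a :- (con 0ℚ :- b :- con 0ℚ)) :* f := con 3ℚ :* (a :* f) :+ b :* f) refl a b φ ⟩
        3ℚ * (a * φ) + b * φ
          ≡⟨ cong₂ (λ s t → 3ℚ * s + t) (ρZ-Q⁺ x y isA m) (ρZ-Q⁻ x y isA m) ⟩
        3ℚ * Q⁺ x y m + Q⁻ x y m
          ≡⟨ relations-Q x y isA m ⟨
        - Z₁ Q x y m + Z₂ Q x y m
          ≡⟨ solve 2 (λ a b → :- a :+ b := :- a :+ con (- 1ℚ) :* (:- b)) refl (Z₁ Q x y m) (Z₂ Q x y m) ⟩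
        - Z₁ Q x y m + - 1ℚ * (- Z₂ Q x y m)
          ≡⟨ cong₂ (λ s t → s + - 1ℚ * t) (ρZ-bigSum-relation₁ Q x y isA m) (ρZ-bigSum-relation₂ Q x y isA m) ⟨
        A h * φ + - 1ℚ * (B h * φ)
          ≡⟨ solve 3 (λ a b f → a :* f :+ con (- 1ℚ) :* (b :* f) := (a :+ con (- 1ℚ) :* b) :* f) refl (A h) (B h) φ ⟩
        (A h + - 1ℚ * B h) * φ ∎
        where
        h = Zc x y m
        φ = 1/fac m
        a = lam Q⁺P h
        b = lam Q⁻P h
      onP : ∀ x y → IsA x y → ∀ m → ρP ((3ℚ • lam Q⁺P) -F ((0F -F lam Q⁻P) -F lamS QP)) x y m ≡ ρP (A +F ((- 1ℚ) • B)) x y m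
      onP x y isA m = begin
        (3ℚ * lam Q⁺P h - (0ℚ - lam Q⁻P h - lamS QP h)) * φ
          ≡⟨ cong (_* φ) (cong₂ (λ s t → 3ℚ * s - t) (lam-avoids Q⁺P h λ _ _ _ _ → λ ())
               (cong₂ (λ s t → 0ℚ - s - t) (lam-avoids Q⁻P h λ _ _ _ _ → λ ()) (bigSum-genS-avoids (QP ∘S) h λ _ → λ ()))) ⟩
        (3ℚ * 0ℚ - (0ℚ - 0ℚ - 0ℚ)) * φ
          ≡⟨ solve 2 (λ f q → (con 3ℚ :* con 0ℚ :- (con 0ℚ :- con 0ℚ :- con 0ℚ)) :* f := q :+ con (- 1ℚ) :* q) refl φ (Q x y m) ⟩
        Q x y m + - 1ℚ * Q x y m
          ≡⟨ cong₂ (λ s t → s + - 1ℚ * t) (ρP-bigSum-relation false Q x y isA m) (ρP-bigSum-relation true Q x y isA m) ⟨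
        A h * φ + - 1ℚ * (B h * φ)
          ≡⟨ solve 3 (λ a b f → a :* f :+ con (- 1ℚ) :* (b :* f) := (a :+ con (- 1ℚ) :* b) :* f) refl (A h) (B h) φ ⟩
        (A h + - 1ℚ * B h) * φ ∎
        where
        h = Pc x y m
        φ = 1/fac m
      onK : ∀ c → 3ℚ * lam Q⁺P (Zk c) - (0ℚ - lam Q⁻P (Zk c) - lamS QP (Zk c)) ≡ A (Zk c) + - 1ℚ * B (Zk c)
      onK c = begin
        3ℚ * lam Q⁺P (Zk c) - (0ℚ - lam Q⁻P (Zk c) - lamS QP (Zk c))
          ≡⟨ cong₂ (λ s t → 3ℚ * s - t) (lam-avoids Q⁺P (Zk c) λ _ _ _ _ → λ ())
               (cong₂ (λ s t → 0ℚ - s - t) (lam-avoids Q⁻P (Zk c) λ _ _ _ _ → λ ()) (lamS-QP (Zk c))) ⟩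
        3ℚ * 0ℚ - (0ℚ - 0ℚ - bigSum genS Q (Zk c))
          ≡⟨ solve 1 (λ s → con 3ℚ :* con 0ℚ :- (con 0ℚ :- con 0ℚ :- s) := con 0ℚ :+ con (- 1ℚ) :* (:- s)) refl (bigSum genS Q (Zk c)) ⟩
        0ℚ + - 1ℚ * (- bigSum genS Q (Zk c))
          ≡⟨ cong₂ (λ s t → s + - 1ℚ * t) (bigSum-relation₁-Zk Q c) (bigSum-relation₂-Zk Q c) ⟨
        A (Zk c) + - 1ℚ * B (Zk c) ∎

    private
      -- One half because Q⁻|(1+δ) = 2Q⁻, one quarter from `even-Q⁻`, and the sign of -λ(Q⁻).
      -⅛ : ℚ
      -⅛ = (ℤ.- ℤ.+ 1) ℚ./ 8

      C X S S⁻ : F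
      C  = bigSum (relation true) Q⁻
      X  = bigSum evenP Q⁻
      S  = bigSum genS Q
      S⁻ = bigSum genS Q⁻

      v : F
      v = (-⅛ • X) +F ((½ • S⁻) +F ((- 1ℚ) • S))

      u : F
      u = (A +F ((- 1ℚ) • B)) +F (½ • C)

    -- It remains to see that λ(Q⁻) is even. As δ fixes Q⁻, half of the second family at Q⁻ replaces
    -- λ(Q⁻) by half the P-generators weighted by Q⁻ minus half of the Z_c-sum of Q⁻. The former is
    -- even because Q⁻ is a quarter of `even Q⁻`, the latter by parity.
    lam-Q⁺-even : InPev (3ℚ • lam Q⁺P)
    lam-Q⁺-even = v
      , InSpan-+ {u = -⅛ • X} {(½ • S⁻) +F ((- 1ℚ) • S)} (InSpan-• -⅛ {X} (Pev-bigSum-evenP Q⁻))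
          (InSpan-+ {u = ½ • S⁻} {(- 1ℚ) • S} (InSpan-• ½ {S⁻} (Pev-bigSum-genS Q⁻ Q⁻‖J)) (InSpan-• (- 1ℚ) {S} (Pev-bigSum-genS Q Q‖J)))
      , InSpan-≈F {u = (3ℚ • lam Q⁺P) -F v} {u}
          (Supported-≈F
            (Supported-minus (Supported-scale 3ℚ (Supported-lam Q⁺P)) (Supported-plus
              (Supported-scale -⅛ (Supported-bigSum evenP Q⁻ Supported-evenP))
              (Supported-plus (Supported-scale ½ (Supported-genS Q⁻)) (Supported-scale (- 1ℚ) (Supported-genS Q)))))
            (Supported-plus (Supported-plus (Supported-rel false Q) (Supported-scale (- 1ℚ) (Supported-rel true Q)))
              (Supported-scale ½ (Supported-rel true Q⁻)))
            onZ onP onK)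
          (InSpan-+ {u = A +F ((- 1ℚ) • B)} {½ • C}
            (InSpan-+ {u = A} {(- 1ℚ) • B} (InRel-bigSum false Q) (InSpan-• (- 1ℚ) {B} (InRel-bigSum true Q)))
            (InSpan-• ½ {C} (InRel-bigSum true Q⁻)))
      where
      open ≡-Reasoning
      onZ : ∀ x y → IsA x y → ∀ m → ρZ ((3ℚ • lam Q⁺P) -F v) x y m ≡ ρZ u x y m
      onZ x y isA m = begin
        (3ℚ * a - (-⅛ * X h + (½ * S⁻ h + - 1ℚ * S h))) * φ
          ≡⟨ cong (λ t → (3ℚ * a - t) * φ) (cong₂ (λ s t → -⅛ * s + t) (bigSum-evenP-avoids Q⁻ h λ _ _ _ _ → λ ())
               (cong₂ (λ s t → ½ * s + - 1ℚ * t) (bigSum-genS-avoids Q⁻ h λ _ → λ ()) (bigSum-genS-avoids Q h λ _ → λ ()))) ⟩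
        (3ℚ * a - (-⅛ * 0ℚ + (½ * 0ℚ + - 1ℚ * 0ℚ))) * φ
          ≡⟨ solve 2 (λ a f → (con 3ℚ :* a :- (con -⅛ :* con 0ℚ :+ (con ½ :* con 0ℚ :+ con (- 1ℚ) :* con 0ℚ))) :* f := con 3ℚ :* (a :* f)) refl a φ ⟩
        3ℚ * (a * φ)
          ≡⟨ cong (3ℚ *_) (ρZ-Q⁺ x y isA m) ⟩
        3ℚ * Q⁺ x y m
          ≡⟨ solve 2 (λ p q → con 3ℚ :* p := con 3ℚ :* p :+ q :+ con ½ :* (:- (q :+ q))) refl (Q⁺ x y m) (Q⁻ x y m) ⟩
        3ℚ * Q⁺ x y m + Q⁻ x y m + ½ * (- (Q⁻ x y m + Q⁻ x y m))
          ≡⟨ cong₂ (λ s t → s + ½ * (- (Q⁻ x y m + t))) (relations-Q x y isA m) (Q⁻‖δ≡ x y isA m) ⟨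
        - Z₁ Q x y m + Z₂ Q x y m + ½ * (- Z₂ Q⁻ x y m)
          ≡⟨ solve 3 (λ a b c → :- a :+ b :+ c := :- a :+ con (- 1ℚ) :* (:- b) :+ c) refl (Z₁ Q x y m) (Z₂ Q x y m) (½ * (- Z₂ Q⁻ x y m)) ⟩
        - Z₁ Q x y m + - 1ℚ * (- Z₂ Q x y m) + ½ * (- Z₂ Q⁻ x y m)
          ≡⟨ cong₂ _+_ (cong₂ (λ s t → s + - 1ℚ * t) (ρZ-bigSum-relation₁ Q x y isA m) (ρZ-bigSum-relation₂ Q x y isA m))
                       (cong (½ *_) (ρZ-bigSum-relation₂ Q⁻ x y isA m)) ⟨
        A h * φ + - 1ℚ * (B h * φ) + ½ * (C h * φ)
          ≡⟨ solve 4 (λ a b c f → a :* f :+ con (- 1ℚ) :* (b :* f) :+ con ½ :* (c :* f) := (a :+ con (- 1ℚ) :* b :+ con ½ :* c) :* f) refl (A h) (B h) (C h) φ ⟩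
        (A h + - 1ℚ * B h + ½ * C h) * φ ∎
        where
        h = Zc x y m
        φ = 1/fac m
        a = lam Q⁺P h
      onP : ∀ x y → IsA x y → ∀ m → ρP ((3ℚ • lam Q⁺P) -F v) x y m ≡ ρP u x y m
      onP x y isA m = begin
        (3ℚ * lam Q⁺P h - (-⅛ * X h + (½ * S⁻ h + - 1ℚ * S h))) * φ
          ≡⟨ cong₂ (λ s t → (3ℚ * s - (-⅛ * X h + t)) * φ) (lam-avoids Q⁺P h λ _ _ _ _ → λ ())
               (cong₂ (λ s t → ½ * s + - 1ℚ * t) (bigSum-genS-avoids Q⁻ h λ _ → λ ()) (bigSum-genS-avoids Q h λ _ → λ ())) ⟩
        (3ℚ * 0ℚ - (-⅛ * X h + (½ * 0ℚ + - 1ℚ * 0ℚ))) * φ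
          ≡⟨ solve 2 (λ x f → (con 3ℚ :* con 0ℚ :- (con -⅛ :* x :+ (con ½ :* con 0ℚ :+ con (- 1ℚ) :* con 0ℚ))) :* f := :- (con -⅛ :* (x :* f))) refl (X h) φ ⟩
        - (-⅛ * (X h * φ))
          ≡⟨ cong (λ t → - (-⅛ * t)) (trans (ρP-evenP-bigSum Q⁻ x y isA m) (even-Q⁻ x y isA m)) ⟩
        - (-⅛ * (ℕ→ℚ 4 * Q⁻ x y m))
          ≡⟨ solve 2 (λ q r → :- (con -⅛ :* (con (ℕ→ℚ 4) :* r)) := q :+ con (- 1ℚ) :* q :+ con ½ :* r) refl (Q x y m) (Q⁻ x y m) ⟩
        Q x y m + - 1ℚ * Q x y m + ½ * Q⁻ x y m
          ≡⟨ cong₂ _+_ (cong₂ (λ s t → s + - 1ℚ * t) (ρP-bigSum-relation false Q x y isA m) (ρP-bigSum-relation true Q x y isA m))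
                       (cong (½ *_) (ρP-bigSum-relation true Q⁻ x y isA m)) ⟨
        A h * φ + - 1ℚ * (B h * φ) + ½ * (C h * φ)
          ≡⟨ solve 4 (λ a b c f → a :* f :+ con (- 1ℚ) :* (b :* f) :+ con ½ :* (c :* f) := (a :+ con (- 1ℚ) :* b :+ con ½ :* c) :* f) refl (A h) (B h) (C h) φ ⟩
        (A h + - 1ℚ * B h + ½ * C h) * φ ∎
        where
        h = Pc x y m
        φ = 1/fac m
      onK : ∀ c → 3ℚ * lam Q⁺P (Zk c) - v (Zk c) ≡ u (Zk c)
      onK c = begin
        3ℚ * lam Q⁺P z - (-⅛ * X z + (½ * S⁻ z + - 1ℚ * S z))
          ≡⟨ cong₂ (λ s t → 3ℚ * s - (-⅛ * t + (½ * S⁻ z + - 1ℚ * S z))) (lam-avoids Q⁺P z λ _ _ _ _ → λ ()) (bigSum-evenP-avoids Q⁻ z λ _ _ _ _ → λ ()) ⟩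
        3ℚ * 0ℚ - (-⅛ * 0ℚ + (½ * S⁻ z + - 1ℚ * S z))
          ≡⟨ solve 2 (λ s t → con 3ℚ :* con 0ℚ :- (con -⅛ :* con 0ℚ :+ (con ½ :* s :+ con (- 1ℚ) :* t)) := con 0ℚ :+ con (- 1ℚ) :* (:- t) :+ con ½ :* (:- s)) refl (S⁻ z) (S z) ⟩
        0ℚ + - 1ℚ * (- S z) + ½ * (- S⁻ z)
          ≡⟨ cong₂ _+_ (cong₂ (λ s t → s + - 1ℚ * t) (bigSum-relation₁-Zk Q c) (bigSum-relation₂-Zk Q c)) (cong (½ *_) (bigSum-relation₂-Zk Q⁻ c)) ⟨
        u z ∎
        where z = Zk c

-- The converse.

module Converse (N : ℕ) .{{_ : NonZero N}} (w : ℕ) where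
  open Setup N w
  open Action N w
  open FreeSpace N w
  open Relations N w
  open Spans N w
  open Coordinates N w
  open GroupAlgebra N w
  open Direct N w

  private
    infix 4 _≐_
    _≐_ : Map → Map → Set
    f ≐ g = ∀ x y m → f x y m ≡ g x y m

  even-‖ : ∀ f γ x y m → (even f ‖ γ) x y m ≡
    (f ‖ γ) x y m - (f ‖ (εM ⊗ γ)) x y m - (f ‖ (ε′M ⊗ γ)) x y m + (f ‖ (JM ⊗ γ)) x y m
  even-‖ f γ x y m = trans (‖-+ ((f -M (f ‖ εM)) -M (f ‖ ε′M)) (f ‖ JM) γ x y m) (cong₂ _+_
    (trans (‖-- (f -M (f ‖ εM)) (f ‖ ε′M) γ x y m) (cong₂ _-_
      (trans (‖-- f (f ‖ εM) γ x y m) (cong (λ t → (f ‖ γ) x y m - t) (‖-⊗ f εM γ x y m)))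
      (‖-⊗ f ε′M γ x y m)))
    (‖-⊗ f JM γ x y m))

  even-‖ε : ∀ f → (even f ‖ εM) ≐ ((- 1ℚ) *M even f)
  even-‖ε f x y m = trans (even-‖ f εM x y m) (trans
    (cong (λ t → (f ‖ εM) x y m - t - (f ‖ JM) x y m + (f ‖ ε′M) x y m) (‖-identity f x y m))
    (solve 4 (λ a b c d → b :- a :- d :+ c := con (- 1ℚ) :* (a :- b :- c :+ d)) refl
      (f x y m) ((f ‖ εM) x y m) ((f ‖ ε′M) x y m) ((f ‖ JM) x y m)))

  even-‖J : ∀ f → (even f ‖ JM) ≐ even f
  even-‖J f x y m = trans (even-‖ f JM x y m) (trans
    (cong (λ t → (f ‖ JM) x y m - (f ‖ ε′M) x y m - (f ‖ εM) x y m + t) (‖-identity f x y m))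
    (solve 4 (λ a b c d → d :- c :- b :+ a := a :- b :- c :+ d) refl
      (f x y m) ((f ‖ εM) x y m) ((f ‖ ε′M) x y m) ((f ‖ JM) x y m)))

  symmetrize : Map → Map
  symmetrize f = f +M (f ‖ δM)

  symmetrize-‖ : ∀ f γ x y m → (symmetrize f ‖ γ) x y m ≡ (f ‖ γ) x y m + (f ‖ δM ‖ γ) x y m
  symmetrize-‖ f γ = ‖-+ f (f ‖ δM) γ

  symmetrize-‖δ : ∀ f → (symmetrize f ‖ δM) ≐ symmetrize f
  symmetrize-‖δ f x y m = trans (symmetrize-‖ f δM x y m) (trans
    (cong ((f ‖ δM) x y m +_) (trans (‖-⊗ f δM δM x y m) (‖-identity f x y m)))
    (ℚP.+-comm ((f ‖ δM) x y m) (f x y m)))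

  ‖δJ : ∀ f → (f ‖ δM ‖ JM) ≐ (f ‖ JM ‖ δM)
  ‖δJ f x y m = trans (‖-⊗ f δM JM x y m) (sym (‖-⊗ f JM δM x y m))

  ‖TJ : ∀ f → (f ‖ TM ‖ JM) ≐ (f ‖ JM ‖ TM)
  ‖TJ f x y m = trans (‖-⊗ f TM JM x y m) (sym (‖-⊗ f JM TM x y m))

  symmetrize-‖J : ∀ {f} → (f ‖ JM) ≐ f → (symmetrize f ‖ JM) ≐ symmetrize f
  symmetrize-‖J {f} h x y m = trans (symmetrize-‖ f JM x y m)
    (cong₂ _+_ (h x y m) (trans (‖δJ f x y m) (‖-ext δM h x y m)))

  -- δε = J(εδ)
  symmetrize-‖ε : ∀ {f} → (f ‖ JM) ≐ f → (f ‖ εM) ≐ ((- 1ℚ) *M f) → (symmetrize f ‖ εM) ≐ ((- 1ℚ) *M symmetrize f)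
  symmetrize-‖ε {f} hJ hε x y m = begin
    (symmetrize f ‖ εM) x y m
      ≡⟨ symmetrize-‖ f εM x y m ⟩
    (f ‖ εM) x y m + (f ‖ δM ‖ εM) x y m
      ≡⟨ cong₂ _+_ (hε x y m) δε ⟩
    - 1ℚ * f x y m + - 1ℚ * (f ‖ δM) x y m
      ≡⟨ ℚP.*-distribˡ-+ (- 1ℚ) (f x y m) ((f ‖ δM) x y m) ⟨
    - 1ℚ * symmetrize f x y m ∎
    where
    open ≡-Reasoning
    δε : (f ‖ δM ‖ εM) x y m ≡ - 1ℚ * (f ‖ δM) x y m
    δε = begin
      (f ‖ δM ‖ εM) x y m           ≡⟨ ‖-⊗ f δM εM x y m ⟩
      (f ‖ (JM ⊗ (εM ⊗ δM))) x y m  ≡⟨ ‖-⊗ f JM (εM ⊗ δM) x y m ⟨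
      (f ‖ JM ‖ (εM ⊗ δM)) x y m    ≡⟨ ‖-ext (εM ⊗ δM) hJ x y m ⟩
      (f ‖ (εM ⊗ δM)) x y m         ≡⟨ ‖-⊗ f εM δM x y m ⟨
      (f ‖ εM ‖ δM) x y m           ≡⟨ ‖-ext δM hε x y m ⟩
      (((- 1ℚ) *M f) ‖ δM) x y m    ≡⟨ ‖-* (- 1ℚ) f δM x y m ⟩
      - 1ℚ * (f ‖ δM) x y m         ∎

  -- The map f obtained from a combination of relations need not be fixed by J, whereas the
  -- reconstruction requires this of ψ.
  average : Map → Map
  average f = ½ *M (f +M (f ‖ JM))

  average-‖ : ∀ f γ x y m → (average f ‖ γ) x y m ≡ ½ * ((f ‖ γ) x y m + (f ‖ JM ‖ γ) x y m)
  average-‖ f γ x y m = trans (‖-* ½ (f +M (f ‖ JM)) γ x y m) (cong (½ *_) (‖-+ f (f ‖ JM) γ x y m))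

  average-‖J : ∀ f → (average f ‖ JM) ≐ average f
  average-‖J f x y m = trans (average-‖ f JM x y m) (cong (½ *_) (trans
    (cong ((f ‖ JM) x y m +_) (trans (‖-⊗ f JM JM x y m) (‖-identity f x y m)))
    (ℚP.+-comm ((f ‖ JM) x y m) (f x y m))))

  average-‖δ : ∀ {f} → (f ‖ δM) ≐ f → (average f ‖ δM) ≐ average f
  average-‖δ {f} h x y m = trans (average-‖ f δM x y m)
    (cong (½ *_) (cong₂ _+_ (h x y m) (trans (sym (‖δJ f x y m)) (‖-ext JM h x y m))))

  Z₁≡ : ∀ f x y m → Z₁ f x y m ≡ (symmetrize f ‖ TM) x y m
  Z₁≡ f x y m = sym (symmetrize-‖ f TM x y m)

  module FromDecomposition {g : Map} (g‖J : (g ‖ JM) ≈M g) (g‖ε : (g ‖ εM) ≈M g) (e f : Map)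
    (decomposition : ∀ x y → IsA x y → ∀ m → g x y m ≡ Z₁ (even e) x y m + (Z₁ f x y m - Z₂ f x y m)) where

    -- E enters the decomposition as E|T = (E|T - E) + E; hence E is also a summand of ψ.
    E h₀ h ψ : Map
    E  = symmetrize (even e)
    h₀ = symmetrize f
    h  = average h₀
    ψ  = E +M h

    private
      E‖J : (E ‖ JM) ≐ E
      E‖J = symmetrize-‖J (even-‖J e)

      decomposition′ : g ≈M ((E ‖ TM) +M ((h₀ ‖ TM) -M h₀))
      decomposition′ x y isA m = trans (decomposition x y isA m)
        (cong₂ (λ s t → s + (t - Z₂ f x y m)) (Z₁≡ (even e) x y m) (Z₁≡ f x y m))

      -- J is central and fixes g and E. The mean of this and of the original decomposition has the
      -- J-average of h₀ in place of h₀.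
      decomposition‖J : ∀ x y → IsA x y → ∀ m →
        g x y m ≡ (E ‖ TM) x y m + ((h₀ ‖ JM ‖ TM) x y m - (h₀ ‖ JM) x y m)
      decomposition‖J x y isA m = begin
        g x y m
          ≡⟨ g‖J x y isA m ⟨
        (g ‖ JM) x y m
          ≡⟨ ‖-cong JM refl {g} {(E ‖ TM) +M ((h₀ ‖ TM) -M h₀)} decomposition′ x y isA m ⟩
        (((E ‖ TM) +M ((h₀ ‖ TM) -M h₀)) ‖ JM) x y m
          ≡⟨ trans (‖-+ (E ‖ TM) ((h₀ ‖ TM) -M h₀) JM x y m) (cong ((E ‖ TM ‖ JM) x y m +_) (‖-- (h₀ ‖ TM) h₀ JM x y m)) ⟩
        (E ‖ TM ‖ JM) x y m + ((h₀ ‖ TM ‖ JM) x y m - (h₀ ‖ JM) x y m)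
          ≡⟨ cong₂ (λ s t → s + (t - (h₀ ‖ JM) x y m)) (trans (‖TJ E x y m) (‖-ext TM E‖J x y m)) (‖TJ h₀ x y m) ⟩
        (E ‖ TM) x y m + ((h₀ ‖ JM ‖ TM) x y m - (h₀ ‖ JM) x y m) ∎
        where open ≡-Reasoning

      g≈ : g ≈M (((ψ ‖ TM) -M ψ) +M E)
      g≈ x y isA m = begin
        g x y m
          ≡⟨ solve 1 (λ g → g := con ½ :* (g :+ g)) refl (g x y m) ⟩
        ½ * (g x y m + g x y m)
          ≡⟨ cong₂ (λ s t → ½ * (s + t)) (decomposition′ x y isA m) (decomposition‖J x y isA m) ⟩
        ½ * (a + (b - c) + (a + (b′ - c′)))
          ≡⟨ solve 6 (λ a b c b′ c′ e → con ½ :* (a :+ (b :- c) :+ (a :+ (b′ :- c′)))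
               := a :+ con ½ :* (b :+ b′) :- (e :+ con ½ :* (c :+ c′)) :+ e) refl a b c b′ c′ (E x y m) ⟩
        a + ½ * (b + b′) - ψ x y m + E x y m
          ≡⟨ cong (λ t → a + t - ψ x y m + E x y m) (average-‖ h₀ TM x y m) ⟨
        a + (h ‖ TM) x y m - ψ x y m + E x y m
          ≡⟨ cong (λ t → t - ψ x y m + E x y m) (‖-+ E h TM x y m) ⟨
        (ψ ‖ TM) x y m - ψ x y m + E x y m ∎
        where
        open ≡-Reasoning
        a = (E ‖ TM) x y m
        b = (h₀ ‖ TM) x y m
        c = h₀ x y m
        b′ = (h₀ ‖ JM ‖ TM) x y m
        c′ = (h₀ ‖ JM) x y m

    open Reconstruction {ψ} {E} {g}
      (λ x y _ m → trans (‖-+ E h JM x y m) (cong₂ _+_ (E‖J x y m) (average-‖J h₀ x y m)))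
      (λ x y _ m → trans (‖-+ E h δM x y m) (cong₂ _+_ (symmetrize-‖δ (even e) x y m) (average-‖δ (symmetrize-‖δ f) x y m)))
      (λ x y _ m → symmetrize-‖δ (even e) x y m)
      (λ x y _ m → symmetrize-‖ε (even-‖J e) (even-‖ε e) x y m)
      g‖ε g≈ public

  open LinearRelation
  open Linear

  ∀-relation : {I : Set} {R : I → F → F → Set} → (∀ i → LinearRelation (R i)) → LinearRelation (λ u t → ∀ i → R i u t)
  ∀-relation h = record
    { zero-R  = λ i → zero-R (h i)
    ; plus-R  = λ p q i → plus-R (h i) (p i) (q i)
    ; scale-R = λ c p i → scale-R (h i) c (p i)
    }

  Map-relation : ∀ {L L′} → LinearMap L → LinearMap L′ → LinearRelation (λ u t → L u ≐ L′ t)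
  Map-relation lin lin′ = ∀-relation (λ x → ∀-relation (λ y → ∀-relation (λ m → equal-functionals (lin x y m) (lin′ x y m))))

  ×-relation : ∀ {R R′} → LinearRelation R → LinearRelation R′ → LinearRelation (λ u t → R u t × R′ u t)
  ×-relation h h′ = record
    { zero-R  = zero-R h , zero-R h′
    ; plus-R  = λ (p , p′) (q , q′) → plus-R h p q , plus-R h′ p′ q′
    ; scale-R = λ c (p , p′) → scale-R h c p , scale-R h′ c p′
    }

  zero-map-linear : LinearMap (λ _ → 0M)
  zero-map-linear x y m = zero-linear

  Pev-coordinates : ∀ {v} → InSpan ValidPev pevVec v → Σ F λ t → (ρZ v ≐ 0M) × (ρP v ≐ even (ρP t))
  Pev-coordinates {v} span = t
    , (λ x y m → trans (ρZ-cong v≈ x y m) (proj₁ coordinates x y m))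
    , (λ x y m → trans (ρP-cong v≈ x y m) (proj₂ coordinates x y m))
    where
    R : F → F → Set
    R u t = (ρZ u ≐ 0M) × (ρP u ≐ even (ρP t))
    generator : ∀ i → ValidPev i → Σ F (R (pevVec i))
    generator (pIdx idx) = ValidIdx-elim (λ idx → Σ F (R (pevVec (pIdx idx)))) (λ i x y _ → genP (x , y) i
      , (λ x′ y′ m → *-zeroˡ′ (1/fac m) (evenP-avoids (x , y) i (Zg (suc (toℕ m)) (suc (w ℕ.∸ toℕ m)) x′ y′) λ _ _ _ _ → λ ()))
      , ρP-evenP (x , y) i) idx
    generator (zIdx c) _ = 0F
      , (λ x y m → *-zeroˡ′ (1/fac m) (cong₂ _+_ (gen-≢ {Zk c} {Zg (suc (toℕ m)) (suc (w ℕ.∸ toℕ m)) x y} λ ())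
                                                 (*-zeroʳ′ (sign k) (gen-≢ {Zk (⊝ c)} {Zg (suc (toℕ m)) (suc (w ℕ.∸ toℕ m)) x y} λ ()))))
      , (λ x y m → trans
          (*-zeroˡ′ (1/fac m) (cong₂ _+_ (gen-≢ {Zk c} {Pg (suc (toℕ m)) (suc (w ℕ.∸ toℕ m)) x y} λ ())
                                         (*-zeroʳ′ (sign k) (gen-≢ {Zk (⊝ c)} {Pg (suc (toℕ m)) (suc (w ℕ.∸ toℕ m)) x y} λ ()))))
          (sym (zero-ℓ (even-linear ρP-linear x y m))))
    eliminated : Σ F λ u₀ → Σ F λ t → (v ≈F u₀) × R u₀ t
    eliminated = InSpan-elim {R = R} (×-relation (Map-relation ρZ-linear zero-map-linear) (Map-relation ρP-linear (even-linear ρP-linear)))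
      generator span
    t : F
    t = proj₁ (proj₂ eliminated)
    v≈ : v ≈F proj₁ eliminated
    v≈ = proj₁ (proj₂ (proj₂ eliminated))
    coordinates : R (proj₁ eliminated) t
    coordinates = proj₂ (proj₂ (proj₂ eliminated))

  -- Adding Z₁ of the P-coordinate annihilates the first family of relations. What remains is the
  -- contribution of the second family, whose P-coordinates t collects.
  Rel-coordinates : ∀ {u} → InRel u → Σ F λ t →
    (ρZ u +M Z₁ (ρP u)) ≐ (Z₁ (ρP t) -M Z₂ (ρP t))
  Rel-coordinates {u} span = t , λ x y m → trans
    (cong₂ _+_ (ρZ-cong u≈ x y m) (cong₂ _+_ (‖-ext TM (ρP-cong u≈) x y m) (‖-ext TM (‖-ext δM (ρP-cong u≈)) x y m)))
    (proj₂ (proj₂ (proj₂ eliminated)) x y m)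
    where
    left right : F → Map
    left u = ρZ u +M Z₁ (ρP u)
    right t = Z₁ (ρP t) -M Z₂ (ρP t)
    R : F → F → Set
    R u t = left u ≐ right t
    right-linear : LinearMap right
    right-linear x y m = minus-linear (Z₁-linear ρP-linear x y m) (Z₂-linear ρP-linear x y m)
    Z₁-relation : ∀ b v i → Z₁ (ρP (relation b v i)) ≐ Z₁ (ρP (genP v i))
    Z₁-relation b v i x y m = cong₂ _+_ (‖-ext TM (ρP-relation b v i) x y m) (‖-ext TM (‖-ext δM (ρP-relation b v i)) x y m)
    generator : ∀ b i x y → Σ F (R (relVec (b , suc (toℕ i) , suc (w ℕ.∸ toℕ i) , x , y)))
    generator false i x y = 0F , λ x′ y′ m → trans
      (cong₂ _+_ (ρZ-relation₁ (x , y) i x′ y′ m) (Z₁-relation false (x , y) i x′ y′ m))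
      (trans (ℚP.+-inverseˡ (Z₁ (ρP (genP (x , y) i)) x′ y′ m)) (sym (zero-ℓ (right-linear x′ y′ m))))
    generator true i x y = genP (x , y) i , λ x′ y′ m → trans
      (cong₂ _+_ (ρZ-relation₂ (x , y) i x′ y′ m) (Z₁-relation true (x , y) i x′ y′ m))
      (ℚP.+-comm (- Z₂ (ρP (genP (x , y) i)) x′ y′ m) (Z₁ (ρP (genP (x , y) i)) x′ y′ m))
    eliminated : Σ F λ u₀ → Σ F λ t → (u ≈F u₀) × R u₀ t
    eliminated = InSpan-elim {R = R}
      (Map-relation (λ x y m → plus-linear (ρZ-linear x y m) (Z₁-linear ρP-linear x y m)) right-linear)
      (λ (b , idx) → ValidIdx-elim (λ idx → Σ F (R (relVec (b , idx)))) (λ i x y _ → generator b i x y) idx)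
      span
    t : F
    t = proj₁ (proj₂ eliminated)
    u≈ : u ≈F proj₁ eliminated
    u≈ = proj₁ (proj₂ (proj₂ eliminated))

  -- Since λ(R) involves no generator P, the relation u = λ(R) - v has P-coordinate minus that of v,
  -- and v has no Z-coordinate. Inserting both in `Rel-coordinates` leaves R alone on one side.
  lam-decomposition : ∀ R → InPev (lam R) → Σ Map λ e → Σ Map λ f → ∀ x y → IsA x y → ∀ m →
    (R ∘S) x y m ≡ Z₁ (even e) x y m + (Z₁ f x y m - Z₂ f x y m)
  lam-decomposition R (v , v∈Pev , u∈Rel) = e , f , λ x y isA m → begin
    g x y m
      ≡⟨ ρZ-bigSum-genZ g x y isA m ⟨
    lam R (Zc x y m) * 1/fac m
      ≡⟨ solve 3 (λ a b f → a :* f := (a :- b) :* f :+ b :* f) refl (lam R (Zc x y m)) (v (Zc x y m)) (1/fac m) ⟩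
    ρZ u x y m + ρZ v x y m
      ≡⟨ cong (ρZ u x y m +_) (proj₁ (proj₂ pev) x y m) ⟩
    ρZ u x y m + 0ℚ
      ≡⟨ solve 2 (λ a z → a :+ con 0ℚ := z :+ (a :+ con (- 1ℚ) :* z)) refl (ρZ u x y m) (Z₁ (even e) x y m) ⟩
    Z₁ (even e) x y m + (ρZ u x y m + - 1ℚ * Z₁ (even e) x y m)
      ≡⟨ cong (λ t → Z₁ (even e) x y m + (ρZ u x y m + t)) (Z₁-ρP x y m) ⟨
    Z₁ (even e) x y m + (ρZ u x y m + Z₁ (ρP u) x y m)
      ≡⟨ cong (Z₁ (even e) x y m +_) (proj₂ rel x y m) ⟩
    Z₁ (even e) x y m + (Z₁ f x y m - Z₂ f x y m) ∎
    where
    open ≡-Reasoning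
    g : Map
    g = R ∘S
    u : F
    u = lam R -F v
    pev : Σ F λ t → (ρZ v ≐ 0M) × (ρP v ≐ even (ρP t))
    pev = Pev-coordinates v∈Pev
    rel : Σ F λ t → (ρZ u +M Z₁ (ρP u)) ≐ (Z₁ (ρP t) -M Z₂ (ρP t))
    rel = Rel-coordinates u∈Rel
    e f : Map
    e = ρP (proj₁ pev)
    f = ρP (proj₁ rel)
    Zc : Fin N → Fin N → Fin (suc w) → Gen
    Zc x y m = Zg (suc (toℕ m)) (suc (w ℕ.∸ toℕ m)) x y
    ρP-u : ρP u ≐ ((- 1ℚ) *M even e)
    ρP-u x y m = begin
      (lam R p - v p) * 1/fac m
        ≡⟨ cong (λ t → (t - v p) * 1/fac m) (bigSum-genZ-avoids g p λ _ _ _ _ → λ ()) ⟩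
      (0ℚ - v p) * 1/fac m
        ≡⟨ solve 2 (λ a f → (con 0ℚ :- a) :* f := con (- 1ℚ) :* (a :* f)) refl (v p) (1/fac m) ⟩
      - 1ℚ * ρP v x y m
        ≡⟨ cong (- 1ℚ *_) (proj₂ (proj₂ pev) x y m) ⟩
      - 1ℚ * even e x y m ∎
      where p = Pg (suc (toℕ m)) (suc (w ℕ.∸ toℕ m)) x y
    Z₁-ρP : ∀ x y m → Z₁ (ρP u) x y m ≡ - 1ℚ * Z₁ (even e) x y m
    Z₁-ρP x y m = trans
      (cong₂ _+_ (‖-scaled (- 1ℚ) (even e) ρP-u TM x y m)
                 (‖-scaled (- 1ℚ) (even e ‖ δM) (‖-scaled (- 1ℚ) (even e) ρP-u δM) TM x y m))
      (sym (ℚP.*-distribˡ-+ (- 1ℚ) ((even e ‖ TM) x y m) ((even e ‖ δM ‖ TM) x y m)))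

  converse : ∀ R → InVbar⁺ R → InPev (lam R) →
    Σ Map (λ P → InW⁺ P × (R ≈M (½ *M ((P ∣ UM) +M ((P ∣ UM) ∣ε)))))
  converse R (R∣J , R∣ε) lam∈Pev = P , InW′⇒InW⁺ {P} {Φ} P∘S Φ∈W
    , ≈M-transfer {R} {½ *M ((P ∣ UM) +M ((P ∣ UM) ∣ε))} {R ∘S} {½ *M ((Φ ‖ UM) +M (Φ ‖ UM ‖ εM))}
        (λ _ _ _ → refl)
        (λ x y m → cong₂ (λ s t → ½ * (s + t)) (PU x y m) (ε-transfer {P ∣ UM} {Φ ‖ UM} PU x y m))
        g≡½
    where
    decomposition : Σ Map λ e → Σ Map λ f → ∀ x y → IsA x y → ∀ m →
      (R ∘S) x y m ≡ Z₁ (even e) x y m + (Z₁ f x y m - Z₂ f x y m)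
    decomposition = lam-decomposition R lam∈Pev
    open FromDecomposition {R ∘S}
      (λ x y isA m → trans (sym (∘S-∣ R JM x y m)) (∘S-cong {R ∣ JM} {R} R∣J x y isA m))
      (λ x y isA m → trans (sym (∘S-∣ε R x y m)) (∘S-cong {R ∣ε} {R} R∣ε x y isA m))
      (proj₁ decomposition) (proj₁ (proj₂ decomposition)) (proj₂ (proj₂ decomposition))
    P : Map
    P = Φ ∘S⁻¹
    P∘S : (P ∘S) ≐ Φ
    P∘S = ∘S⁻¹-∘S Φ
    PU : ((P ∣ UM) ∘S) ≐ (Φ ‖ UM)
    PU = ∣-transfer {P} {Φ} UM P∘S

  -- R agrees with Q⁺ on A(N), so λ(R) = λ(Q⁺), and a third of the membership of 3λ(Q⁺) is what is
  -- wanted.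
  converse⁻ : ∀ R → Σ Map (λ P → InW⁺ P × (R ≈M (½ *M ((P ∣ UM) +M ((P ∣ UM) ∣ε))))) → InPev (lam R)
  converse⁻ R (P , P∈W , R≈) = (⅓ • v) , InSpan-• ⅓ {v} (proj₁ (proj₂ lam-Q⁺-even))
    , InSpan-≈F {u = lam R -F (⅓ • v)} {⅓ • ((3ℚ • lam Q⁺P) -F v)} scaled (InSpan-• ⅓ {(3ℚ • lam Q⁺P) -F v} (proj₂ (proj₂ lam-Q⁺-even)))
    where
    open ForPeriodPolynomial {P} P∈W using (Q⁺P; lam-Q⁺-even)
    v : F
    v = proj₁ lam-Q⁺-even
    ⅓ : ℚ
    ⅓ = (ℤ.+ 1) ℚ./ 3
    scaled : (lam R -F (⅓ • v)) ≈F (⅓ • ((3ℚ • lam Q⁺P) -F v))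
    scaled g = trans (cong (λ t → t - ⅓ * v g) (bigSum-cong genZ {R ∘S} {Q⁺P ∘S} (∘S-cong {R} {Q⁺P} R≈) g))
      (solve 2 (λ a b → a :- con ⅓ :* b := con ⅓ :* (con 3ℚ :* a :- b)) refl (lam Q⁺P g) (v g))

theorem2p6 : (N w : ℕ) .{{_ : NonZero N}} → ¬ ((w ≡ 0) × (N ≡ 1)) →
    let open Setup N w in
    (∀ (P : Map) → InW⁺ P →
      let Q  = P ∣ UM
          Q⁺ = ½ *M (Q +M (Q ∣ε))
          Q⁻ = ½ *M (Q -M (Q ∣ε))
      in InVbar⁻sym Q⁻
         × ((3ℚ • lam Q⁺) ≈D ((0F -F lam Q⁻) -F lamS Q))
         × InPev (3ℚ • lam Q⁺))
    × (∀ (R : Map) → InVbar⁺ R →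
        (InPev (lam R) ⇔ Σ Map (λ P → InW⁺ P × (R ≈M (½ *M ((P ∣ UM) +M ((P ∣ UM) ∣ε)))))))
theorem2p6 N w _ =
    (λ P P∈W → let open Direct.ForPeriodPolynomial N w {P} P∈W in Q⁻P-symmetric , lam-Q⁺ , lam-Q⁺-even)
  , (λ R R∈V → mk⇔ (Converse.converse N w R R∈V) (Converse.converse⁻ N w R))
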